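{- Let $\ell\ne p$ be a prime and let $e_i$ be the multiplicity of $\ell^i$ as an elementary divisor of the adjacency matrix $A$ of the skew-lines graph $\Gamma$ on the $2$-dimensional subspaces of $V=\mathbb F_q^n$ ($n\ge4$, $q=p^t$). Put $f=[n]-1$ and $g=\left[\begin{smallmatrix}n\\2\end{smallmatrix}\right]_q-[n]$. In each case below, $e_i=0$ for all $i$ not listed. (A) Suppose $\ell\nmid q+1$. If $\ell\nmid[n-2]$ and $\ell\nmid[n-3]$, then $\ell\nmid|S(\Gamma)|$. Otherwise: (i) if $\ell\mid[n-2]$ and $\ell\nmid[n-3]$, with $a=v_\ell\left(\left[\begin{smallmatrix}n-2\\2\end{smallmatrix}\right]_q\right)$: $e_a=1$, $e_0=f+g$; (ii) if $\ell\nmid[n-2]$ and $\ell\mid[n-3]$, with $a=v_\ell([n-3])$: $e_a=f+1$, $e_0=g$. (B) Suppose $\ell\mid q+1$. (i) If $\ell\mid[n-2]$ (so $n$ is even) and $\ell\nmid[(n-2)/2]_{q^2}$, then $\ell\nmid|S(\Gamma)|$. (ii) If $\ell\mid[n-2]$ and $\ell\mid[(n-2)/2]_{q^2}$, with $a=v_\ell\left(\left[\begin{smallmatrix}n-2\\2\end{smallmatrix}\right]_q\right)$: $e_a=1$, $e_0=f+g$. (iii) If $\ell\mid[n-3]$ (so $n$ is odd) and $\ell\nmid[(n-3)/2]_{q^2}$, with $a=v_\ell([n-3])$: $e_a=f$, $e_0=g+1$. (iv) If $\ell\mid[n-3]$ and $\ell\mid[(n-3)/2]_{q^2}$, with $a=v_\ell(q+1)$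 and $b=v_\ell\left(\frac{[n-3]}{q+1}\right)$: $e_{a+b}=f$, $e_b=1$, $e_0=g$.
   Context: Let $p$ be a prime, $q=p^t$ with $t\ge1$, $n\ge4$, and $V$ an $n$-dimensional vector space over $\mathbb F_q$. Notation: $[m]=\frac{q^m-1}{q-1}$, $[m]_{q^2}=\frac{q^{2m}-1}{q^2-1}$, and $\left[\begin{smallmatrix}m\\k\end{smallmatrix}\right]_q$ is the number of $k$-dimensional subspaces of $\mathbb F_q^m$; $v_\ell$ is the $\ell$-adic valuation. The skew-lines graph $\Gamma$ has as vertices the $2$-dimensional subspaces of $V$, two being adjacent when their intersection is $\{0\}$; $A$ is its adjacency matrix. The Smith group $S(\Gamma)$ is the (finite) cokernel of $A$ over $\mathbb Z$. The multiplicity of $\ell^i$ as an elementary divisor of an integer matrix is the number of nonzero diagonal entries of its Smith normal form whose $\ell$-adic valuation is exactly $i$. -}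

module Defs where

open import Algebra.Bundles using (AbelianGroup; CommutativeRing)
open import Data.Bool.Base using (if_then_else_)
open import Data.Fin.Base as Fin using (Fin; finToFun; funToFin)
import Data.Fin.Properties as Fin
open import Data.Integer.Base as ℤ using (ℤ; 0ℤ; 1ℤ)
import Data.Integer.Properties as ℤ
open import Data.Integer.Tactic.RingSolver using (solve-∀)
open import Data.List.Base using (List; []; _∷_; allFin; concatMap; deduplicate; filter; length; lookup)
open import Data.List.Membership.Propositional using (lose)
open import Data.List.Membership.Propositional.Properties using (∈-allFin; ∈-lookup)
open import Data.List.Relation.Unary.All as All using ()
open import Data.List.Relation.Unary.AllPairs using (_∷_)
open import Data.List.Relation.Unary.Any using (here)
import Data.List.Relation.Unary.Any.Properties as Any
open import Data.List.Relation.Unary.Enumerates.Setoid using (IsEnumeration)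
import Data.List.Relation.Unary.Enumerates.Setoid.Properties as Enumerates
import Data.List.Relation.Unary.Unique.DecSetoid.Properties as UniqueDec
open import Data.List.Relation.Unary.Unique.Setoid using (Unique)
open import Data.Nat.Base using (ℕ; zero; suc; _^_; _∸_; _/_; NonTrivial; 2+)
open import Data.Nat.Divisibility using (_∣_; _∤_; _∣?_)
open import Data.Product.Base using (∃; _×_; _,_; proj₁; proj₂)
open import Data.Vec.Functional using (Vector)
import Data.Vec.Functional.Relation.Binary.Equality.Setoid as VecEquality
open import Function.Base using (_∘_)
open import Function.Bundles using (Bijection; Surjection)
open import Function.Consequences.Setoid using (strictlySurjective⇒surjective)
open import Level using (Level; _⊔_) renaming (suc to lsuc)
open import Relation.Binary.Bundles using (Setoid; DecSetoid)
open import Relation.Binary.PropositionalEquality as ≡ using (_≡_; refl)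
open import Relation.Nullary.Decidable using (Dec; yes; no; does; map′; _×-dec_; _→-dec_; ¬?)
open import Relation.Nullary.Negation using (contradiction)
open import Relation.Unary using (Pred; Decidable; _∩_; _⊆_; _≐_)
open import Relation.Unary.Properties using (≐-refl; ≐-sym; ≐-trans)
open import Algebra.Properties.Group (AbelianGroup.group ℤ.+-0-abelianGroup) using (inverseʳ-unique)
import Algebra.Properties.Semiring.Sum as Sum

private
  variable
    a b c r : Level

Finite : Setoid a b → Set (a ⊔ b)
Finite S = ∃ λ N → Bijection (≡.setoid (Fin N)) S

card : {S : Setoid a b} → Finite S → ℕ
card = proj₁

module Search {S : Setoid a b} {N : ℕ} (enum : Surjection (≡.setoid (Fin N)) S) where
  open Setoid S
  open Surjection enum using (to; strictlySurjective)

  all? : ∀ {p} {P : Pred Carrier p} → (∀ {x y} → x ≈ y → P x → P y) →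
         Decidable P → Dec (∀ x → P x)
  all? resp P? = map′
    (λ h x → resp (proj₂ (strictlySurjective x)) (h (proj₁ (strictlySurjective x))))
    (λ h i → h (to i)) (Fin.all? (P? ∘ to))

  any? : ∀ {p} {P : Pred Carrier p} → (∀ {x y} → x ≈ y → P x → P y) →
         Decidable P → Dec (∃ P)
  any? resp P? = map′
    (λ (i , h) → to i , h)
    (λ (x , h) → proj₁ (strictlySurjective x) , resp (sym (proj₂ (strictlySurjective x))) h)
    (Fin.any? (P? ∘ to))

lookup-injective : (S : Setoid a b) → let open Setoid S in
                   ∀ {xs} → Unique S xs → ∀ i j → lookup xs i ≈ lookup xs j → i ≡ j
lookup-injective S (_ ∷ _) Fin.zero    Fin.zero    _  = refl
lookup-injective S (h ∷ _) Fin.zero    (Fin.suc j) eq = contradiction eq (All.lookup h (∈-lookup j))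
lookup-injective S (h ∷ _) (Fin.suc i) Fin.zero    eq = contradiction (Setoid.sym S eq) (All.lookup h (∈-lookup i))
lookup-injective S (_ ∷ u) (Fin.suc i) (Fin.suc j) eq = ≡.cong Fin.suc (lookup-injective S u i j eq)

enumeration⇒finite : (DS : DecSetoid a b) → let S = DecSetoid.setoid DS in
                     ∀ {xs} → IsEnumeration S xs → Finite S
enumeration⇒finite DS {xs} enum = length ys , record
  { to        = lookup ys
  ; cong      = λ { refl → Setoid.refl S }
  ; bijective = (λ {i} {j} → lookup-injective S (UniqueDec.deduplicate-! DS xs) i j)
              , Enumerates.lookup-surjective S (Enumerates.deduplicate⁺ DS enum)
  }
  where
  S = DecSetoid.setoid DS
  ys = deduplicate (DecSetoid._≟_ DS) xs

vectors : {S : Setoid a b} {N : ℕ} → Surjection (≡.setoid (Fin N)) S →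
          ∀ n → Surjection (≡.setoid (Fin (N ^ n))) (VecEquality.≋-setoid S n)
vectors {S = S} {N} enum n = record
  { to         = λ i → to ∘ finToFun i
  ; cong       = λ { refl _ → Setoid.refl S }
  ; surjective = strictlySurjective⇒surjective (≡.setoid (Fin (N ^ n))) (VecEquality.≋-setoid S n)
                   (λ { refl _ → Setoid.refl S })
                   λ v → funToFin (proj₁ ∘ strictlySurjective ∘ v) , λ i →
                     Setoid.trans S
                       (Setoid.reflexive S (≡.cong to (Fin.finToFun-funToFin (proj₁ ∘ strictlySurjective ∘ v) i)))
                       (proj₂ (strictlySurjective (v i)))
  }
  where open Surjection enum using (to; strictlySurjective)

-- Any two fields with q elements are isomorphic, so this is 𝔽_q for q = p ^ t.
record FiniteField c r (q : ℕ) : Set (lsuc (c ⊔ r)) where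
  field
    commutativeRing : CommutativeRing c r
  open CommutativeRing commutativeRing public
  field
    1≉0      : 1# ≉ 0#
    inverse  : ∀ x → x ≉ 0# → ∃ λ y → y * x ≈ 1#
    elements : Bijection (≡.setoid (Fin q)) setoid

order-nonTrivial : ∀ {q} → FiniteField c r q → NonTrivial q
order-nonTrivial {q = q} K = go q elements
  where
  open FiniteField K hiding (zero)
  go : ∀ q → Bijection (≡.setoid (Fin q)) setoid → NonTrivial q
  go zero bij with () ← proj₁ (Bijection.strictlySurjective bij 0#)
  go (suc zero) bij
    with Bijection.strictlySurjective bij 0# | Bijection.strictlySurjective bij 1#
  ... | Fin.zero , e | Fin.zero , e′ = contradiction (trans (sym e′) e) 1≉0
  go (2+ _) _ = _

-- (Q ^ m - 1) / (Q - 1); both subtractions and the division are exact.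
qNumber : (Q : ℕ) .{{_ : NonTrivial Q}} → ℕ → ℕ
qNumber Q@(2+ _) m = (Q ^ m ∸ 1) / (Q ∸ 1)

module LinearAlgebra {q : ℕ} (K : FiniteField c r q) where
  private
    module K = FiniteField K
    module KSum = Sum K.semiring

  open VecEquality K.setoid public using (_≋_; ≋-refl; ≋-sym; ≋-trans; ≋-setoid)

  V : ℕ → Set c
  V n = Vector K.Carrier n

  0ᵛ : ∀ {n} → V n
  0ᵛ _ = K.0#

  infixl 6 _+ᵛ_
  _+ᵛ_ : ∀ {n} → V n → V n → V n
  (u +ᵛ v) i = u i K.+ v i

  infixl 7 _·ᵛ_
  _·ᵛ_ : ∀ {n} → K.Carrier → V n → V n
  (x ·ᵛ v) i = x K.* v i

  combination : ∀ {n k} → V k → (Fin k → V n) → V n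
  combination {k = k} x u j = KSum.sum λ i → x i K.* u i j

  record Subspace (n : ℕ) : Set (lsuc (c ⊔ r)) where
    field
      member   : Pred (V n) (c ⊔ r)
      resp-≋   : ∀ {u v} → u ≋ v → member u → member v
      0-closed : member 0ᵛ
      +-closed : ∀ {u v} → member u → member v → member (u +ᵛ v)
      ·-closed : ∀ x {v} → member v → member (x ·ᵛ v)
  open Subspace public

  Span : ∀ {n k} → (Fin k → V n) → Pred (V n) (c ⊔ r)
  Span {k = k} u v = ∃ λ (x : V k) → v ≋ combination x u

  LinearlyIndependent : ∀ {n k} → (Fin k → V n) → Set (c ⊔ r)
  LinearlyIndependent {k = k} u = ∀ (x : V k) → combination x u ≋ 0ᵛ → x ≋ 0ᵛ

  HasDimension : ∀ {n} → Subspace n → ℕ → Set (c ⊔ r)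
  HasDimension {n} W k = ∃ λ (u : Fin k → V n) → LinearlyIndependent u × (member W ≐ Span u)

  -- The k-dimensional subspaces of K ^ n, identified when they have the
  -- same elements.
  Grassmannian : ℕ → ℕ → Setoid (lsuc (c ⊔ r)) (c ⊔ r)
  Grassmannian n k = record
    { Carrier       = ∃ λ (W : Subspace n) → HasDimension W k
    ; _≈_           = λ (W , _) (W′ , _) → member W ≐ member W′
    ; isEquivalence = record { refl = ≐-refl ; sym = ≐-sym ; trans = ≐-trans }
    }

  private
    scalars : Surjection (≡.setoid (Fin q)) K.setoid
    scalars = Bijection.surjection K.elements

    tuples : ∀ n → Surjection (≡.setoid (Fin (q ^ n))) (≋-setoid n)
    tuples = vectors scalars

    frames : ∀ n k → Surjection (≡.setoid (Fin ((q ^ n) ^ k))) (VecEquality.≋-setoid (≋-setoid n) k)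
    frames n = vectors (tuples n)

  _≟ᴷ_ : ∀ x y → Dec (x K.≈ y)
  x ≟ᴷ y with Surjection.strictlySurjective scalars x | Surjection.strictlySurjective scalars y
  ... | i , e | j , e′ = map′
    (λ { refl → K.trans (K.sym e) e′ })
    (λ x≈y → Bijection.injective K.elements (K.trans e (K.trans x≈y (K.sym e′))))
    (i Fin.≟ j)

  _≋?_ : ∀ {n} (u v : V n) → Dec (u ≋ v)
  u ≋? v = Fin.all? λ i → u i ≟ᴷ v i

  combination-cong : ∀ {n k} {x y : V k} {u v : Fin k → V n} → x ≋ y → (∀ i → u i ≋ v i) →
                     combination x u ≋ combination y v
  combination-cong x≋y u≋v j = KSum.sum-cong-≋ λ i → K.*-cong (x≋y i) (u≋v i j)

  -- The decision procedures and the enumeration are abstract only to keep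
  -- terms small: their types determine everything used below.
  abstract
    span? : ∀ {n k} (u : Fin k → V n) → Decidable (Span u)
    span? {k = k} u v = Search.any? (tuples k)
      (λ x≋y e → ≋-trans e (combination-cong x≋y λ _ → ≋-refl))
      (λ x → v ≋? combination x u)

  abstract
    linearlyIndependent? : ∀ {n k} (u : Fin k → V n) → Dec (LinearlyIndependent u)
    linearlyIndependent? {k = k} u = Search.all? (tuples k)
      (λ x≋y h e → ≋-trans (≋-sym x≋y) (h (≋-trans (combination-cong x≋y λ _ → ≋-refl) e)))
      (λ x → (combination x u ≋? 0ᵛ) →-dec (x ≋? 0ᵛ))

  span : ∀ {n k} → (Fin k → V n) → Subspace n
  span {k = k} u = record
    { member   = Span u
    ; resp-≋   = λ e (x , h) → x , ≋-trans (≋-sym e) h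
    ; 0-closed = 0ᵛ , λ j → K.sym (K.trans
        (KSum.sum-cong-≋ {k} {λ i → K.0# K.* u i j} {λ _ → K.0#} λ i → K.zeroˡ (u i j))
        (KSum.sum-replicate-zero k))
    ; +-closed = λ (x , h) (y , h′) → x +ᵛ y , λ j →
        K.trans (K.+-cong (h j) (h′ j)) (K.sym (K.trans
          (KSum.sum-cong-≋ {k} {λ i → (x i K.+ y i) K.* u i j} {λ i → x i K.* u i j K.+ y i K.* u i j}
            λ i → K.distribʳ (u i j) (x i) (y i))
          (KSum.∑-distrib-+ (λ i → x i K.* u i j) (λ i → y i K.* u i j))))
    ; ·-closed = λ z (x , h) → z ·ᵛ x , λ j → K.trans (K.*-congˡ (h j)) (K.trans
        (KSum.*-distribˡ-sum z (λ i → x i K.* u i j))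
        (KSum.sum-cong-≋ {k} {λ i → z K.* (x i K.* u i j)} {λ i → z K.* x i K.* u i j}
          λ i → K.sym (K.*-assoc z (x i) (u i j))))
    }

  member? : ∀ {n k} ((W , _) : Setoid.Carrier (Grassmannian n k)) → Decidable (member W)
  member? (_ , u , _ , f , g) v = map′ g f (span? u v)

  ⊆? : ∀ {n p} {P Q : Pred (V n) p} → (∀ {u v} → u ≋ v → P u → P v) → (∀ {u v} → u ≋ v → Q u → Q v) →
       Decidable P → Decidable Q → Dec (P ⊆ Q)
  ⊆? {n} rP rQ P? Q? = map′ (λ h {v} → h v) (λ h v → h {v})
    (Search.all? (tuples n) (λ e h Pv → rQ e (h (rP (≋-sym e) Pv))) λ v → P? v →-dec Q? v)

  grassmannianDecSetoid : ℕ → ℕ → DecSetoid (lsuc (c ⊔ r)) (c ⊔ r)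
  grassmannianDecSetoid n k = record
    { isDecEquivalence = record
      { isEquivalence = Setoid.isEquivalence (Grassmannian n k)
      ; _≟_ = λ X@(W , _) X′@(W′ , _) →
          ⊆? (resp-≋ W) (resp-≋ W′) (member? X) (member? X′) ×-dec
          ⊆? (resp-≋ W′) (resp-≋ W) (member? X′) (member? X)
      }
    }

  spans : ∀ {n k} (u : Fin k → V n) → Dec (LinearlyIndependent u) → List (Setoid.Carrier (Grassmannian n k))
  spans u (yes li) = (span u , u , li , ≐-refl) ∷ []
  spans u (no  _)  = []

  abstract
    grassmannian-finite : ∀ n k → Finite (Grassmannian n k)
    grassmannian-finite n k = enumeration⇒finite (grassmannianDecSetoid n k) {xs = concatMap subspaces (allFin _)}
      λ X → Any.concatMap⁺ subspaces (lose (∈-allFin _) (complete X))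
      where
      open Surjection (frames n k) using (to; strictlySurjective)
      open import Data.List.Membership.Setoid (Grassmannian n k) using (_∈_)

      subspaces : Fin ((q ^ n) ^ k) → List (Setoid.Carrier (Grassmannian n k))
      subspaces i = spans (to i) (linearlyIndependent? (to i))

      ∈-spans : ∀ (X : Setoid.Carrier (Grassmannian n k)) v → (∀ i → v i ≋ proj₁ (proj₂ X) i) →
                ∀ d → X ∈ spans v d
      ∈-spans (_ , u , li , f , g) v e (yes _) = here
        ( (λ Wv → let (x , h) = f Wv in x , ≋-trans h (combination-cong ≋-refl λ j → ≋-sym (e j)))
        , (λ (x , h) → g (x , ≋-trans h (combination-cong ≋-refl e))) )
      ∈-spans (_ , u , li , f , g) v e (no ¬li) = contradiction
        (λ x h → li x (≋-trans (combination-cong ≋-refl λ j → ≋-sym (e j)) h)) ¬li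

      complete : ∀ (X : Setoid.Carrier (Grassmannian n k)) → X ∈ subspaces (proj₁ (strictlySurjective (proj₁ (proj₂ X))))
      complete X@(_ , u , _) = ∈-spans X _ (proj₂ (strictlySurjective u)) (linearlyIndependent? _)

  gaussianBinomial : ℕ → ℕ → ℕ
  gaussianBinomial m k = card (grassmannian-finite m k)

  [_] : ℕ → ℕ
  [ m ] = qNumber q {{order-nonTrivial K}} m

  [_]q² : ℕ → ℕ
  [ m ]q² = qNumber (q ^ 2) {{square-nonTrivial q {{order-nonTrivial K}}}} m
    where
    square-nonTrivial : ∀ Q → .{{NonTrivial Q}} → NonTrivial (Q ^ 2)
    square-nonTrivial (2+ _) = _

  Line : ℕ → Set (lsuc (c ⊔ r))
  Line n = Setoid.Carrier (Grassmannian n 2)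

  Skew : ∀ {n} → Line n → Line n → Set (c ⊔ r)
  Skew (L , _) (M , _) = (member L ∩ member M) ≐ (_≋ 0ᵛ)

  abstract
    skew? : ∀ {n} (L M : Line n) → Dec (Skew L M)
    skew? {n} X@(L , _) Y@(M , _) = map′
      (λ h → (λ {v} → h v)
           , λ v≋0 → resp-≋ L (≋-sym v≋0) (0-closed L) , resp-≋ M (≋-sym v≋0) (0-closed M))
      (λ h v → proj₁ h {v})
      (Search.all? (tuples n)
        (λ e h (l , m) → ≋-trans (≋-sym e) (h (resp-≋ L (≋-sym e) l , resp-≋ M (≋-sym e) m)))
        (λ v → (member? X v ×-dec member? Y v) →-dec (v ≋? 0ᵛ)))

  line : ∀ n → Fin (gaussianBinomial n 2) → Line n
  line n = Bijection.to (proj₂ (grassmannian-finite n 2))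

  -- The vertices are listed in some fixed order; neither the Smith normal
  -- form nor the cokernel up to isomorphism depends on which.
  skewLinesMatrix : ∀ n → Fin (gaussianBinomial n 2) → Fin (gaussianBinomial n 2) → ℤ
  skewLinesMatrix n i j = if does (skew? (line n i) (line n j)) then 1ℤ else 0ℤ

private
  module ℤSum = Sum ℤ.+-*-semiring

Matrix : ℕ → Set
Matrix N = Fin N → Fin N → ℤ

infix 4 _≗ᴹ_
_≗ᴹ_ : ∀ {N} → Matrix N → Matrix N → Set
A ≗ᴹ B = ∀ i j → A i j ≡ B i j

infixl 7 _*ᴹ_
_*ᴹ_ : ∀ {N} → Matrix N → Matrix N → Matrix N
(A *ᴹ B) i j = ℤSum.sum λ k → A i k ℤ.* B k j

diagonal : ∀ {N} → Vector ℤ N → Matrix N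
diagonal d i j = if does (i Fin.≟ j) then d i else 0ℤ

Invertible : ∀ {N} → Matrix N → Set
Invertible P = ∃ λ P⁻¹ → (P *ᴹ P⁻¹ ≗ᴹ diagonal (λ _ → 1ℤ)) × (P⁻¹ *ᴹ P ≗ᴹ diagonal (λ _ → 1ℤ))

-- diagonal (+ d) is the Smith normal form of A.  Since x ∣ 0 for all x while
-- 0 ∣ x only for x = 0, any zero entries come last.
record IsSmithNormalForm {N} (A : Matrix N) (d : Vector ℕ N) : Set where
  field
    P Q          : Matrix N
    P-invertible : Invertible P
    Q-invertible : Invertible Q
    PAQ≗D        : P *ᴹ A *ᴹ Q ≗ᴹ diagonal (ℤ.+_ ∘ d)
    divisibility : ∀ {i j} → i Fin.≤ j → d i ∣ d j

-- v_ℓ(x) = k.  No k satisfies this when x = 0.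
HasValuation : (ℓ x k : ℕ) → Set
HasValuation ℓ x k = (ℓ ^ k ∣ x) × (ℓ ^ suc k ∤ x)

hasValuation? : ∀ ℓ x k → Dec (HasValuation ℓ x k)
hasValuation? ℓ x k = (ℓ ^ k ∣? x) ×-dec ¬? (ℓ ^ suc k ∣? x)

-- The multiplicity of ℓ ^ i as an elementary divisor of a matrix with
-- Smith normal form diagonal d.
multiplicity : ∀ {N} → Vector ℕ N → (ℓ i : ℕ) → ℕ
multiplicity {N} d ℓ i = length (filter (λ k → hasValuation? ℓ (d k) i) (allFin N))

infixr 7 _*ᵛ_
_*ᵛ_ : ∀ {N} → Matrix N → Vector ℤ N → Vector ℤ N
(A *ᵛ x) i = ℤSum.sum λ j → A i j ℤ.* x j

*ᵛ-zero : ∀ {N} (A : Matrix N) i → (A *ᵛ λ _ → 0ℤ) i ≡ 0ℤ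
*ᵛ-zero {N} A i = ≡.trans
  (ℤSum.sum-cong-≗ {N} {λ j → A i j ℤ.* 0ℤ} {λ _ → 0ℤ} λ j → ℤ.*-zeroʳ (A i j))
  (ℤSum.sum-replicate-zero N)

*ᵛ-+ : ∀ {N} (A : Matrix N) x y i → (A *ᵛ λ j → x j ℤ.+ y j) i ≡ (A *ᵛ x) i ℤ.+ (A *ᵛ y) i
*ᵛ-+ {N} A x y i = ≡.trans
  (ℤSum.sum-cong-≗ {N} {λ j → A i j ℤ.* (x j ℤ.+ y j)} {λ j → A i j ℤ.* x j ℤ.+ A i j ℤ.* y j}
    λ j → ℤ.*-distribˡ-+ (A i j) (x j) (y j))
  (ℤSum.∑-distrib-+ (λ j → A i j ℤ.* x j) (λ j → A i j ℤ.* y j))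

*ᵛ-neg : ∀ {N} (A : Matrix N) x i → (A *ᵛ λ j → ℤ.- x j) i ≡ ℤ.- (A *ᵛ x) i
*ᵛ-neg {N} A x i = inverseʳ-unique _ _ cancel
  where
  open ≡.≡-Reasoning
  cancel : (A *ᵛ x) i ℤ.+ (A *ᵛ λ j → ℤ.- x j) i ≡ 0ℤ
  cancel = begin
    (A *ᵛ x) i ℤ.+ (A *ᵛ λ j → ℤ.- x j) i  ≡⟨ *ᵛ-+ A x (λ j → ℤ.- x j) i ⟨
    (A *ᵛ λ j → x j ℤ.+ ℤ.- x j) i         ≡⟨ ℤSum.sum-cong-≗ {N} (λ j → ≡.cong (A i j ℤ.*_) (ℤ.+-inverseʳ (x j))) ⟩
    (A *ᵛ λ _ → 0ℤ) i                      ≡⟨ *ᵛ-zero A i ⟩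
    0ℤ                                     ∎

image : ∀ {N} → Matrix N → Pred (Vector ℤ N) _
image A y = ∃ λ x → ∀ i → y i ≡ (A *ᵛ x) i

cokernel : ∀ {N} → Matrix N → Setoid _ _
cokernel {N} A = record
  { Carrier = Vector ℤ N
  ; _≈_     = λ u v → image A λ i → u i ℤ.- v i
  ; isEquivalence = record
    { refl  = λ {u} → (λ _ → 0ℤ) , λ i → ≡.trans (ℤ.+-inverseʳ (u i)) (≡.sym (*ᵛ-zero A i))
    ; sym   = λ {u} {v} (x , h) → (λ j → ℤ.- x j) , λ i →
        ≡.trans (swap (u i) (v i)) (≡.trans (≡.cong ℤ.-_ (h i)) (≡.sym (*ᵛ-neg A x i)))
    ; trans = λ {u} {v} {w} (x , h) (y , h′) → (λ j → x j ℤ.+ y j) , λ i →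
        ≡.trans (telescope (u i) (v i) (w i)) (≡.trans (≡.cong₂ ℤ._+_ (h i) (h′ i)) (≡.sym (*ᵛ-+ A x y i)))
    }
  }
  where
  swap : ∀ x y → y ℤ.- x ≡ ℤ.- (x ℤ.- y)
  swap = solve-∀
  telescope : ∀ x y z → x ℤ.- z ≡ (x ℤ.- y) ℤ.+ (y ℤ.- z)
  telescope = solve-∀

{-# OPTIONS --safe #-}

-- Write N for the point-line incidence matrix of PG(n-1, q), u = [n-3] and
-- k for the number of lines of PG(n-3, q).  Two lines meet in q + 1 points,
-- one point or none, so A = q I + J - NᵀN, while NNᵀ = q [n-2] I + J because
-- two points lie on a unique line.  Let ℓ ≠ p.  Modulo ℓ^j the number q is
-- invertible, so the kernel of q I - X Y is isomorphic to that of q I - Y X;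
-- for X = (Nᵀ | -1) and Y = (N ; 1) the latter is an explicit matrix whose
-- size is about the number of points, and it diagonalises to
-- diag(k, u, ..., u) with f entries u.  The number of elementary divisors
-- divisible by ℓ^j is the dimension of the reduction modulo ℓ of the kernel
-- modulo ℓ^j.  Hence, at every ℓ ≠ p, A has elementary divisors 1^g, u^f, k,
-- and all the cases follow from (q + 1) k = [n-2] u.
module Submission where

import Algebra.Properties.Semiring.Sum as Sum
open import Data.Bool.Base using (if_then_else_)
open import Data.Fin.Base as Fin using (Fin; zero; suc)
import Data.Fin.Properties as Fin
open import Data.Integer.Base as ℤ using (ℤ; 0ℤ; 1ℤ; -1ℤ)
import Data.Integer.Divisibility.Signed as ℤ∣
import Data.Integer.DivMod as ℤ
import Data.Integer.Properties as ℤ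
open import Data.Integer.Tactic.RingSolver using (solve-∀)
open import Data.List.Base using (_∷_; []; allFin; filter; length; lookup; tabulate)
open import Data.List.Membership.Propositional.Properties using (∈-allFin; ∈-filter⁺; ∈-filter⁻; ∈-lookup)
open import Data.List.Properties using (filter-all; filter-none; length-tabulate)
open import Data.List.Relation.Unary.All as All using ()
open import Data.List.Relation.Unary.Any as Any using ()
open import Data.List.Relation.Unary.Any.Properties using (lookup-index)
import Data.List.Relation.Unary.Unique.Propositional.Properties as Unique
open import Data.Nat.Base as ℕ using (ℕ; zero; suc)
open import Data.Nat.Divisibility using (_∣_; _∤_)
import Data.Nat.Divisibility as ℕ
import Data.Nat.DivMod as ℕ
import Data.Nat.Induction as ℕ
import Data.Nat.Properties as ℕ
open import Data.Nat.Tactic.RingSolver using () renaming (solve-∀ to ℕ-solve-∀)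
open import Data.Nat.Primality using (Prime; euclidsLemma; ¬prime[1]; prime⇒irreducible; prime⇒nonZero; prime⇒nonTrivial)
open import Data.Nat.Coprimality using (Coprime; coprime-Bézout)
open import Data.Nat.GCD using (module Bézout)
open import Data.Product.Base using (∃; ∃₂; _×_; _,_; proj₁; proj₂)
open import Data.Sum.Base using (_⊎_; inj₁; inj₂; [_,_]′)
open import Data.Vec.Functional using (Vector)
open import Function.Bundles using (Bijection; Surjection)
open import Function.Base using (_∘_; flip)
open import Function.Consequences.Setoid using (strictlySurjective⇒surjective)
open import Induction.WellFounded using (Acc; acc)
open import Relation.Binary.Bundles using (Setoid)
open import Relation.Binary.Definitions using (tri<; tri≈; tri>)
open import Relation.Binary.PropositionalEquality as ≡ using (_≡_; _≢_; refl; sym; trans; cong; cong₂; subst)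
open import Relation.Nullary.Decidable using (Dec; yes; no; does; _×-dec_; ¬?)
open import Relation.Nullary.Negation using (¬_; contradiction)
open import Relation.Unary using (Pred; Decidable; _⊆_)
open import Defs

-- Finite sums and matrices over ℤ

-- The matrix has eigenvalues `q⁴ k`, `- q² u` and `q` with multiplicities 1, `f` and `g`, so away
-- from `p` the elementary divisors turn out to be the eigenvalues. A rational diagonalisation does
-- not show this: the eigenvectors need not span the lattice at ℓ, and in the second half of the
-- theorem ℓ divides `1 + q`. Every change of coordinates below therefore uses integers and an
-- inverse of `q` only; `1 + q` enters through the identity `(1 + q) k = u (1 + q u)`, never through
-- an inverse. The column of -1 in `X` and the row of ones in `Y` serve to absorb `J`. Congruences
-- between integer vectors, one modulus `ℓ ^ suc j` at a time, replace the local ring at ℓ, and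
-- dimensions over the field with ℓ elements are compared by counting vectors. The kernels see only
-- positive exponents; exponent 0 is settled by the total number of divisors, which is where `g`
-- comes from. In the cases the decisive fact is `[n-2] = 1 + q [n-3]`: ℓ never divides both factors
-- of `[n-2] [n-3]`.

module _ where
  open import Data.Integer.Base using (_+_; _*_; _-_; -_)
  open ≡.≡-Reasoning

  open module ℤSum = Sum ℤ.+-*-semiring public
    using (sum; ∑-comm; ∑-distrib-+; *-distribˡ-sum; *-distribʳ-sum)

  sum-cong : ∀ {N} {f g : Vector ℤ N} → (∀ i → f i ≡ g i) → sum f ≡ sum g
  sum-cong = ℤSum.sum-cong-≗

  sum-zero : ∀ {N} {f : Vector ℤ N} → (∀ i → f i ≡ 0ℤ) → sum f ≡ 0ℤ
  sum-zero {N} h = trans (sum-cong h) (ℤSum.sum-replicate-zero N)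

  sum-const : ∀ N x → sum {N} (λ _ → x) ≡ ℤ.+ N * x
  sum-const zero    x = refl
  sum-const (suc N) x = trans (cong (x +_) (sum-const N x)) (sym (ℤ.suc-* (ℤ.+ N) x))

  sum-linear : ∀ {N} a b (f g : Vector ℤ N) →
               sum (λ i → a * f i + b * g i) ≡ a * sum f + b * sum g
  sum-linear a b f g = trans (∑-distrib-+ (λ i → a * f i) (λ i → b * g i))
    (cong₂ _+_ (sym (*-distribˡ-sum a f)) (sym (*-distribˡ-sum b g)))

  χ : ∀ {p} {P : Set p} → Dec P → ℤ
  χ P? = if does P? then 1ℤ else 0ℤ

  χ-yes : ∀ {p} {P : Set p} (P? : Dec P) → P → χ P? ≡ 1ℤ
  χ-yes (yes _) _ = refl
  χ-yes (no ¬p) p = contradiction p ¬p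

  χ-no : ∀ {p} {P : Set p} (P? : Dec P) → ¬ P → χ P? ≡ 0ℤ
  χ-no (yes p) ¬p = contradiction p ¬p
  χ-no (no _)  _  = refl

  δ : ∀ {N} → Matrix N
  δ = diagonal (λ _ → 1ℤ)

  δ-refl : ∀ {N} (i : Fin N) → δ i i ≡ 1ℤ
  δ-refl i = χ-yes (i Fin.≟ i) refl

  δ-≢ : ∀ {N} {i j : Fin N} → i ≢ j → δ i j ≡ 0ℤ
  δ-≢ {i = i} {j} = χ-no (i Fin.≟ j)

  δ-sym : ∀ {N} (i j : Fin N) → δ i j ≡ δ j i
  δ-sym zero    zero    = refl
  δ-sym zero    (suc j) = refl
  δ-sym (suc i) zero    = refl
  δ-sym (suc i) (suc j) = δ-sym i j

  sum-δˡ : ∀ {N} i (f : Vector ℤ N) → sum (λ j → δ i j * f j) ≡ f i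
  sum-δˡ zero f = trans
    (cong₂ _+_ (ℤ.*-identityˡ (f zero)) (sum-zero λ j → ℤ.*-zeroˡ (f (suc j)))) (ℤ.+-identityʳ _)
  sum-δˡ (suc i) f = trans
    (cong₂ _+_ (ℤ.*-zeroˡ (f zero)) (sum-δˡ i (f ∘ suc))) (ℤ.+-identityˡ _)

  sum-δʳ : ∀ {N} i (f : Vector ℤ N) → sum (λ j → f j * δ j i) ≡ f i
  sum-δʳ i f = trans (sum-cong λ j → trans (ℤ.*-comm (f j) _) (cong (_* f j) (δ-sym j i))) (sum-δˡ i f)

  diagonal-δ : ∀ {N} (d : Vector ℤ N) i j → diagonal d i j ≡ d i * δ i j
  diagonal-δ d i j with i Fin.≟ j
  ... | yes _ = sym (ℤ.*-identityʳ (d i))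
  ... | no  _ = sym (ℤ.*-zeroʳ (d i))

  diagonal-*ᵛ : ∀ {N} (d x : Vector ℤ N) i → (diagonal d *ᵛ x) i ≡ d i * x i
  diagonal-*ᵛ d x i = begin
    sum (λ j → diagonal d i j * x j)
      ≡⟨ sum-cong (λ j → trans (cong (_* x j) (diagonal-δ d i j)) (ℤ.*-assoc (d i) (δ i j) (x j))) ⟩
    sum (λ j → d i * (δ i j * x j))   ≡⟨ *-distribˡ-sum (d i) (λ j → δ i j * x j) ⟨
    d i * sum (λ j → δ i j * x j)     ≡⟨ cong (d i *_) (sum-δˡ i x) ⟩
    d i * x i                         ∎

  sum-assoc : ∀ {M N} (a : Vector ℤ M) (B : Fin M → Fin N → ℤ) (x : Vector ℤ N) →
              sum (λ j → sum (λ i → a i * B i j) * x j) ≡ sum (λ i → a i * sum (λ j → B i j * x j))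
  sum-assoc a B x = begin
    sum (λ j → sum (λ i → a i * B i j) * x j)    ≡⟨ sum-cong (λ j → *-distribʳ-sum (x j) (λ i → a i * B i j)) ⟩
    sum (λ j → sum (λ i → a i * B i j * x j))    ≡⟨ ∑-comm (λ j i → a i * B i j * x j) ⟩
    sum (λ i → sum (λ j → a i * B i j * x j))
      ≡⟨ sum-cong (λ i → trans (sum-cong λ j → ℤ.*-assoc (a i) (B i j) (x j)) (sym (*-distribˡ-sum (a i) (λ j → B i j * x j)))) ⟩
    sum (λ i → a i * sum (λ j → B i j * x j))    ∎

  *ᵛ-*ᴹ : ∀ {N} (A B : Matrix N) x i → ((A *ᴹ B) *ᵛ x) i ≡ (A *ᵛ (B *ᵛ x)) i
  *ᵛ-*ᴹ A B x i = sum-assoc (A i) B x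

  *ᴹ-assoc : ∀ {N} (A B C : Matrix N) → A *ᴹ B *ᴹ C ≗ᴹ A *ᴹ (B *ᴹ C)
  *ᴹ-assoc A B C i j = sum-assoc (A i) B (λ l → C l j)

  *ᴹ-cong : ∀ {N} {A A′ B B′ : Matrix N} → A ≗ᴹ A′ → B ≗ᴹ B′ → A *ᴹ B ≗ᴹ A′ *ᴹ B′
  *ᴹ-cong p r i j = sum-cong λ k → cong₂ _*_ (p i k) (r k j)

  *ᴹ-identityˡ : ∀ {N} (A : Matrix N) → δ *ᴹ A ≗ᴹ A
  *ᴹ-identityˡ A i j = sum-δˡ i (λ k → A k j)

  *ᴹ-identityʳ : ∀ {N} (A : Matrix N) → A *ᴹ δ ≗ᴹ A
  *ᴹ-identityʳ A i j = sum-δʳ j (A i)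

  ≗ᴹ-refl : ∀ {N} {A : Matrix N} → A ≗ᴹ A
  ≗ᴹ-refl _ _ = refl

  ≗ᴹ-sym : ∀ {N} {A B : Matrix N} → A ≗ᴹ B → B ≗ᴹ A
  ≗ᴹ-sym p i j = sym (p i j)

  ≗ᴹ-trans : ∀ {N} {A B C : Matrix N} → A ≗ᴹ B → B ≗ᴹ C → A ≗ᴹ C
  ≗ᴹ-trans p r i j = trans (p i j) (r i j)

  ᵀ-*ᴹ : ∀ {N} (A B : Matrix N) → flip (A *ᴹ B) ≗ᴹ flip B *ᴹ flip A
  ᵀ-*ᴹ A B i j = sum-cong λ k → ℤ.*-comm (A j k) (B k i)

  *ᵛ-cong : ∀ {N} {A B : Matrix N} {x y : Vector ℤ N} → A ≗ᴹ B → (∀ i → x i ≡ y i) →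
            ∀ i → (A *ᵛ x) i ≡ (B *ᵛ y) i
  *ᵛ-cong p r i = sum-cong λ k → cong₂ _*_ (p i k) (r k)

  *ᵛ-identity : ∀ {N} (x : Vector ℤ N) i → (δ *ᵛ x) i ≡ x i
  *ᵛ-identity x i = sum-δˡ i x

  ∣-sum : ∀ {N m} {f : Vector ℤ N} → (∀ i → m ℤ∣.∣ f i) → m ℤ∣.∣ sum f
  ∣-sum {zero}  h = ℤ∣.divides 0ℤ refl
  ∣-sum {suc N} h = ℤ∣.∣m∣n⇒∣m+n (h zero) (∣-sum (h ∘ suc))

  *-invertible : ∀ {N} (P Q : Matrix N) → Invertible P → Invertible Q → Invertible (P *ᴹ Q)
  *-invertible P Q (P⁻ , pl , pr) (Q⁻ , ql , qr) = Q⁻ *ᴹ P⁻ , cancel P Q Q⁻ P⁻ ql pl , cancel Q⁻ P⁻ P Q pr qr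
    where
    cancel : ∀ {N} (A B C D : Matrix N) → B *ᴹ C ≗ᴹ δ → A *ᴹ D ≗ᴹ δ → (A *ᴹ B) *ᴹ (C *ᴹ D) ≗ᴹ δ
    cancel A B C D bc ad = ≗ᴹ-trans (*ᴹ-assoc A B (C *ᴹ D)) (≗ᴹ-trans
      (*ᴹ-cong {A = A} ≗ᴹ-refl (≗ᴹ-trans (≗ᴹ-sym (*ᴹ-assoc B C D))
        (≗ᴹ-trans (*ᴹ-cong {B = D} bc ≗ᴹ-refl) (*ᴹ-identityˡ D)))) ad)

  ᵀ-invertible : ∀ {N} (P : Matrix N) → Invertible P → Invertible (flip P)
  ᵀ-invertible P (P⁻ , l , r) = flip P⁻ ,
    (λ i j → trans (sym (ᵀ-*ᴹ P⁻ P i j)) (trans (r j i) (δ-sym j i))) ,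
    (λ i j → trans (sym (ᵀ-*ᴹ P P⁻ i j)) (trans (l j i) (δ-sym j i)))

  δ-invertible : ∀ {N} → Invertible (δ {N})
  δ-invertible = δ , *ᴹ-identityˡ δ , *ᴹ-identityˡ δ

-- Smith normal forms

module _ where
  open import Data.Integer.Base using (_+_; _*_; _-_; -_)
  open ≡.≡-Reasoning

  infix 4 _∼_
  record _∼_ {N} (A B : Matrix N) : Set where
    constructor equivalence
    field
      P Q          : Matrix N
      P-invertible : Invertible P
      Q-invertible : Invertible Q
      PAQ≗B        : P *ᴹ A *ᴹ Q ≗ᴹ B
  open _∼_

  ≗ᴹ⇒∼ : ∀ {N} {A B : Matrix N} → A ≗ᴹ B → A ∼ B
  ≗ᴹ⇒∼ {A = A} p = equivalence δ δ δ-invertible δ-invertible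
    (≗ᴹ-trans (*ᴹ-identityʳ (δ *ᴹ A)) (≗ᴹ-trans (*ᴹ-identityˡ A) p))

  ∼-trans : ∀ {N} {A B C : Matrix N} → A ∼ B → B ∼ C → A ∼ C
  ∼-trans {A = A} (equivalence P Q pi qi e) (equivalence P′ Q′ pi′ qi′ e′) =
    equivalence (P′ *ᴹ P) (Q *ᴹ Q′) (*-invertible P′ P pi′ pi) (*-invertible Q Q′ qi qi′)
      (≗ᴹ-trans (≗ᴹ-trans (*ᴹ-cong {B = Q *ᴹ Q′} (*ᴹ-assoc P′ P A) ≗ᴹ-refl)
        (≗ᴹ-trans (≗ᴹ-sym (*ᴹ-assoc (P′ *ᴹ (P *ᴹ A)) Q Q′)) (*ᴹ-cong {B = Q′} (*ᴹ-assoc P′ (P *ᴹ A) Q) ≗ᴹ-refl)))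
        (≗ᴹ-trans (*ᴹ-cong {B = Q′} (*ᴹ-cong {A = P′} ≗ᴹ-refl e) ≗ᴹ-refl) e′))

  ∼-ᵀ : ∀ {N} {A B : Matrix N} → A ∼ B → flip A ∼ flip B
  ∼-ᵀ {A = A} (equivalence P Q pi qi e) = equivalence (flip Q) (flip P) (ᵀ-invertible Q qi) (ᵀ-invertible P pi)
    (≗ᴹ-trans (*ᴹ-assoc (flip Q) (flip A) (flip P)) (≗ᴹ-trans
      (*ᴹ-cong {A = flip Q} ≗ᴹ-refl (≗ᴹ-sym (ᵀ-*ᴹ P A)))
      (≗ᴹ-trans (≗ᴹ-sym (ᵀ-*ᴹ (P *ᴹ A) Q)) λ i j → e j i)))

  addRows : ∀ {N} → Fin N → Vector ℤ N → Matrix N → Matrix N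
  addRows i u A k l = A k l + u k * A i l

  -- The condition `u i ≡ 0ℤ` leaves row `i` itself unchanged, so the shear with `- u` undoes the
  -- operation.
  addRows-∼ : ∀ {N} i (u : Vector ℤ N) A → u i ≡ 0ℤ → A ∼ addRows i u A
  addRows-∼ i u A uᵢ≡0 = equivalence (shear u) δ
    ( shear (-_ ∘ u)
    , shear-inverse u (-_ ∘ u) -uᵢ≡0 (λ _ → refl)
    , shear-inverse (-_ ∘ u) u uᵢ≡0 (λ k → sym (ℤ.neg-involutive (u k))) ) δ-invertible
    (≗ᴹ-trans (*ᴹ-identityʳ (shear u *ᴹ A)) (shear-* u A))
    where
    shear : Vector ℤ _ → Matrix _
    shear u = addRows i u δ

    shear-* : ∀ u A → shear u *ᴹ A ≗ᴹ addRows i u A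
    shear-* u A k l = begin
      sum (λ m → (δ k m + u k * δ i m) * A m l)
        ≡⟨ sum-cong (λ m → expand (δ k m) (u k) (δ i m) (A m l)) ⟩
      sum (λ m → 1ℤ * (δ k m * A m l) + u k * (δ i m * A m l))
        ≡⟨ sum-linear 1ℤ (u k) (λ m → δ k m * A m l) (λ m → δ i m * A m l) ⟩
      1ℤ * sum (λ m → δ k m * A m l) + u k * sum (λ m → δ i m * A m l)
        ≡⟨ cong₂ (λ x y → 1ℤ * x + u k * y) (sum-δˡ k (λ m → A m l)) (sum-δˡ i (λ m → A m l)) ⟩
      1ℤ * A k l + u k * A i l
        ≡⟨ cong (_+ u k * A i l) (ℤ.*-identityˡ (A k l)) ⟩
      A k l + u k * A i l ∎
      where
      expand : ∀ a b c d → (a + b * c) * d ≡ 1ℤ * (a * d) + b * (c * d)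
      expand = solve-∀

    shear-inverse : ∀ u v → v i ≡ 0ℤ → (∀ k → v k ≡ - u k) → shear u *ᴹ shear v ≗ᴹ δ
    shear-inverse u v vᵢ≡0 v≡-u k l = begin
      (shear u *ᴹ shear v) k l                          ≡⟨ shear-* u (shear v) k l ⟩
      δ k l + v k * δ i l + u k * (δ i l + v i * δ i l)
        ≡⟨ cong₂ (λ x y → δ k l + x * δ i l + u k * (δ i l + y * δ i l)) (v≡-u k) vᵢ≡0 ⟩
      δ k l + (- u k) * δ i l + u k * (δ i l + 0ℤ * δ i l)  ≡⟨ collapse (δ k l) (u k) (δ i l) ⟩
      δ k l                                              ∎
      where
      collapse : ∀ a b c → a + (- b) * c + b * (c + 0ℤ * c) ≡ a
      collapse = solve-∀

    -uᵢ≡0 : - u i ≡ 0ℤ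
    -uᵢ≡0 = cong -_ uᵢ≡0

  addColumns-∼ : ∀ {N} j (u : Vector ℤ N) A → u j ≡ 0ℤ → A ∼ λ k l → A k l + u l * A k j
  addColumns-∼ j u A uⱼ≡0 = ∼-ᵀ (addRows-∼ j u (flip A) uⱼ≡0)

  block : ∀ {N} → ℤ → Matrix N → Matrix (suc N)
  block d B zero    zero    = d
  block d B zero    (suc j) = 0ℤ
  block d B (suc i) zero    = 0ℤ
  block d B (suc i) (suc j) = B i j

  block-cong : ∀ {N} d {B C : Matrix N} → B ≗ᴹ C → block d B ≗ᴹ block d C
  block-cong d h zero    zero    = refl
  block-cong d h zero    (suc j) = refl
  block-cong d h (suc i) zero    = refl
  block-cong d h (suc i) (suc j) = h i j

  block-* : ∀ {N} a b (A B : Matrix N) → block a A *ᴹ block b B ≗ᴹ block (a * b) (A *ᴹ B)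
  block-* {N} a b A B zero    zero    = trans
    (cong (a * b +_) (sum-zero {N} {λ _ → 0ℤ} λ _ → refl)) (ℤ.+-identityʳ (a * b))
  block-* a b A B zero    (suc j) = cong₂ _+_ (ℤ.*-zeroʳ a) (sum-zero λ k → ℤ.*-zeroˡ (B k j))
  block-* a b A B (suc i) zero    = cong (0ℤ +_) (sum-zero λ k → ℤ.*-zeroʳ (A i k))
  block-* a b A B (suc i) (suc j) = ℤ.+-identityˡ _

  block-δ : ∀ {N} → block 1ℤ δ ≗ᴹ δ {suc N}
  block-δ zero    zero    = refl
  block-δ zero    (suc j) = refl
  block-δ (suc i) zero    = refl
  block-δ (suc i) (suc j) = refl

  block-diagonal : ∀ {N} (d : Vector ℤ (suc N)) → block (d zero) (diagonal (d ∘ suc)) ≗ᴹ diagonal d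
  block-diagonal d zero    zero    = refl
  block-diagonal d zero    (suc j) = refl
  block-diagonal d (suc i) zero    = refl
  block-diagonal d (suc i) (suc j) = refl

  block-invertible : ∀ {N} (P : Matrix N) → Invertible P → Invertible (block 1ℤ P)
  block-invertible P (P⁻ , l , r) = block 1ℤ P⁻ , half P P⁻ l , half P⁻ P r
    where
    half : ∀ A B → A *ᴹ B ≗ᴹ δ → block 1ℤ A *ᴹ block 1ℤ B ≗ᴹ δ
    half A B h = ≗ᴹ-trans (block-* 1ℤ 1ℤ A B) (≗ᴹ-trans (block-cong 1ℤ h) block-δ)

  block-∼ : ∀ {N} d {B C : Matrix N} → B ∼ C → block d B ∼ block d C
  block-∼ d {B} {C} (equivalence P Q pi qi e) =
    equivalence (block 1ℤ P) (block 1ℤ Q) (block-invertible P pi) (block-invertible Q qi)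
      (≗ᴹ-trans (*ᴹ-cong {B = block 1ℤ Q} (block-* 1ℤ d P B) ≗ᴹ-refl)
        (≗ᴹ-trans (block-* (1ℤ * d) 1ℤ (P *ᴹ B) Q) λ i j →
          trans (cong (λ x → block x (P *ᴹ B *ᴹ Q) i j) (unit d)) (block-cong d e i j)))
    where
    unit : ∀ d → 1ℤ * d * 1ℤ ≡ d
    unit = solve-∀

  ∼-∣ : ∀ {N m} {A B : Matrix N} → A ∼ B → (∀ i j → m ℤ∣.∣ A i j) → ∀ i j → m ℤ∣.∣ B i j
  ∼-∣ {m = m} (equivalence P Q _ _ e) h i j = subst (m ℤ∣.∣_) (e i j)
    (∣-sum λ k → ℤ∣.∣m⇒∣m*n (Q k j) (∣-sum λ l → ℤ∣.∣n⇒∣m*n (P i l) (h l k)))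

  -- `d∣B` survives every further reduction of `B` by `∼-∣`, so `d` divides all later diagonal
  -- entries. Demanding it at each stage yields the divisibility chain of the Smith form.
  record Reduced {N} (A : Matrix (suc N)) : Set where
    constructor reduced
    field
      {d}       : ℤ
      {B}       : Matrix N
      A∼dB      : A ∼ block d B
      d∣B       : ∀ i j → d ℤ∣.∣ B i j

  Reduced-resp : ∀ {N} {A A′ : Matrix (suc N)} → A ∼ A′ → Reduced A′ → Reduced A
  Reduced-resp A∼A′ (reduced h h′) = reduced (∼-trans A∼A′ h) h′

  Reduced-ᵀ : ∀ {N} {A : Matrix (suc N)} → Reduced (flip A) → Reduced A
  Reduced-ᵀ (reduced {d} {B} h h′) = reduced (∼-trans (∼-ᵀ h) (≗ᴹ⇒∼ block-ᵀ)) (λ i j → h′ j i)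
    where
    block-ᵀ : flip (block d B) ≗ᴹ block d (flip B)
    block-ᵀ zero    zero    = refl
    block-ᵀ zero    (suc j) = refl
    block-ᵀ (suc i) zero    = refl
    block-ᵀ (suc i) (suc j) = refl

  Smaller : ∀ {N} → Matrix (suc N) → Matrix (suc N) → Set
  Smaller A B = A zero zero ≢ 0ℤ × ℤ.∣ A zero zero ∣ ℕ.< ℤ.∣ B zero zero ∣

  -- With b the corner entry and r the remainder of the other entry, b is
  -- reduced modulo r to a residue in [1 , r] rather than [0 , r-1], so that
  -- the new corner is nonzero without a case distinction.
  shrink : ∀ {N} (A : Matrix (suc N)) j → A zero zero ≢ 0ℤ → ¬ A zero zero ℤ∣.∣ A zero (suc j) →
           ∃ λ A′ → A ∼ A′ × Smaller A′ A
  shrink A j b≢0 b∤x = A₂ , ∼-trans (addColumns-∼ zero u A refl) (addColumns-∼ (suc j) w A₁ refl)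
    , subst (λ y → y ≢ 0ℤ × ℤ.∣ y ∣ ℕ.< ℤ.∣ b ∣) (sym corner)
        ((λ ()) , ℕ.≤-<-trans (ℤ.n%ℕd<d (b - 1ℤ) r) (ℤ.n%d<d x b))
    where
    b = A zero zero
    x = A zero (suc j)
    instance
      b-nonZero : ℤ.NonZero b
      b-nonZero = ℤ.≢-nonZero b≢0
    r = x ℤ.% b
    r≢0 : r ≢ 0
    r≢0 r≡0 = b∤x (ℤ∣.divides (x ℤ./ b)
      (trans (ℤ.a≡a%n+[a/n]*n x b) (trans (cong (λ y → ℤ.+ y + x ℤ./ b * b) r≡0) (ℤ.+-identityˡ _))))
    instance
      r-nonZero : ℕ.NonZero r
      r-nonZero = ℕ.≢-nonZero r≢0
    u w : Vector ℤ _
    u zero    = 0ℤ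
    u (suc l) = - (x ℤ./ b)
    w zero    = - ((b - 1ℤ) ℤ./ℕ r)
    w (suc l) = 0ℤ
    A₁ A₂ : Matrix _
    A₁ k l = A k l + u l * A k zero
    A₂ k l = A₁ k l + w l * A₁ k (suc j)
    remainder : A₁ zero (suc j) ≡ ℤ.+ r
    remainder = trans (cong (_+ - (x ℤ./ b) * b) (ℤ.a≡a%n+[a/n]*n x b)) (cancel (ℤ.+ r) (x ℤ./ b) b)
      where
      cancel : ∀ r p b → r + p * b + - p * b ≡ r
      cancel = solve-∀
    corner : A₂ zero zero ≡ ℤ.+ suc ((b - 1ℤ) ℤ.%ℕ r)
    corner = begin
      b + 0ℤ * b + w zero * A₁ zero (suc j)    ≡⟨ cong (λ y → b + 0ℤ * b + w zero * y) remainder ⟩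
      b + 0ℤ * b + w zero * ℤ.+ r              ≡⟨ rearrange b ((b - 1ℤ) ℤ./ℕ r) (ℤ.+ r) ⟩
      1ℤ + (b - 1ℤ) + - ((b - 1ℤ) ℤ./ℕ r) * ℤ.+ r
        ≡⟨ cong (λ y → 1ℤ + y + w zero * ℤ.+ r) (ℤ.a≡a%ℕn+[a/ℕn]*n (b - 1ℤ) r) ⟩
      1ℤ + (ℤ.+ s + (b - 1ℤ) ℤ./ℕ r * ℤ.+ r) + - ((b - 1ℤ) ℤ./ℕ r) * ℤ.+ r
        ≡⟨ cancel (ℤ.+ s) ((b - 1ℤ) ℤ./ℕ r) (ℤ.+ r) ⟩
      1ℤ + ℤ.+ s                                ∎
      where
      s = (b - 1ℤ) ℤ.%ℕ r
      rearrange : ∀ b p r → b + 0ℤ * b + - p * r ≡ 1ℤ + (b - 1ℤ) + - p * r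
      rearrange = solve-∀
      cancel : ∀ s p r → 1ℤ + (s + p * r) + - p * r ≡ 1ℤ + s
      cancel = solve-∀

  module _ {N} (A : Matrix (suc N))
           (row : ∀ j → A zero zero ℤ∣.∣ A zero (suc j)) (column : ∀ i → A zero zero ℤ∣.∣ A (suc i) zero) where
    private
      b = A zero zero
      open ℤ∣._∣_
      u w : Vector ℤ (suc N)
      u zero    = 0ℤ
      u (suc j) = - quotient (row j)
      w zero    = 0ℤ
      w (suc i) = - quotient (column i)
      A₁ A₂ : Matrix (suc N)
      A₁ k l = A k l + u l * A k zero
      A₂ = addRows zero w A₁

      cancel : ∀ p b → p * b + - p * b ≡ 0ℤ
      cancel = solve-∀
      b+0 : ∀ b → b + 0ℤ * b ≡ b
      b+0 = solve-∀

      A₁-row : ∀ j → A₁ zero (suc j) ≡ 0ℤ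
      A₁-row j = trans (cong (_+ u (suc j) * b) (equality (row j))) (cancel (quotient (row j)) b)

    complement : Matrix N
    complement i j = A₂ (suc i) (suc j)

    cleared : A ∼ block b complement
    cleared = ∼-trans (addColumns-∼ zero u A refl) (∼-trans (addRows-∼ zero w A₁ refl) (≗ᴹ⇒∼ entries))
      where
      entries : A₂ ≗ᴹ block b complement
      entries zero    zero    = trans (b+0 (b + 0ℤ * b)) (b+0 b)
      entries zero    (suc j) = trans (b+0 (A₁ zero (suc j))) (A₁-row j)
      entries (suc i) zero    = begin
        A (suc i) zero + 0ℤ * A (suc i) zero + w (suc i) * (b + 0ℤ * b)
          ≡⟨ cong₂ (λ y z → y + w (suc i) * z) (b+0 (A (suc i) zero)) (b+0 b) ⟩
        A (suc i) zero + w (suc i) * b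
          ≡⟨ cong (_+ w (suc i) * b) (equality (column i)) ⟩
        quotient (column i) * b + w (suc i) * b
          ≡⟨ cancel (quotient (column i)) b ⟩
        0ℤ ∎
      entries (suc i) (suc j) = refl

  -- Whenever the corner fails to divide an entry, `shrink` produces a nonzero corner of smaller
  -- absolute value. The recursion on that value can only end with a corner that divides everything.
  reduce-nonZero-corner : ∀ {N} (A : Matrix (suc N)) → Acc ℕ._<_ ℤ.∣ A zero zero ∣ → A zero zero ≢ 0ℤ → Reduced A
  reduce-nonZero-corner A (acc smaller) b≢0
    with Fin.all? (λ j → A zero zero ℤ∣.∣? A zero (suc j))
  ... | no ¬row =
    let j , b∤x                   = Fin.¬∀⟶∃¬ _ _ (λ j → A zero zero ℤ∣.∣? A zero (suc j)) ¬row
        A′ , A∼A′ , b′≢0 , b′<b = shrink A j b≢0 b∤x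
    in Reduced-resp A∼A′ (reduce-nonZero-corner A′ (smaller b′<b) b′≢0)
  ... | yes row with Fin.all? (λ i → A zero zero ℤ∣.∣? A (suc i) zero)
  ... | no ¬column =
    let i , b∤x                    = Fin.¬∀⟶∃¬ _ _ (λ i → A zero zero ℤ∣.∣? A (suc i) zero) ¬column
        A′ , Aᵀ∼A′ , b′≢0 , b′<b = shrink (flip A) i b≢0 b∤x
    in Reduced-ᵀ (Reduced-resp Aᵀ∼A′ (reduce-nonZero-corner A′ (smaller b′<b) b′≢0))
  ... | yes column with Fin.all? (λ i → Fin.all? λ j → A zero zero ℤ∣.∣? complement A row column i j)
  ... | yes h = reduced (cleared A row column) h
  ... | no ¬h =
    let b                         = A zero zero
        C                         = complement A row column
        i , h                     = Fin.¬∀⟶∃¬ _ _ (λ i → Fin.all? λ j → b ℤ∣.∣? C i j) ¬h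
        j , b∤x                   = Fin.¬∀⟶∃¬ _ _ (λ j → b ℤ∣.∣? C i j) h
        -- Row `suc i` is added to row zero to expose the entry `C i j`. The corner stays `b`, since
        -- that row of `block b C` starts with zero.
        B                         = addRows (suc i) (δ zero) (block b C)
        A∼B                       = ∼-trans (cleared A row column) (addRows-∼ (suc i) (δ zero) (block b C) refl)
        B≡b                       = ℤ.+-identityʳ b
        B≡x                       = trans (ℤ.+-identityˡ _) (ℤ.*-identityˡ (C i j))
        A′ , B∼A′ , b′≢0 , b′<b  = shrink B j (λ B≡0 → b≢0 (trans (sym B≡b) B≡0))
                                      (λ h → b∤x (≡.subst₂ ℤ∣._∣_ B≡b B≡x h))
    in Reduced-resp (∼-trans A∼B B∼A′)
         (reduce-nonZero-corner A′ (smaller (subst (λ y → ℤ.∣ A′ zero zero ∣ ℕ.< ℤ.∣ y ∣) B≡b b′<b)) b′≢0)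

  reduce-nonZero-row : ∀ {N} (A : Matrix (suc N)) j → A zero j ≢ 0ℤ → Reduced A
  reduce-nonZero-row A zero    x≢0 = reduce-nonZero-corner A (ℕ.<-wellFounded _) x≢0
  reduce-nonZero-row A (suc j) x≢0 with A zero zero ℤ.≟ 0ℤ
  ... | no b≢0  = reduce-nonZero-corner A (ℕ.<-wellFounded _) b≢0
  -- Adding column `suc j` to column zero copies the nonzero entry into the vanishing corner.
  ... | yes b≡0 = Reduced-resp (addColumns-∼ (suc j) (δ zero) A refl)
    (reduce-nonZero-corner _ (ℕ.<-wellFounded _) λ e → x≢0
      (trans (sym (trans (cong₂ _+_ b≡0 (ℤ.*-identityˡ (A zero (suc j)))) (ℤ.+-identityˡ _))) e))

  reduce : ∀ {N} (A : Matrix (suc N)) → Reduced A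
  reduce A with Fin.all? (λ j → A zero j ℤ.≟ 0ℤ)
  ... | no ¬row = let j , x≢0 = Fin.¬∀⟶∃¬ _ _ (λ j → A zero j ℤ.≟ 0ℤ) ¬row in reduce-nonZero-row A j x≢0
  ... | yes row with Fin.all? (λ i → Fin.all? λ j → A (suc i) j ℤ.≟ 0ℤ)
  ... | no ¬h =
    let i , h   = Fin.¬∀⟶∃¬ _ _ (λ i → Fin.all? λ j → A (suc i) j ℤ.≟ 0ℤ) ¬h
        j , x≢0 = Fin.¬∀⟶∃¬ _ _ (λ j → A (suc i) j ℤ.≟ 0ℤ) h
    in Reduced-resp (addRows-∼ (suc i) (δ zero) A refl) (reduce-nonZero-row _ j λ e → x≢0
         (trans (sym (trans (cong₂ _+_ (row j) (ℤ.*-identityˡ (A (suc i) j))) (ℤ.+-identityˡ _))) e))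
  ... | yes h = reduced {d = 0ℤ} {λ _ _ → 0ℤ} (≗ᴹ⇒∼ zeros) (λ _ _ → ℤ∣.divides 0ℤ refl)
    where
    zeros : A ≗ᴹ block 0ℤ (λ _ _ → 0ℤ)
    zeros zero    zero    = row zero
    zeros zero    (suc j) = row (suc j)
    zeros (suc i) zero    = h i zero
    zeros (suc i) (suc j) = h i (suc j)

  diagonalise : ∀ {N} (A : Matrix N) →
                ∃ λ d → A ∼ diagonal d × (∀ {i j} → i Fin.≤ j → d i ℤ∣.∣ d j)
  diagonalise {zero}  A = (λ ()) , ≗ᴹ⇒∼ (λ ()) , λ {}
  diagonalise {suc N} A with reduce A
  ... | reduced {b} {B} A∼bB b∣B with diagonalise B
  ... | d , B∼d , chain = d′ , ∼-trans A∼bB (∼-trans (block-∼ b B∼d) (≗ᴹ⇒∼ (block-diagonal d′))) , chain′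
    where
    d′ : Vector ℤ (suc N)
    d′ zero    = b
    d′ (suc i) = d i
    chain′ : ∀ {i j} → i Fin.≤ j → d′ i ℤ∣.∣ d′ j
    chain′ {zero}  {zero}  _   = ℤ∣.∣-refl
    chain′ {zero}  {suc j} _   = subst (b ℤ∣.∣_)
      (trans (diagonal-δ d j j) (trans (cong (d j *_) (δ-refl j)) (ℤ.*-identityʳ (d j)))) (∼-∣ B∼d b∣B j j)
    chain′ {suc i} {suc j} i≤j = chain (ℕ.≤-pred i≤j)

  smithNormalForm : ∀ {N} (A : Matrix N) → ∃ (IsSmithNormalForm A)
  smithNormalForm A with diagonalise A
  ... | d , equivalence P Q pi qi e , chain = ℤ.∣_∣ ∘ d , record
    { P-invertible = *-invertible (diagonal s) P (diagonal s , s²≗δ , s²≗δ) pi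
    ; Q-invertible = qi
    ; PAQ≗D        = ≗ᴹ-trans (*ᴹ-cong {B = Q} (*ᴹ-assoc (diagonal s) P A) ≗ᴹ-refl)
                     (≗ᴹ-trans (*ᴹ-assoc (diagonal s) (P *ᴹ A) Q)
                     (≗ᴹ-trans (*ᴹ-cong {A = diagonal s} ≗ᴹ-refl e)
                               (λ i j → trans (diagonal-* s d i j) (absolute i j))))
    ; divisibility = λ i≤j → ℤ∣.∣⇒∣ᵤ (chain i≤j)
    }
    where
    -- The sign of zero counts as plus, so every `s i` is a unit even where `d i` vanishes, and
    -- `diagonal s` is its own inverse.
    s : Vector ℤ _
    s i = ℤ.sign (d i) ℤ.◃ 1
    diagonal-* : ∀ {N} (a b : Vector ℤ N) → diagonal a *ᴹ diagonal b ≗ᴹ diagonal (λ i → a i * b i)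
    diagonal-* a b i j = begin
      sum (λ k → diagonal a i k * diagonal b k j)  ≡⟨ diagonal-*ᵛ a (λ k → diagonal b k j) i ⟩
      a i * diagonal b i j                         ≡⟨ cong (a i *_) (diagonal-δ b i j) ⟩
      a i * (b i * δ i j)                          ≡⟨ ℤ.*-assoc (a i) (b i) (δ i j) ⟨
      a i * b i * δ i j                            ≡⟨ diagonal-δ (λ i → a i * b i) i j ⟨
      diagonal (λ i → a i * b i) i j               ∎
    s² : ∀ x → (ℤ.sign x ℤ.◃ 1) * (ℤ.sign x ℤ.◃ 1) ≡ 1ℤ
    s² (ℤ.+ _)    = refl
    s² ℤ.-[1+ _ ] = refl
    s∣∣ : ∀ x → (ℤ.sign x ℤ.◃ 1) * x ≡ ℤ.+ ℤ.∣ x ∣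
    s∣∣ (ℤ.+ n)    = ℤ.*-identityˡ (ℤ.+ n)
    s∣∣ ℤ.-[1+ n ] = ℤ.-1*i≡-i ℤ.-[1+ n ]
    diagonal-cong : ∀ {N} {a b : Vector ℤ N} → (∀ i → a i ≡ b i) → diagonal a ≗ᴹ diagonal b
    diagonal-cong h i j = cong (if does (i Fin.≟ j) then_else 0ℤ) (h i)
    s²≗δ : diagonal s *ᴹ diagonal s ≗ᴹ δ
    s²≗δ i j = trans (diagonal-* s s i j) (diagonal-cong (s² ∘ d) i j)
    absolute : diagonal (λ i → s i * d i) ≗ᴹ diagonal (ℤ.+_ ∘ ℤ.∣_∣ ∘ d)
    absolute = diagonal-cong (s∣∣ ∘ d)

*ᵛ-- : ∀ {N} (A : Matrix N) x y i →
       (A *ᵛ λ j → x j ℤ.- y j) i ≡ (A *ᵛ x) i ℤ.- (A *ᵛ y) i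
*ᵛ-- A x y i = trans (*ᵛ-+ A x (λ j → ℤ.- y j) i) (cong (ℤ._+_ ((A *ᵛ x) i)) (*ᵛ-neg A y i))

module SmithCoordinates {N} {A : Matrix N} {d : Vector ℕ N} (snf : IsSmithNormalForm A d) where
  open IsSmithNormalForm snf public
  P⁻¹ = proj₁ P-invertible
  Q⁻¹ = proj₁ Q-invertible

  P⁻¹P : ∀ x i → (P⁻¹ *ᵛ P *ᵛ x) i ≡ x i
  P⁻¹P x i = trans (sym (*ᵛ-*ᴹ P⁻¹ P x i))
    (trans (*ᵛ-cong {A = P⁻¹ *ᴹ P} {x = x} (proj₂ (proj₂ P-invertible)) (λ _ → refl) i) (*ᵛ-identity x i))

  PP⁻¹ : ∀ x i → (P *ᵛ P⁻¹ *ᵛ x) i ≡ x i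
  PP⁻¹ x i = trans (sym (*ᵛ-*ᴹ P P⁻¹ x i))
    (trans (*ᵛ-cong {A = P *ᴹ P⁻¹} {x = x} (proj₁ (proj₂ P-invertible)) (λ _ → refl) i) (*ᵛ-identity x i))

  Q⁻¹Q : ∀ x i → (Q⁻¹ *ᵛ Q *ᵛ x) i ≡ x i
  Q⁻¹Q x i = trans (sym (*ᵛ-*ᴹ Q⁻¹ Q x i))
    (trans (*ᵛ-cong {A = Q⁻¹ *ᴹ Q} {x = x} (proj₂ (proj₂ Q-invertible)) (λ _ → refl) i) (*ᵛ-identity x i))

  QQ⁻¹ : ∀ x i → (Q *ᵛ Q⁻¹ *ᵛ x) i ≡ x i
  QQ⁻¹ x i = trans (sym (*ᵛ-*ᴹ Q Q⁻¹ x i))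
    (trans (*ᵛ-cong {A = Q *ᴹ Q⁻¹} {x = x} (proj₁ (proj₂ Q-invertible)) (λ _ → refl) i) (*ᵛ-identity x i))

  PAQ : ∀ x i → (P *ᵛ A *ᵛ Q *ᵛ x) i ≡ ℤ.+ d i ℤ.* x i
  PAQ x i = trans (sym (*ᵛ-*ᴹ P A (Q *ᵛ x) i)) (trans (sym (*ᵛ-*ᴹ (P *ᴹ A) Q x i))
    (trans (*ᵛ-cong {A = P *ᴹ A *ᴹ Q} {x = x} PAQ≗D (λ _ → refl) i) (diagonal-*ᵛ (ℤ.+_ ∘ d) x i)))

  AQ : ∀ x i → (A *ᵛ Q *ᵛ x) i ≡ (P⁻¹ *ᵛ λ j → ℤ.+ d j ℤ.* x j) i
  AQ x i = trans (sym (P⁻¹P (A *ᵛ Q *ᵛ x) i)) (*ᵛ-cong {A = P⁻¹} (λ _ _ → refl) (PAQ x) i)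

  DQ⁻¹ : ∀ x i → ℤ.+ d i ℤ.* (Q⁻¹ *ᵛ x) i ≡ (P *ᵛ A *ᵛ x) i
  DQ⁻¹ x i = trans (sym (PAQ (Q⁻¹ *ᵛ x) i))
    (*ᵛ-cong {A = P} (λ _ _ → refl) (*ᵛ-cong {A = A} (λ _ _ → refl) (QQ⁻¹ x)) i)

-- The cokernel

∏ : ∀ {N} → Vector ℕ N → ℕ
∏ {zero}  d = 1
∏ {suc N} d = d zero ℕ.* ∏ (d ∘ suc)

-- Mixed radix with the entries of `d` as bases. It numbers the residue vectors modulo `d`, that is,
-- the cokernel of the diagonal matrix.
digits : ∀ {N} (d : Vector ℕ N) → Fin (∏ d) → ∀ i → Fin (d i)
digits d k zero    = proj₁ (Fin.remQuot {d zero} (∏ (d ∘ suc)) k)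
digits d k (suc i) = digits (d ∘ suc) (proj₂ (Fin.remQuot {d zero} (∏ (d ∘ suc)) k)) i

fromDigits : ∀ {N} (d : Vector ℕ N) → (∀ i → Fin (d i)) → Fin (∏ d)
fromDigits {zero}  d r = zero
fromDigits {suc N} d r = Fin.combine (r zero) (fromDigits (d ∘ suc) (r ∘ suc))

digits-fromDigits : ∀ {N} (d : Vector ℕ N) r i → digits d (fromDigits d r) i ≡ r i
digits-fromDigits d r zero    = cong proj₁ (Fin.remQuot-combine {d zero} (r zero) (fromDigits (d ∘ suc) (r ∘ suc)))
digits-fromDigits d r (suc i) = trans
  (cong (λ k → digits (d ∘ suc) (proj₂ k) i) (Fin.remQuot-combine {d zero} (r zero) (fromDigits (d ∘ suc) (r ∘ suc))))
  (digits-fromDigits (d ∘ suc) (r ∘ suc) i)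

digits-injective : ∀ {N} (d : Vector ℕ N) k l → (∀ i → digits d k i ≡ digits d l i) → k ≡ l
digits-injective {zero}  d zero zero h = refl
digits-injective {suc N} d k    l    h = trans (sym (Fin.combine-remQuot {d zero} (∏ (d ∘ suc)) k)) (trans
  (cong₂ (Fin.combine {d zero}) (h zero) (digits-injective (d ∘ suc) _ _ (h ∘ suc))) (Fin.combine-remQuot {d zero} (∏ (d ∘ suc)) l))

residue-unique : ∀ {m a b} → a ℕ.< m → b ℕ.< m → ℤ.+ m ℤ∣.∣ ℤ.+ a ℤ.- ℤ.+ b → a ≡ b
residue-unique {m} {a} {b} a<m b<m m∣a-b with ℕ.<-cmp a b
... | tri≈ _ a≡b _ = a≡b
... | tri> _ _ b<a = contradiction
  (subst (λ x → m ∣ ℤ.∣ x ∣) (trans (ℤ.m-n≡m⊖n a b) (ℤ.⊖-≥ (ℕ.<⇒≤ b<a))) (ℤ∣.∣⇒∣ᵤ m∣a-b))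
  (ℕ.>⇒∤ {{ℕ.>-nonZero (ℕ.m<n⇒0<n∸m b<a)}} (ℕ.≤-<-trans (ℕ.m∸n≤m a b) a<m))
... | tri< a<b _ _ = contradiction
  (subst (m ∣_) (ℤ.∣-i∣≡∣i∣ (ℤ.+ (b ℕ.∸ a)))
    (subst (λ x → m ∣ ℤ.∣ x ∣) (trans (ℤ.m-n≡m⊖n a b) (ℤ.⊖-< a<b)) (ℤ∣.∣⇒∣ᵤ m∣a-b)))
  (ℕ.>⇒∤ {{ℕ.>-nonZero (ℕ.m<n⇒0<n∸m a<b)}} (ℕ.≤-<-trans (ℕ.m∸n≤m b a) b<m))

-- Multiplication by `P` carries the image of `A` onto that of the diagonal matrix, so the residue
-- vectors modulo `d`, pulled back by `P⁻¹`, represent each class exactly once.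
cokernel-finite : ∀ {N} {A : Matrix N} {d} → IsSmithNormalForm A d → (∀ i → d i ≢ 0) →
                  ∃ λ (S : Finite (cokernel A)) → card S ≡ ∏ d
cokernel-finite {N} {A} {d} snf d≢0 = (∏ d , record
  { to        = to
  ; cong      = to-cong
  ; bijective = (λ {k} {l} → injective k l)
              , strictlySurjective⇒surjective (≡.setoid (Fin (∏ d))) (cokernel A) {f = to}
                  to-cong surjective
  }) , refl
  where
  open SmithCoordinates snf
  open ≡.≡-Reasoning

  residues : Fin (∏ d) → Vector ℤ N
  residues k i = ℤ.+ Fin.toℕ (digits d k i)

  to : Fin (∏ d) → Vector ℤ N
  to k = P⁻¹ *ᵛ residues k

  to-cong : ∀ {k l} → k ≡ l → image A (λ i → to k i ℤ.- to l i)
  to-cong {k} refl = Setoid.refl (cokernel A) {to k}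

  injective : ∀ k l → image A (λ i → to k i ℤ.- to l i) → k ≡ l
  injective k l (x , e) = digits-injective d k l λ i → Fin.toℕ-injective
    (residue-unique (Fin.toℕ<n (digits d k i)) (Fin.toℕ<n (digits d l i))
      (ℤ∣.divides ((Q⁻¹ *ᵛ x) i) (begin
        residues k i ℤ.- residues l i
          ≡⟨ cong₂ ℤ._-_ (PP⁻¹ (residues k) i) (PP⁻¹ (residues l) i) ⟨
        (P *ᵛ to k) i ℤ.- (P *ᵛ to l) i             ≡⟨ *ᵛ-- P (to k) (to l) i ⟨
        (P *ᵛ λ j → to k j ℤ.- to l j) i            ≡⟨ *ᵛ-cong {A = P} (λ _ _ → refl) e i ⟩
        (P *ᵛ A *ᵛ x) i                             ≡⟨ DQ⁻¹ x i ⟨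
        ℤ.+ d i ℤ.* (Q⁻¹ *ᵛ x) i                    ≡⟨ ℤ.*-comm (ℤ.+ d i) _ ⟩
        (Q⁻¹ *ᵛ x) i ℤ.* ℤ.+ d i                    ∎)))

  surjective : ∀ y → ∃ λ k → image A (λ i → to k i ℤ.- y i)
  surjective y = k , Q *ᵛ x , λ i → begin
    to k i ℤ.- y i                                    ≡⟨ cong (ℤ._-_ (to k i)) (P⁻¹P y i) ⟨
    to k i ℤ.- (P⁻¹ *ᵛ P *ᵛ y) i                      ≡⟨ *ᵛ-- P⁻¹ (residues k) (P *ᵛ y) i ⟨
    (P⁻¹ *ᵛ λ j → residues k j ℤ.- (P *ᵛ y) j) i      ≡⟨ *ᵛ-cong {A = P⁻¹} (λ _ _ → refl) step i ⟩
    (P⁻¹ *ᵛ λ j → ℤ.+ d j ℤ.* x j) i                  ≡⟨ AQ x i ⟨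
    (A *ᵛ Q *ᵛ x) i                                   ∎
    where
    instance
      d-nonZero : ∀ {i} → ℕ.NonZero (d i)
      d-nonZero {i} = ℕ.≢-nonZero (d≢0 i)
    r : ∀ i → Fin (d i)
    r i = Fin.fromℕ< (ℤ.n%ℕd<d ((P *ᵛ y) i) (d i))
    k = fromDigits d r
    -- `P y` exceeds its residue vector by `d` times the quotients; `Q` turns the negated quotients
    -- into a preimage under `A`.
    x : Vector ℤ N
    x i = ℤ.- ((P *ᵛ y) i ℤ./ℕ d i)
    cancel : ∀ r p d → r ℤ.- (r ℤ.+ p ℤ.* d) ≡ d ℤ.* ℤ.- p
    cancel = solve-∀
    step : ∀ i → residues k i ℤ.- (P *ᵛ y) i ≡ ℤ.+ d i ℤ.* x i
    step i = trans
      (cong₂ ℤ._-_ (cong ℤ.+_ (trans (cong Fin.toℕ (digits-fromDigits d r i)) (Fin.toℕ-fromℕ< _)))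
                   (ℤ.a≡a%ℕn+[a/ℕn]*n ((P *ᵛ y) i) (d i)))
      (cancel (ℤ.+ ((P *ᵛ y) i ℤ.%ℕ d i)) _ (ℤ.+ d i))

∤-∏ : ∀ {ℓ} → Prime ℓ → ∀ {N} (d : Vector ℕ N) → (∀ i → ℓ ∤ d i) → ℓ ∤ ∏ d
∤-∏ ℓ-prime {zero}  d h ℓ∣1 = ¬prime[1] (subst Prime (ℕ.∣1⇒≡1 ℓ∣1) ℓ-prime)
∤-∏ ℓ-prime {suc N} d h ℓ∣∏ with euclidsLemma (d zero) (∏ (d ∘ suc)) ℓ-prime ℓ∣∏
... | inj₁ ℓ∣d = h zero ℓ∣d
... | inj₂ ℓ∣∏ = ∤-∏ ℓ-prime (d ∘ suc) (h ∘ suc) ℓ∣∏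

-- Counting

count : ∀ {p N} {P : Pred (Fin N) p} → Decidable P → ℕ
count {N = N} P? = length (filter P? (allFin N))

count-all : ∀ {p N} {P : Pred (Fin N) p} (P? : Decidable P) → (∀ i → P i) → count P? ≡ N
count-all {N = N} P? h = trans (cong length (filter-all P? {xs = allFin N} (All.universal h _))) (length-tabulate _)

count-none : ∀ {p N} {P : Pred (Fin N) p} (P? : Decidable P) → (∀ i → ¬ P i) → count P? ≡ 0
count-none {N = N} P? h = cong length (filter-none P? {xs = allFin N} (All.universal h _))

module _ {p N} {P : Pred (Fin N) p} (P? : Decidable P) where
  select : Fin (count P?) → Fin N
  select = lookup (filter P? (allFin N))

  select-injective : ∀ s t → select s ≡ select t → s ≡ t
  select-injective = lookup-injective (≡.setoid (Fin N)) (Unique.filter⁺ P? (Unique.allFin⁺ N))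

  select-satisfies : ∀ s → P (select s)
  select-satisfies s = proj₂ (∈-filter⁻ P? {xs = allFin N} (∈-lookup s))

  select-surjective : ∀ {i} → P i → ∃ λ s → select s ≡ i
  select-surjective {i} Pi = Any.index i∈ , sym (lookup-index i∈)
    where i∈ = ∈-filter⁺ P? (∈-allFin i) Pi

module _ {a} {A : Set a} where
  -- Matches the shape of `hasValuation?`: divisible by `ℓ ^ i` and not by `ℓ ^ suc i`.
  -- Multiplicities thereby become differences of divisibility counts.
  length-filter-∖ : ∀ {p r} {P : Pred A p} {R : Pred A r} (P? : Decidable P) (R? : Decidable R) → R ⊆ P → ∀ xs →
                    length (filter (λ x → P? x ×-dec ¬? (R? x)) xs) ℕ.+ length (filter R? xs) ≡ length (filter P? xs)
  length-filter-∖ P? R? R⊆P [] = refl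
  length-filter-∖ P? R? R⊆P (x ∷ xs) with P? x | R? x
  ... | yes _ | yes _ = trans (ℕ.+-suc _ _) (cong suc (length-filter-∖ P? R? R⊆P xs))
  ... | yes _ | no  _ = cong suc (length-filter-∖ P? R? R⊆P xs)
  ... | no ¬p | yes r = contradiction (R⊆P r) ¬p
  ... | no  _ | no  _ = length-filter-∖ P? R? R⊆P xs

  length-filter-tabulate : ∀ {p} {P : Pred A p} (P? : Decidable P) {N} (f : Fin N → A) {M} (g : Fin M → Fin N) →
                           length (filter P? (tabulate (f ∘ g))) ≡ length (filter (P? ∘ f) (tabulate g))
  length-filter-tabulate P? f {zero}  g = refl
  length-filter-tabulate P? f {suc M} g with P? (f (g zero))
  ... | yes _ = cong suc (length-filter-tabulate P? f (g ∘ suc))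
  ... | no  _ = length-filter-tabulate P? f (g ∘ suc)

𝟙 : ∀ {p} {P : Set p} → Dec P → ℕ
𝟙 P? = if does P? then 1 else 0

count-suc : ∀ {p N} {P : Pred (Fin (suc N)) p} (P? : Decidable P) → count P? ≡ 𝟙 (P? zero) ℕ.+ count (P? ∘ suc)
count-suc P? with P? zero
... | yes _ = cong suc (length-filter-tabulate P? suc (λ i → i))
... | no  _ = length-filter-tabulate P? suc (λ i → i)

count-const : ∀ {p N} {P : Set p} (P? : Dec P) → count {N = N} (λ _ → P?) ≡ N ℕ.* 𝟙 P?
count-const {N = N} (yes p) = trans (count-all {N = N} (λ _ → yes p) (λ _ → p)) (sym (ℕ.*-identityʳ N))
count-const {N = N} (no ¬p) = trans (count-none {N = N} (λ _ → no ¬p) (λ _ → ¬p)) (sym (ℕ.*-zeroʳ N))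

-- Linear maps and kernels modulo m

module _ where
  open import Data.Integer.Base using (_+_; _*_; _-_; -_)
  open ≡.≡-Reasoning

  record Linear {M N} (φ : Vector ℤ M → Vector ℤ N) : Set where
    field
      ext    : ∀ {x y} → (∀ i → x i ≡ y i) → ∀ i → φ x i ≡ φ y i
      linear : ∀ a b x y i → φ (λ j → a * x j + b * y j) i ≡ a * φ x i + b * φ y i

    multiple : ∀ {x y} m → (∀ i → x i ≡ y i * m) → ∀ i → φ x i ≡ φ y i * m
    multiple {x} {y} m h i = begin
      φ x i                                ≡⟨ ext {x} {λ j → m * y j + 0ℤ * y j} (λ j → trans (h j) (expand m (y j))) i ⟩
      φ (λ j → m * y j + 0ℤ * y j) i       ≡⟨ linear m 0ℤ y y i ⟩
      m * φ y i + 0ℤ * φ y i               ≡⟨ expand m (φ y i) ⟨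
      φ y i * m                            ∎
      where
      expand : ∀ m y → y * m ≡ m * y + 0ℤ * y
      expand = solve-∀

    resp-∣ : ∀ x m → (∀ i → m ℤ∣.∣ x i) → ∀ i → m ℤ∣.∣ φ x i
    resp-∣ x m h i = ℤ∣.divides (φ (ℤ∣._∣_.quotient ∘ h) i) (multiple m (ℤ∣._∣_.equality ∘ h) i)

    difference : ∀ x y i → φ (λ j → 1ℤ * x j + -1ℤ * y j) i ≡ φ x i - φ y i
    difference x y i = trans (linear 1ℤ -1ℤ x y i) (minus (φ x i) (φ y i))
      where
      minus : ∀ x y → 1ℤ * x + -1ℤ * y ≡ x - y
      minus = solve-∀

    resp-≡mod : ∀ x y m → (∀ i → m ℤ∣.∣ x i - y i) → ∀ i → m ℤ∣.∣ φ x i - φ y i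
    resp-≡mod x y m h i = subst (m ℤ∣.∣_) (difference x y i)
      (resp-∣ (λ j → 1ℤ * x j + -1ℤ * y j) m (λ j → subst (m ℤ∣.∣_) (minus (x j) (y j)) (h j)) i)
      where
      minus : ∀ x y → x - y ≡ 1ℤ * x + -1ℤ * y
      minus = solve-∀

  open Linear public

  ∘-linear : ∀ {L M N} {ψ : Vector ℤ M → Vector ℤ N} {φ : Vector ℤ L → Vector ℤ M} →
             Linear ψ → Linear φ → Linear (ψ ∘ φ)
  ∘-linear {φ = φ} ψ-linear φ-linear = record
    { ext    = λ {x} {y} h → ext ψ-linear {φ x} {φ y} (ext φ-linear {x} {y} h)
    ; linear = λ a b x y i → trans (ext ψ-linear {φ (λ j → a * x j + b * y j)} {λ j → a * φ x j + b * φ y j}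
        (linear φ-linear a b x y) i) (linear ψ-linear a b (φ x) (φ y) i)
    }

  sum-*-linear : ∀ {N} (f : Vector ℤ N) a b (x y : Vector ℤ N) →
                 sum (λ j → f j * (a * x j + b * y j)) ≡ a * sum (λ j → f j * x j) + b * sum (λ j → f j * y j)
  sum-*-linear f a b x y = trans (sum-cong λ j → expand (f j) a b (x j) (y j))
    (sum-linear a b (λ j → f j * x j) (λ j → f j * y j))
    where
    expand : ∀ f a b x y → f * (a * x + b * y) ≡ a * (f * x) + b * (f * y)
    expand = solve-∀

  *ᵛ-linear : ∀ {N} (A : Matrix N) → Linear (A *ᵛ_)
  *ᵛ-linear A = record
    { ext    = λ {x} {y} → *ᵛ-cong {A = A} {x = x} {y} (λ _ _ → refl)
    ; linear = λ a b x y i → sum-*-linear (A i) a b x y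
    }

  -- The maps are linear over ℤ on the whole lattices but mutually inverse only modulo `m` and only
  -- on `K` and `K′`. Being integral, they also preserve divisibility by ℓ, which is what lets a
  -- kernel modulo a power of ℓ be compared after reduction modulo ℓ.
  record KernelIso (m : ℤ) {M N} (K : Vector ℤ M → Set) (K′ : Vector ℤ N → Set) : Set where
    field
      to          : Vector ℤ M → Vector ℤ N
      from        : Vector ℤ N → Vector ℤ M
      to-linear   : Linear to
      from-linear : Linear from
      to-∈        : ∀ {x} → K x → K′ (to x)
      from-∈      : ∀ {y} → K′ y → K (from y)
      from∘to     : ∀ {x} → K x → ∀ i → m ℤ∣.∣ from (to x) i - x i
      to∘from     : ∀ {y} → K′ y → ∀ i → m ℤ∣.∣ to (from y) i - y i

  ∣-telescope : ∀ {m} x y z → m ℤ∣.∣ x - y → m ℤ∣.∣ y - z → m ℤ∣.∣ x - z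
  ∣-telescope {m} x y z p r = subst (m ℤ∣.∣_) (telescope x y z) (ℤ∣.∣m∣n⇒∣m+n p r)
    where
    telescope : ∀ x y z → (x - y) + (y - z) ≡ x - z
    telescope = solve-∀

  KernelIso-sym : ∀ {m M N} {K : Vector ℤ M → Set} {K′ : Vector ℤ N → Set} → KernelIso m K K′ → KernelIso m K′ K
  KernelIso-sym f = record
    { to = from; from = to; to-linear = from-linear; from-linear = to-linear
    ; to-∈ = from-∈; from-∈ = to-∈; from∘to = to∘from; to∘from = from∘to
    } where open KernelIso f

  KernelIso-trans : ∀ {m L M N} {K : Vector ℤ L → Set} {K′ : Vector ℤ M → Set} {K″ : Vector ℤ N → Set} →
                    KernelIso m K K′ → KernelIso m K′ K″ → KernelIso m K K″
  KernelIso-trans {m} f g = record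
    { to          = G.to ∘ F.to
    ; from        = F.from ∘ G.from
    ; to-linear   = ∘-linear G.to-linear F.to-linear
    ; from-linear = ∘-linear F.from-linear G.from-linear
    ; to-∈        = G.to-∈ ∘ F.to-∈
    ; from-∈      = F.from-∈ ∘ G.from-∈
    ; from∘to     = λ {x} h i → ∣-telescope (F.from (G.from (G.to (F.to x))) i) (F.from (F.to x) i) (x i)
        (resp-≡mod F.from-linear (G.from (G.to (F.to x))) (F.to x) m (G.from∘to (F.to-∈ h)) i) (F.from∘to h i)
    ; to∘from     = λ {z} h i → ∣-telescope (G.to (F.to (F.from (G.from z))) i) (G.to (G.from z) i) (z i)
        (resp-≡mod G.to-linear (F.to (F.from (G.from z))) (G.from z) m (F.to∘from (G.from-∈ h)) i) (G.to∘from h i)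
    }
    where
    module F = KernelIso f
    module G = KernelIso g

  Kernel : ∀ {N} → ℤ → Matrix N → Vector ℤ N → Set
  Kernel m A x = ∀ i → m ℤ∣.∣ (A *ᵛ x) i

  DiagonalKernel : ∀ {N} → ℤ → Vector ℕ N → Vector ℤ N → Set
  DiagonalKernel m d x = ∀ i → m ℤ∣.∣ ℤ.+ d i * x i

  ≡⇒∣- : ∀ {m x y} → x ≡ y → m ℤ∣.∣ x - y
  ≡⇒∣- {x = x} refl = ℤ∣.divides 0ℤ (ℤ.+-inverseʳ x)

  -- `P` changes the values of the map but not its kernel, so `Q` alone gives the coordinates.
  smithKernelIso : ∀ {N} {A : Matrix N} {d} m → IsSmithNormalForm A d → KernelIso m (DiagonalKernel m d) (Kernel m A)
  smithKernelIso {A = A} {d} m snf = record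
    { to          = Q *ᵛ_
    ; from        = Q⁻¹ *ᵛ_
    ; to-linear   = *ᵛ-linear Q
    ; from-linear = *ᵛ-linear Q⁻¹
    ; to-∈        = λ {x} h i → subst (m ℤ∣.∣_) (sym (AQ x i)) (resp-∣ (*ᵛ-linear P⁻¹) (λ j → ℤ.+ d j * x j) m h i)
    ; from-∈      = λ {x} h i → subst (m ℤ∣.∣_) (sym (DQ⁻¹ x i)) (resp-∣ (*ᵛ-linear P) (A *ᵛ x) m h i)
    ; from∘to     = λ {x} _ i → ≡⇒∣- (Q⁻¹Q x i)
    ; to∘from     = λ {x} _ i → ≡⇒∣- (QQ⁻¹ x i)
    }
    where open SmithCoordinates snf

funToFin-cong : ∀ {a b} (f g : Fin a → Fin b) → (∀ i → f i ≡ g i) → Fin.funToFin f ≡ Fin.funToFin g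
funToFin-cong {zero}  f g h = refl
funToFin-cong {suc a} f g h = cong₂ Fin.combine (h zero) (funToFin-cong (f ∘ suc) (g ∘ suc) (h ∘ suc))

-- Prime powers

module _ {ℓ} (ℓ-prime : Prime ℓ) where
  open import Data.Integer.Base using (_+_; _*_; _-_; -_)
  private
    instance
      ℓ-nonZero : ℕ.NonZero ℓ
      ℓ-nonZero = prime⇒nonZero ℓ-prime

  ^∣-cancelʳ : ∀ j a b → ℓ ∤ b → ℓ ℕ.^ j ∣ a ℕ.* b → ℓ ℕ.^ j ∣ a
  ^∣-cancelʳ zero    a b ℓ∤b h = ℕ.1∣ a
  ^∣-cancelʳ (suc j) a b ℓ∤b h with ^∣-cancelʳ j a b ℓ∤b (ℕ.∣-trans (ℕ.n∣m*n ℓ) h)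
  ... | ℕ.divides c refl = ℕ.*-monoˡ-∣ (ℓ ℕ.^ j) ℓ∣c
    where
    ℓ∣cb : ℓ ∣ c ℕ.* b
    ℓ∣cb = ℕ.*-cancelʳ-∣ (ℓ ℕ.^ j) {{ℕ.m^n≢0 ℓ j}} (subst (ℓ ℕ.* ℓ ℕ.^ j ∣_)
      (trans (ℕ.*-assoc c (ℓ ℕ.^ j) b) (trans (cong (c ℕ.*_) (ℕ.*-comm (ℓ ℕ.^ j) b)) (sym (ℕ.*-assoc c b (ℓ ℕ.^ j))))) h)
    ℓ∣c : ℓ ∣ c
    ℓ∣c = [ (λ x → x) , (λ ℓ∣b → contradiction ℓ∣b ℓ∤b) ]′ (euclidsLemma c b ℓ-prime ℓ∣cb)

  -- Meant for a vector in a diagonal kernel: where `ℓ ^ j` does not divide the diagonal entry `a`,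
  -- the coordinate `b` vanishes modulo ℓ.
  ^∣*⇒∣ : ∀ j a b → ¬ ℓ ℕ.^ j ∣ a → ℓ ℕ.^ j ∣ a ℕ.* b → ℓ ∣ b
  ^∣*⇒∣ j a b ∤a ∣ab with ℓ ℕ.∣? b
  ... | yes ℓ∣b = ℓ∣b
  ... | no  ℓ∤b = contradiction (^∣-cancelʳ j a b ℓ∤b ∣ab) ∤a

  -- The vectors of the diagonal kernel supported where ℓ ^ j divides d form a
  -- space of dimension count over 𝔽_ℓ, and an isomorphism of kernels maps it
  -- injectively into the corresponding space for d′.
  count-≤ : ∀ {M N} {d : Vector ℕ M} {d′ : Vector ℕ N} j →
            KernelIso (ℤ.+ (ℓ ℕ.^ suc j)) (DiagonalKernel (ℤ.+ (ℓ ℕ.^ suc j)) d) (DiagonalKernel (ℤ.+ (ℓ ℕ.^ suc j)) d′) →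
            count (λ k → ℓ ℕ.^ suc j ℕ.∣? d k) ℕ.≤ count (λ k → ℓ ℕ.^ suc j ℕ.∣? d′ k)
  count-≤ {M} {N} {d} {d′} j iso = ℕ.≮⇒≥ λ t′<t →
    let k , l , k<l , e = Fin.pigeonhole (ℕ.^-monoʳ-< ℓ ℓ>1 t′<t) code in Fin.<⇒≢ k<l (separated k l e)
    where
    open KernelIso iso
    m = ℓ ℕ.^ suc j
    P? : ∀ {n} (d : Vector ℕ n) → Decidable (λ k → m ∣ d k)
    P? d k = m ℕ.∣? d k
    t = count (P? d)
    t′ = count (P? d′)
    ℓ>1 : 1 ℕ.< ℓ
    ℓ>1 = ℕ.nonTrivial⇒n>1 ℓ {{prime⇒nonTrivial ℓ-prime}}
    e = select (P? d)
    e′ = select (P? d′)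

    embed : Vector ℤ t → Vector ℤ M
    embed x i = sum (λ s → x s * δ (e s) i)

    embed-select : ∀ x s → embed x (e s) ≡ x s
    embed-select x s = trans (sum-cong λ r → cong (x r *_) (δ-select r)) (sum-δʳ s x)
      where
      δ-select : ∀ r → δ (e r) (e s) ≡ δ r s
      δ-select r with r Fin.≟ s
      ... | yes refl = δ-refl (e r)
      ... | no r≢s   = δ-≢ (r≢s ∘ select-injective (P? d) r s)

    embed-outside : ∀ x {i} → ¬ m ∣ d i → embed x i ≡ 0ℤ
    embed-outside x {i} ∤d = sum-zero λ s →
      trans (cong (x s *_) (δ-≢ {i = e s} {i} λ { refl → ∤d (select-satisfies (P? d) s) })) (ℤ.*-zeroʳ (x s))

    -- Digits below ℓ represent every vector over the field with ℓ elements exactly once, so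
    -- congruence modulo ℓ will imply equality.
    vec : Fin (ℓ ℕ.^ t) → Vector ℤ t
    vec k s = ℤ.+ Fin.toℕ (Fin.finToFun {ℓ} {t} k s)

    residue : Fin (ℓ ℕ.^ t) → Fin t′ → Fin ℓ
    residue k s = Fin.fromℕ< (ℤ.n%ℕd<d (to (embed (vec k)) (e′ s)) ℓ)

    code : Fin (ℓ ℕ.^ t) → Fin (ℓ ℕ.^ t′)
    code k = Fin.funToFin (residue k)

    separated : ∀ k l → code k ≡ code l → k ≡ l
    separated k l code≡ = trans (sym (Fin.funToFin-finToFin {t} {ℓ} k)) (trans
      (funToFin-cong (Fin.finToFun {ℓ} {t} k) (Fin.finToFun {ℓ} {t} l) λ s → Fin.toℕ-injective
        (residue-unique (Fin.toℕ<n (Fin.finToFun {ℓ} {t} k s)) (Fin.toℕ<n (Fin.finToFun {ℓ} {t} l s))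
          (subst (ℤ.+ ℓ ℤ∣.∣_) (trans (cong₂ (λ x y → 1ℤ * x + -1ℤ * y) (embed-select (vec k) s) (embed-select (vec l) s))
            (minus (vec k s) (vec l s))) (ℓ∣z (e s)))))
      (Fin.funToFin-finToFin {t} {ℓ} l))
      where
      minus : ∀ x y → 1ℤ * x + -1ℤ * y ≡ x - y
      minus = solve-∀

      x = embed (vec k)
      y = embed (vec l)
      z : Vector ℤ M
      z i = 1ℤ * x i + -1ℤ * y i

      z∈ : DiagonalKernel (ℤ.+ m) d z
      z∈ i with P? d i
      ... | yes ∣d = ℤ∣.∣m⇒∣m*n {ℤ.+ m} {ℤ.+ d i} (z i) (ℤ∣.∣ᵤ⇒∣ ∣d)
      ... | no  ∤d = ℤ∣.divides 0ℤ (trans (cong₂ (λ x y → ℤ.+ d i * (1ℤ * x + -1ℤ * y))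
              (embed-outside (vec k) {i} ∤d) (embed-outside (vec l) {i} ∤d)) (ℤ.*-zeroʳ (ℤ.+ d i)))

      residue≡ : ∀ s → to x (e′ s) ℤ.%ℕ ℓ ≡ to y (e′ s) ℤ.%ℕ ℓ
      residue≡ s = trans (sym (Fin.toℕ-fromℕ< _)) (trans (cong Fin.toℕ
        (trans (sym (Fin.finToFun-funToFin (residue k) s)) (trans (cong (λ c → Fin.finToFun c s) code≡)
          (Fin.finToFun-funToFin (residue l) s)))) (Fin.toℕ-fromℕ< _))

      ℓ∣-selected : ∀ s → ℤ.+ ℓ ℤ∣.∣ to x (e′ s) - to y (e′ s)
      ℓ∣-selected s = ℤ∣.divides (to x (e′ s) ℤ./ℕ ℓ - to y (e′ s) ℤ./ℕ ℓ) (trans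
        (cong₂ _-_ (ℤ.a≡a%ℕn+[a/ℕn]*n (to x (e′ s)) ℓ)
          (trans (ℤ.a≡a%ℕn+[a/ℕn]*n (to y (e′ s)) ℓ) (cong (λ r → ℤ.+ r + to y (e′ s) ℤ./ℕ ℓ * ℤ.+ ℓ) (sym (residue≡ s)))))
        (cancel (ℤ.+ (to x (e′ s) ℤ.%ℕ ℓ)) (to x (e′ s) ℤ./ℕ ℓ) (to y (e′ s) ℤ./ℕ ℓ) (ℤ.+ ℓ)))
        where
        cancel : ∀ r a b n → (r + a * n) - (r + b * n) ≡ (a - b) * n
        cancel = solve-∀

      -- Equal codes give the congruence at the selected positions of `d′`; at all others any kernel
      -- vector is divisible by ℓ.
      ℓ∣φz : ∀ i → ℤ.+ ℓ ℤ∣.∣ to z i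
      ℓ∣φz i with P? d′ i
      ... | yes ∣d with select-surjective (P? d′) ∣d
      ...   | s , refl = subst (ℤ.+ ℓ ℤ∣.∣_) (sym (difference to-linear x y (e′ s))) (ℓ∣-selected s)
      ℓ∣φz i | no ∤d = ℤ∣.∣ᵤ⇒∣ (^∣*⇒∣ (suc j) (d′ i) ℤ.∣ to z i ∣ ∤d
        (subst (m ∣_) (ℤ.abs-* (ℤ.+ d′ i) (to z i)) (ℤ∣.∣⇒∣ᵤ (to-∈ z∈ i))))

      -- `from (to z)` is divisible by ℓ and differs from `z` by a multiple of `ℓ ^ suc j`. The
      -- exponent is positive, so ℓ divides `z` as well.
      ℓ∣z : ∀ i → ℤ.+ ℓ ℤ∣.∣ z i
      ℓ∣z i = subst (ℤ.+ ℓ ℤ∣.∣_) (restore (from (to z) i) (z i))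
        (ℤ∣.∣m∣n⇒∣m-n (resp-∣ from-linear (to z) (ℤ.+ ℓ) ℓ∣φz i)
          (ℤ∣.∣-trans (ℤ∣.∣ᵤ⇒∣ (ℕ.m∣m*n (ℓ ℕ.^ j))) (from∘to z∈ i)))
        where
        restore : ∀ a b → a - (a - b) ≡ b
        restore = solve-∀

  count-≡ : ∀ {M N} {d : Vector ℕ M} {d′ : Vector ℕ N} j →
            KernelIso (ℤ.+ (ℓ ℕ.^ suc j)) (DiagonalKernel (ℤ.+ (ℓ ℕ.^ suc j)) d) (DiagonalKernel (ℤ.+ (ℓ ℕ.^ suc j)) d′) →
            count (λ k → ℓ ℕ.^ suc j ℕ.∣? d k) ≡ count (λ k → ℓ ℕ.^ suc j ℕ.∣? d′ k)
  count-≡ j iso = ℕ.≤-antisym (count-≤ j iso) (count-≤ j (KernelIso-sym iso))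

-- The kernel of A = q I + J - NᵀN modulo m

module _ where
  open import Data.Integer.Base using (_+_; _*_; _-_; -_)
  open ≡.≡-Reasoning

  infixl 6 _+∣_
  _+∣_ : ∀ {m x y} → m ℤ∣.∣ x → m ℤ∣.∣ y → m ℤ∣.∣ x + y
  _+∣_ = ℤ∣.∣m∣n⇒∣m+n

  infixl 7 _*∣_
  _*∣_ : ∀ {m x} y → m ℤ∣.∣ x → m ℤ∣.∣ y * x
  y *∣ h = ℤ∣.∣n⇒∣m*n y h

  sum-linear₃ : ∀ {N} a b c (x y z : Vector ℤ N) →
                sum (λ k → a * x k + b * y k + c * z k) ≡ a * sum x + b * sum y + c * sum z
  sum-linear₃ a b c x y z = begin
    sum (λ k → a * x k + b * y k + c * z k)
      ≡⟨ ∑-distrib-+ (λ k → a * x k + b * y k) (λ k → c * z k) ⟩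
    sum (λ k → a * x k + b * y k) + sum (λ k → c * z k)
      ≡⟨ cong₂ _+_ (sum-linear a b x y) (sym (*-distribˡ-sum c z)) ⟩
    a * sum x + b * sum y + c * sum z ∎

  sum-*-linear₃ : ∀ {N} (f : Vector ℤ N) a b c (x y z : Vector ℤ N) →
                  sum (λ k → f k * (a * x k + b * y k + c * z k)) ≡
                  a * sum (λ k → f k * x k) + b * sum (λ k → f k * y k) + c * sum (λ k → f k * z k)
  sum-*-linear₃ f a b c x y z = trans (sum-cong λ k → expand (f k) a b c (x k) (y k) (z k))
    (sum-linear₃ a b c (λ k → f k * x k) (λ k → f k * y k) (λ k → f k * z k))
    where
    expand : ∀ f a b c x y z → f * (a * x + b * y + c * z) ≡ a * (f * x) + b * (f * y) + c * (f * z)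
    expand = solve-∀

  -- Up to sign, these are the rows of `(q I - Y X) z`. The coordinate `z zero` belongs to the row
  -- of ones in `Y` and the column of -1 in `X`; `w` and `l` are the row sums of `N` and the number
  -- of lines.
  module PointKernel (m q u w l : ℤ) {v : ℕ} (z : Vector ℤ (suc v)) where
    ∑z = sum (z ∘ suc)
    total = w * ∑z - (q + l) * z zero
    row : Fin v → ℤ
    row i = q * q * u * z (suc i) + ∑z - w * z zero

  PointKernel : (m q u w l : ℤ) {v : ℕ} → Vector ℤ (suc v) → Set
  PointKernel m q u w l z = (m ℤ∣.∣ total) × (∀ i → m ℤ∣.∣ row i)
    where open PointKernel m q u w l z

  -- q I - X Y and q I - Y X have isomorphic kernels when q is invertible;
  -- here X Y = NᵀN - J with X = (Nᵀ | -1) and Y = (N ; 1).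
  module _ {l v : ℕ} (N : Fin v → Fin l → ℤ) (A : Matrix l) (q u w : ℤ)
           (NᵀN : ∀ k k′ → sum (λ i → N i k * N i k′) ≡ q * δ k k′ + 1ℤ - A k k′)
           (NNᵀ : ∀ i j → sum (λ k → N i k * N j k) ≡ q * (1ℤ + q * u) * δ i j + 1ℤ)
           (degree : ∀ i → sum (N i) ≡ w)
           (m q′ : ℤ) (q-unit : m ℤ∣.∣ q * q′ - 1ℤ) where
    private
      points : Vector ℤ l → Vector ℤ v
      points x i = sum (λ k → N i k * x k)

      lines : Vector ℤ v → Vector ℤ l
      lines z k = sum (λ i → N i k * z i)

      points-linear : Linear points
      points-linear = record
        { ext    = λ h i → sum-cong λ k → cong (N i k *_) (h k)
        ; linear = λ a b x y i → sum-*-linear (N i) a b x y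
        }

      lines-linear : Linear lines
      lines-linear = record
        { ext    = λ h k → sum-cong λ i → cong (N i k *_) (h i)
        ; linear = λ a b x y k → sum-*-linear (λ i → N i k) a b x y
        }

      A* : ∀ x k → (A *ᵛ x) k ≡ q * x k + sum x * 1ℤ + -1ℤ * lines (points x) k
      A* x k = begin
        sum (λ k′ → A k k′ * x k′)
          ≡⟨ sum-cong (λ k′ → trans (cong (_* x k′) (solveFor (A k k′) (q * δ k k′) (NᵀN k k′)))
               (expand q (δ k k′) (sum (λ i → N i k * N i k′)) (x k′))) ⟩
        sum (λ k′ → q * (δ k k′ * x k′) + 1ℤ * x k′ + -1ℤ * (sum (λ i → N i k * N i k′) * x k′))
          ≡⟨ sum-linear₃ q 1ℤ -1ℤ (λ k′ → δ k k′ * x k′) x (λ k′ → sum (λ i → N i k * N i k′) * x k′) ⟩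
        q * sum (λ k′ → δ k k′ * x k′) + 1ℤ * sum x + -1ℤ * sum (λ k′ → sum (λ i → N i k * N i k′) * x k′)
          ≡⟨ cong₂ (λ y z → y + -1ℤ * z)
               (cong₂ (λ y z → q * y + z) (sum-δˡ k x) (ℤ.*-comm 1ℤ (sum x)))
               (sum-assoc (λ i → N i k) N x) ⟩
        q * x k + sum x * 1ℤ + -1ℤ * lines (points x) k ∎
        where
        solveFor : ∀ a t {s} → s ≡ t + 1ℤ - a → a ≡ t + 1ℤ - s
        solveFor a t refl = cancel a t
          where
          cancel : ∀ a t → a ≡ t + 1ℤ - (t + 1ℤ - a)
          cancel = solve-∀
        expand : ∀ q d s x → (q * d + 1ℤ - s) * x ≡ q * (d * x) + 1ℤ * x + -1ℤ * (s * x)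
        expand = solve-∀

      points-lines : ∀ z j → points (lines z) j ≡ q * (1ℤ + q * u) * z j + 1ℤ * sum z
      points-lines z j = begin
        sum (λ k → N j k * sum (λ i → N i k * z i))  ≡⟨ sum-assoc (N j) (λ k i → N i k) z ⟨
        sum (λ i → sum (λ k → N j k * N i k) * z i)
          ≡⟨ sum-cong (λ i → trans (cong (_* z i) (NNᵀ j i)) (expand (q * (1ℤ + q * u)) (δ j i) (z i))) ⟩
        sum (λ i → q * (1ℤ + q * u) * (δ j i * z i) + 1ℤ * z i)
          ≡⟨ sum-linear (q * (1ℤ + q * u)) 1ℤ (λ i → δ j i * z i) z ⟩
        q * (1ℤ + q * u) * sum (λ i → δ j i * z i) + 1ℤ * sum z
          ≡⟨ cong (λ y → q * (1ℤ + q * u) * y + 1ℤ * sum z) (sum-δˡ j z) ⟩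
        q * (1ℤ + q * u) * z j + 1ℤ * sum z ∎
        where
        expand : ∀ c d z → (c * d + 1ℤ) * z ≡ c * (d * z) + 1ℤ * z
        expand = solve-∀

      sum-lines : ∀ z → sum (lines z) ≡ w * sum z
      sum-lines z = begin
        sum (λ k → sum (λ i → N i k * z i))   ≡⟨ ∑-comm (λ k i → N i k * z i) ⟩
        sum (λ i → sum (λ k → N i k * z i))
          ≡⟨ sum-cong (λ i → trans (sym (*-distribʳ-sum (z i) (N i))) (cong (_* z i) (degree i))) ⟩
        sum (λ i → w * z i)                   ≡⟨ *-distribˡ-sum w z ⟨
        w * sum z                             ∎

      points-1 : ∀ i → sum (λ k → N i k * 1ℤ) ≡ w
      points-1 i = trans (sum-cong λ k → ℤ.*-identityʳ (N i k)) (degree i)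

      sum-1 : sum {l} (λ _ → 1ℤ) ≡ ℤ.+ l
      sum-1 = trans (sum-const l 1ℤ) (ℤ.*-identityʳ (ℤ.+ l))

      -- `to` is multiplication by `Y`, and `from` is `q′` times multiplication by `X`: on the
      -- kernels `X Y` and `Y X` act as `q`, so `q′` makes the two maps inverse.
      to : Vector ℤ l → Vector ℤ (suc v)
      to x zero    = sum x
      to x (suc i) = points x i

      from : Vector ℤ (suc v) → Vector ℤ l
      from z k = q′ * lines (z ∘ suc) k + - q′ * z zero * 1ℤ

      to-linear : Linear to
      to-linear = record { ext = to-ext ; linear = to-lin }
        where
        to-ext : ∀ {x y} → (∀ k → x k ≡ y k) → ∀ i → to x i ≡ to y i
        to-ext h zero    = sum-cong h
        to-ext {x} {y} h (suc i) = ext points-linear {x} {y} h i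
        to-lin : ∀ a b x y i → to (λ k → a * x k + b * y k) i ≡ a * to x i + b * to y i
        to-lin a b x y zero    = sum-linear a b x y
        to-lin a b x y (suc i) = linear points-linear a b x y i

      from-linear : Linear from
      from-linear = record
        { ext    = λ {x} {y} h k → cong₂ (λ s t → q′ * s + - q′ * t * 1ℤ)
            (ext lines-linear {x ∘ suc} {y ∘ suc} (h ∘ suc) k) (h zero)
        ; linear = λ a b x y k → trans
            (cong (λ s → q′ * s + - q′ * (a * x zero + b * y zero) * 1ℤ) (linear lines-linear a b (x ∘ suc) (y ∘ suc) k))
            (collect q′ a b (lines (x ∘ suc) k) (lines (y ∘ suc) k) (x zero) (y zero))
        }
        where
        collect : ∀ q′ a b s t x y → q′ * (a * s + b * t) + - q′ * (a * x + b * y) * 1ℤ ≡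
                  a * (q′ * s + - q′ * x * 1ℤ) + b * (q′ * t + - q′ * y * 1ℤ)
        collect = solve-∀

      points-from : ∀ z j → points (from z) j ≡
                    q′ * (q * (1ℤ + q * u) * z (suc j) + 1ℤ * sum (z ∘ suc)) + - q′ * z zero * w
      points-from z j = trans (sum-*-linear (N j) q′ (- q′ * z zero) (lines (z ∘ suc)) (λ _ → 1ℤ))
        (cong₂ (λ s t → q′ * s + - q′ * z zero * t) (points-lines (z ∘ suc) j) (points-1 j))

      sum-from : ∀ z → sum (from z) ≡ q′ * (w * sum (z ∘ suc)) + - q′ * z zero * ℤ.+ l
      sum-from z = trans (sum-linear q′ (- q′ * z zero) (lines (z ∘ suc)) (λ _ → 1ℤ))
        (cong₂ (λ s t → q′ * s + - q′ * z zero * t) (sum-lines (z ∘ suc)) sum-1)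

      to∘from : ∀ z → PointKernel m q u w (ℤ.+ l) z → ∀ i → m ℤ∣.∣ to (from z) i - z i
      to∘from z (total , row) zero = subst (m ℤ∣.∣_)
        (trans (identity q q′ w (ℤ.+ l) (sum (z ∘ suc)) (z zero)) (cong (_- z zero) (sym (sum-from z))))
        (q′ *∣ total +∣ z zero *∣ q-unit)
        where
        identity : ∀ q q′ w l s z → q′ * (w * s - (q + l) * z) + z * (q * q′ - 1ℤ) ≡
                   q′ * (w * s) + - q′ * z * l - z
        identity = solve-∀
      to∘from z (total , row) (suc j) = subst (m ℤ∣.∣_)
        (trans (identity q q′ u w (sum (z ∘ suc)) (z zero) (z (suc j))) (cong (_- z (suc j)) (sym (points-from z j))))
        (q′ *∣ row j +∣ z (suc j) *∣ q-unit)
        where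
        identity : ∀ q q′ u w s z₀ z → q′ * (q * q * u * z + s - w * z₀) + z * (q * q′ - 1ℤ) ≡
                   q′ * (q * (1ℤ + q * u) * z + 1ℤ * s) + - q′ * z₀ * w - z
        identity = solve-∀

    pointKernelIso : KernelIso m (Kernel m A) (PointKernel m q u w (ℤ.+ l))
    pointKernelIso = record
      { to          = to
      ; from        = from
      ; to-linear   = to-linear
      ; from-linear = from-linear
      ; to-∈        = λ {x} h → to-total x h , to-row x h
      -- With `z′ = from z`, the vector `A z′ = q z′ - X Y z′` is `(q q′ - 1) X z` minus `X` applied
      -- to `to z′ - z`, and the latter is zero modulo `m` by `to∘from`.
      ; from-∈      = λ {z} h k → subst (m ℤ∣.∣_)
          (trans (A-from q q′ (lines (z ∘ suc) k) (z zero) (sum (from z)) (lines (points (from z)) k))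
            (sym (A* (from z) k)))
          ((lines (z ∘ suc) k - z zero) *∣ q-unit +∣ to∘from z h zero +∣
            -1ℤ *∣ resp-≡mod lines-linear (points (from z)) (z ∘ suc) m (to∘from z h ∘ suc) k)
      ; from∘to     = λ {x} h k → subst (m ℤ∣.∣_)
          (trans (cong (λ y → - q′ * y + x k * (q * q′ - 1ℤ)) (A* x k))
            (from-A q q′ (x k) (sum x) (lines (points x) k)))
          (- q′ *∣ h k +∣ x k *∣ q-unit)
      ; to∘from     = λ {z} → to∘from z
      }
      where
      A-from : ∀ q q′ s z₀ t r → (s - z₀) * (q * q′ - 1ℤ) + (t - z₀) + -1ℤ * (r - s) ≡
               q * (q′ * s + - q′ * z₀ * 1ℤ) + t * 1ℤ + -1ℤ * r
      A-from = solve-∀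

      from-A : ∀ q q′ x s t → - q′ * (q * x + s * 1ℤ + -1ℤ * t) + x * (q * q′ - 1ℤ) ≡
               q′ * t + - q′ * s * 1ℤ - x
      from-A = solve-∀

      -- `Y A = (q I - Y X) Y`: the row of ones in `Y` gives this equation and the rows of `N` give
      -- `to-row`. The factor -1 matches the sign chosen in `PointKernel`.
      to-total : ∀ x → Kernel m A x → m ℤ∣.∣ w * sum (points x) - (q + ℤ.+ l) * sum x
      to-total x h = subst (m ℤ∣.∣_) (begin
        -1ℤ * sum (A *ᵛ x)
          ≡⟨ cong (-1ℤ *_) (trans (sum-cong (A* x))
               (sum-linear₃ q (sum x) -1ℤ x (λ _ → 1ℤ) (lines (points x)))) ⟩
        -1ℤ * (q * sum x + sum x * sum {l} (λ _ → 1ℤ) + -1ℤ * sum (lines (points x)))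
          ≡⟨ cong₂ (λ s t → -1ℤ * (q * sum x + sum x * s + -1ℤ * t)) sum-1 (sum-lines (points x)) ⟩
        -1ℤ * (q * sum x + sum x * ℤ.+ l + -1ℤ * (w * sum (points x)))
          ≡⟨ identity q w (ℤ.+ l) (sum x) (sum (points x)) ⟩
        w * sum (points x) - (q + ℤ.+ l) * sum x ∎) (-1ℤ *∣ ∣-sum h)
        where
        identity : ∀ q w l s t → -1ℤ * (q * s + s * l + -1ℤ * (w * t)) ≡ w * t - (q + l) * s
        identity = solve-∀

      to-row : ∀ x → Kernel m A x → ∀ j → m ℤ∣.∣ q * q * u * points x j + sum (points x) - w * sum x
      to-row x h j = subst (m ℤ∣.∣_) (begin
        -1ℤ * sum (λ k → N j k * (A *ᵛ x) k)
          ≡⟨ cong (-1ℤ *_) (trans (sum-cong λ k → cong (N j k *_) (A* x k))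
               (sum-*-linear₃ (N j) q (sum x) -1ℤ x (λ _ → 1ℤ) (lines (points x)))) ⟩
        -1ℤ * (q * points x j + sum x * sum (λ k → N j k * 1ℤ) + -1ℤ * points (lines (points x)) j)
          ≡⟨ cong₂ (λ s t → -1ℤ * (q * points x j + sum x * s + -1ℤ * t)) (points-1 j) (points-lines (points x) j) ⟩
        -1ℤ * (q * points x j + sum x * w + -1ℤ * (q * (1ℤ + q * u) * points x j + 1ℤ * sum (points x)))
          ≡⟨ identity q u w (points x j) (sum x) (sum (points x)) ⟩
        q * q * u * points x j + sum (points x) - w * sum x ∎)
        (-1ℤ *∣ ∣-sum (λ k → N j k *∣ h k))
        where
        identity : ∀ q u w p s t → -1ℤ * (q * p + s * w + -1ℤ * (q * (1ℤ + q * u) * p + 1ℤ * t)) ≡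
                   q * q * u * p + t - w * s
        identity = solve-∀

-- Diagonalising the point kernel

module _ where
  open import Data.Integer.Base using (_+_; _*_; _-_; -_)
  open ≡.≡-Reasoning

  -- The divisors other than the `g` ones. The entries need not form a divisibility chain: only the
  -- number divisible by each power of ℓ will matter.
  elementaryDivisors : ∀ {f} → ℕ → ℕ → Vector ℕ (suc f)
  elementaryDivisors u k zero    = k
  elementaryDivisors u k (suc _) = u

  -- Here v = 1 + q + q² + q³ u and l = v + q² u + q⁴ k are numbers of points
  -- and lines.  With s the value at the first point, the kernel vector is
  -- determined by z₀ - (1 + q) s, by s + w q⁻¹ (z₀ - (1 + q) s), and by the
  -- differences of the later values with s; the difference at the second
  -- point is redundant.
  module _ {v : ℕ} (q : ℤ) (u k : ℕ) (m q′ : ℤ) (q-unit : m ℤ∣.∣ q * q′ - 1ℤ) where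
    private
      U = ℤ.+ u
      K = ℤ.+ k
      w = 1ℤ + q + q * q * U
      l = 1ℤ + q + q * q + q * q * q * U + q * q * U + q * q * q * q * K

    module _ (v-formula : ℤ.+ (2 ℕ.+ v) ≡ 1ℤ + q + q * q + q * q * q * U)
             (k-formula : (1ℤ + q) * K ≡ U * (1ℤ + q * U)) where
      private
        k-zero : m ℤ∣.∣ (1ℤ + q) * K - U * (1ℤ + q * U)
        k-zero = ≡⇒∣- k-formula

        differences : Vector ℤ (3 ℕ.+ v) → Vector ℤ v
        differences z i = z (suc (suc (suc i))) - z (suc zero)

        base : Vector ℤ (2 ℕ.+ v) → ℤ
        base t = t (suc zero) - w * q′ * t zero

        total : Vector ℤ (2 ℕ.+ v) → ℤ
        total t = t zero + (1ℤ + q) * base t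

        -- The difference `r` forced by the row of the first point, `q² U s + S = w z₀`. The sum `S`
        -- over all points is `V s + r` plus the remaining differences, with `V = 1 + q + q² + q³ U`
        -- the number of points.
        redundant : Vector ℤ (2 ℕ.+ v) → ℤ
        redundant t = w * total t - q * q * U * base t - (1ℤ + q + q * q + q * q * q * U) * base t
                      - sum (λ i → t (suc (suc i)))

        to : Vector ℤ (3 ℕ.+ v) → Vector ℤ (2 ℕ.+ v)
        to z zero          = z zero - (1ℤ + q) * z (suc zero)
        to z (suc zero)    = z (suc zero) + w * q′ * (z zero - (1ℤ + q) * z (suc zero))
        to z (suc (suc i)) = differences z i

        from : Vector ℤ (2 ℕ.+ v) → Vector ℤ (3 ℕ.+ v)
        from t zero                = total t
        from t (suc zero)          = base t
        from t (suc (suc zero))    = base t + redundant t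
        from t (suc (suc (suc i))) = base t + t (suc (suc i))

        sum-shift : ∀ s (y : Vector ℤ v) → s + (s + sum (λ i → s + y i)) ≡
                    (1ℤ + q + q * q + q * q * q * U) * s + sum y
        sum-shift s y = begin
          s + (s + sum (λ i → s + y i))
            ≡⟨ cong (λ t → s + (s + t)) (trans (∑-distrib-+ (λ _ → s) y) (cong (_+ sum y) (sum-const v s))) ⟩
          s + (s + (ℤ.+ v * s + sum y))          ≡⟨ collect s (ℤ.+ v) (sum y) ⟩
          (1ℤ + (1ℤ + ℤ.+ v)) * s + sum y        ≡⟨ cong (λ n → n * s + sum y) v-formula ⟩
          (1ℤ + q + q * q + q * q * q * U) * s + sum y ∎
          where
          collect : ∀ s n y → s + (s + (n * s + y)) ≡ (1ℤ + (1ℤ + n)) * s + y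
          collect = solve-∀

        sum-points : ∀ (z : Vector ℤ (3 ℕ.+ v)) s r y → z (suc zero) ≡ s → z (suc (suc zero)) ≡ s + r →
                     (∀ i → z (suc (suc (suc i))) ≡ s + y i) →
                     m ℤ∣.∣ sum (z ∘ suc) - ((1ℤ + q + q * q + q * q * q * U) * s + r + sum y)
        sum-points z s r y z₁ z₂ zᵢ = ≡⇒∣- (begin
          z (suc zero) + (z (suc (suc zero)) + sum (λ i → z (suc (suc (suc i)))))
            ≡⟨ cong₂ (λ a b → a + b) z₁ (cong₂ _+_ z₂ (sum-cong zᵢ)) ⟩
          s + (s + r + sum (λ i → s + y i))             ≡⟨ move s r (sum λ i → s + y i) ⟩
          s + (s + sum (λ i → s + y i)) + r             ≡⟨ cong (_+ r) (sum-shift s y) ⟩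
          (1ℤ + q + q * q + q * q * q * U) * s + sum y + r
            ≡⟨ swap ((1ℤ + q + q * q + q * q * q * U) * s) (sum y) r ⟩
          (1ℤ + q + q * q + q * q * q * U) * s + r + sum y ∎)
          where
          move : ∀ s r t → s + (s + r + t) ≡ s + (s + t) + r
          move = solve-∀
          swap : ∀ a b c → a + b + c ≡ a + c + b
          swap = solve-∀

        module Forward (z : Vector ℤ (3 ℕ.+ v)) (z∈ : PointKernel m q U w l z) where
          s  = z (suc zero)
          r  = z (suc (suc zero)) - s
          z₀ = z zero
          S  = sum (z ∘ suc)
          Y  = sum (differences z)
          row = proj₂ z∈

          S-formula : m ℤ∣.∣ S - ((1ℤ + q + q * q + q * q * q * U) * s + r + Y)
          S-formula = sum-points z s r (differences z) refl (split (z (suc (suc zero))) s)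
            (λ i → split (z (suc (suc (suc i)))) s)
            where
            split : ∀ x s → x ≡ s + (x - s)
            split = solve-∀

          -- Two rows differ only in `q² U` times the difference of their entries. The factor `q′²`
          -- removes `q²`, with error `(q q′)² - 1 = (q q′ + 1) (q q′ - 1)`.
          u-difference : ∀ i → m ℤ∣.∣ U * (z (suc i) - s)
          u-difference i = subst (m ℤ∣.∣_) (identity q q′ U w (z (suc i)) s S z₀)
            (q′ * q′ *∣ (row i +∣ -1ℤ *∣ row zero) +∣ (- (q * q′ + 1ℤ) * (U * (z (suc i) - s))) *∣ q-unit)
            where
            identity : ∀ q q′ u w z s S z₀ →
              q′ * q′ * ((q * q * u * z + S - w * z₀) + -1ℤ * (q * q * u * s + S - w * z₀)) +
              (- (q * q′ + 1ℤ) * (u * (z - s))) * (q * q′ - 1ℤ) ≡ u * (z - s)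
            identity = solve-∀

          -- Multiply the first row by `U`: the differences drop out by `u-difference`, and `s` is
          -- left with the coefficient `q² U + V = (1 + q) w - q`, where `V` is the number of
          -- points.
          u-combination : m ℤ∣.∣ U * (q * s + w * (z₀ - (1ℤ + q) * s))
          u-combination = subst (m ℤ∣.∣_) (identity q U s r z₀ S Y)
            (u-difference (suc zero) +∣ u-Y +∣ - U *∣ row zero +∣ U *∣ S-formula)
            where
            u-Y : m ℤ∣.∣ U * Y
            u-Y = subst (m ℤ∣.∣_) (sym (*-distribˡ-sum U (differences z))) (∣-sum λ i → u-difference (suc (suc i)))
            identity : ∀ q u s r z₀ S Y →
              u * r + u * Y + - u * (q * q * u * s + S - (1ℤ + q + q * q * u) * z₀) +
              u * (S - ((1ℤ + q + q * q + q * q * q * u) * s + r + Y)) ≡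
              u * (q * s + (1ℤ + q + q * q * u) * (z₀ - (1ℤ + q) * s))
            identity = solve-∀

          -- Eliminates `S` between the first row and the total equation. By
          -- `q + l = q⁴ K + (1 + q) w` and `w = 1 + q + q² U` the result is
          -- `q⁴ K z₀ - q² U w (z₀ - s)`. This explains the coordinate `z₀ - (1 + q) s`: the part
          -- `(1 + q) K s` of `K z₀` becomes a multiple of `U` by `k-zero`, and `u-combination`
          -- absorbs the rest.
          q⁴k : m ℤ∣.∣ q * q * q * q * (K * (z₀ - (1ℤ + q) * s))
          q⁴k = subst (m ℤ∣.∣_) (identity q U K s z₀ S)
            (w *∣ row zero +∣ -1ℤ *∣ proj₁ z∈ +∣ q * q *∣ u-combination +∣ (- (q * q * q * q * s)) *∣ k-zero)
            where
            identity : ∀ q u k s z₀ S →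
              (1ℤ + q + q * q * u) * (q * q * u * s + S - (1ℤ + q + q * q * u) * z₀) + -1ℤ * ((1ℤ + q + q * q * u) * S - (q + ((1ℤ + q + q * q + q * q * q * u) + q * q * u + q * q * q * q * k)) * z₀) +
              q * q * (u * (q * s + (1ℤ + q + q * q * u) * (z₀ - (1ℤ + q) * s))) + - (q * q * q * q * s) * ((1ℤ + q) * k - u * (1ℤ + q * u)) ≡
              q * q * q * q * (k * (z₀ - (1ℤ + q) * s))
            identity = solve-∀

        to-∈ : ∀ {z} → PointKernel m q U w l z → DiagonalKernel m (elementaryDivisors {1 ℕ.+ v} u k) (to z)
        to-∈ {z} z∈ zero = subst (m ℤ∣.∣_) (identity q q′ (K * (z₀ - (1ℤ + q) * s)))
          -- With `x = q q′`, the error `x⁴ - 1` is `(x - 1) (x + 1) (x² + 1)`.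
          (q′ * q′ * q′ * q′ *∣ q⁴k +∣
           (- (K * (z₀ - (1ℤ + q) * s) * (q * q′ + 1ℤ) * (q * q′ * (q * q′) + 1ℤ))) *∣ q-unit)
          where
          open Forward z z∈
          identity : ∀ q q′ a → q′ * q′ * q′ * q′ * (q * q * q * q * a) +
                     - (a * (q * q′ + 1ℤ) * (q * q′ * (q * q′) + 1ℤ)) * (q * q′ - 1ℤ) ≡ a
          identity = solve-∀
        to-∈ {z} z∈ (suc zero) = subst (m ℤ∣.∣_) (identity q q′ U w s (z₀ - (1ℤ + q) * s))
          (q′ *∣ u-combination +∣ (- (U * s)) *∣ q-unit)
          where
          open Forward z z∈
          identity : ∀ q q′ u w s t → q′ * (u * (q * s + w * t)) + - (u * s) * (q * q′ - 1ℤ) ≡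
                     u * (s + w * q′ * t)
          identity = solve-∀
        to-∈ {z} z∈ (suc (suc i)) = Forward.u-difference z z∈ (suc (suc i))

        module Backward (t : Vector ℤ (2 ℕ.+ v)) (t∈ : DiagonalKernel m (elementaryDivisors {1 ℕ.+ v} u k) t) where
          t₀ = t zero
          s  = base t
          z₀ = total t
          r  = redundant t
          Y  = sum (λ i → t (suc (suc i)))
          S  = sum (from t ∘ suc)

          row₁ : m ℤ∣.∣ q * q * U * s + S - w * z₀
          row₁ = subst (m ℤ∣.∣_) (identity (q * q * U * s) (w * z₀) ((1ℤ + q + q * q + q * q * q * U) * s) Y S)
            (sum-points (from t) s r (λ i → t (suc (suc i))) refl refl (λ _ → refl))
            where
            identity : ∀ a b c y S → S - (c + (b - a - c - y) + y) ≡ a + S - b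
            identity = solve-∀

          u-combination : m ℤ∣.∣ U * (q * s + w * t₀)
          u-combination = subst (m ℤ∣.∣_) (identity q q′ U w t₀ (t (suc zero)))
            (q *∣ t∈ (suc zero) +∣ (- (U * w * t₀)) *∣ q-unit)
            where
            identity : ∀ q q′ u w t₀ t₁ → q * (u * t₁) + - (u * w * t₀) * (q * q′ - 1ℤ) ≡
                       u * (q * (t₁ - w * q′ * t₀) + w * t₀)
            identity = solve-∀

          -- Expanding `z₀` as `t₀ + (1 + q) s` in `redundant` gives `r = q s + w t₀ - Y`.
          u-redundant : m ℤ∣.∣ U * r
          u-redundant = subst (m ℤ∣.∣_) (identity q U t₀ s Y) (u-combination +∣ -1ℤ *∣ u-Y)
            where
            u-Y : m ℤ∣.∣ U * Y
            u-Y = subst (m ℤ∣.∣_) (sym (*-distribˡ-sum U (λ i → t (suc (suc i))))) (∣-sum λ i → t∈ (suc (suc i)))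
            identity : ∀ q u t₀ s Y → u * (q * s + (1ℤ + q + q * q * u) * t₀) + -1ℤ * (u * Y) ≡
                       u * ((1ℤ + q + q * q * u) * (t₀ + (1ℤ + q) * s) - q * q * u * s - (1ℤ + q + q * q + q * q * q * u) * s - Y)
            identity = solve-∀

          shifted-row : ∀ y → m ℤ∣.∣ U * y → m ℤ∣.∣ q * q * U * (s + y) + S - w * z₀
          shifted-row y h = subst (m ℤ∣.∣_) (identity q U s y S (w * z₀)) (row₁ +∣ q * q *∣ h)
            where
            identity : ∀ q u s y S b → q * q * u * s + S - b + q * q * (u * y) ≡ q * q * u * (s + y) + S - b
            identity = solve-∀

          -- The elimination behind `q⁴k`, solved for the total equation instead.
          total-row : m ℤ∣.∣ w * S - (q + l) * z₀
          total-row = subst (m ℤ∣.∣_) (identity q U K t₀ s S)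
            (w *∣ row₁ +∣ (- (q * q * q * q)) *∣ t∈ zero +∣ q * q *∣ u-combination +∣
             (- (q * q * q * q * s)) *∣ k-zero)
            where
            identity : ∀ q u k t₀ s S →
              (1ℤ + q + q * q * u) * (q * q * u * s + S - (1ℤ + q + q * q * u) * (t₀ + (1ℤ + q) * s)) + - (q * q * q * q) * (k * t₀) +
              q * q * (u * (q * s + (1ℤ + q + q * q * u) * t₀)) + - (q * q * q * q * s) * ((1ℤ + q) * k - u * (1ℤ + q * u)) ≡
              (1ℤ + q + q * q * u) * S - (q + ((1ℤ + q + q * q + q * q * q * u) + q * q * u + q * q * q * q * k)) * (t₀ + (1ℤ + q) * s)
            identity = solve-∀

        from-∈ : ∀ {t} → DiagonalKernel m (elementaryDivisors {1 ℕ.+ v} u k) t → PointKernel m q U w l (from t)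
        from-∈ {t} t∈ = total-row , rows
          where
          open Backward t t∈
          rows : ∀ i → m ℤ∣.∣ q * q * U * from t (suc i) + S - w * z₀
          rows zero          = row₁
          rows (suc zero)    = shifted-row r u-redundant
          rows (suc (suc i)) = shifted-row (t (suc (suc i))) (t∈ (suc (suc i)))

        base-to : ∀ z → base (to z) ≡ z (suc zero)
        base-to z = identity w q′ (z (suc zero)) (z zero - (1ℤ + q) * z (suc zero))
          where
          identity : ∀ w q′ s t → s + w * q′ * t - w * q′ * t ≡ s
          identity = solve-∀

        total-to : ∀ z → total (to z) ≡ z zero
        total-to z = trans (cong (λ s → to z zero + (1ℤ + q) * s) (base-to z)) (identity q (z zero) (z (suc zero)))
          where
          identity : ∀ q z s → z - (1ℤ + q) * s + (1ℤ + q) * s ≡ z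
          identity = solve-∀

        from∘to : ∀ {z} → PointKernel m q U w l z → ∀ i → m ℤ∣.∣ from (to z) i - z i
        from∘to {z} z∈ zero             = ≡⇒∣- (total-to z)
        from∘to {z} z∈ (suc zero)       = ≡⇒∣- (base-to z)
        -- Only this coordinate uses the kernel condition: it was dropped by `to` and is recovered
        -- from the first row. The others agree exactly.
        from∘to {z} z∈ (suc (suc zero)) = subst (m ℤ∣.∣_) (begin
          -1ℤ * (q * q * U * s + S - w * z₀) + (S - (V * s + r + Y))
            ≡⟨ identity (q * q * U * s) (w * z₀) (V * s) s (z (suc (suc zero))) Y S ⟩
          (s + (w * z₀ - q * q * U * s - V * s - Y)) - z (suc (suc zero))
            ≡⟨ cong₂ (λ s′ z′ → (s′ + (w * z′ - q * q * U * s′ - V * s′ - Y)) - z (suc (suc zero)))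
                 (base-to z) (total-to z) ⟨
          from (to z) (suc (suc zero)) - z (suc (suc zero)) ∎)
          (-1ℤ *∣ row zero +∣ S-formula)
          where
          open Forward z z∈
          V = 1ℤ + q + q * q + q * q * q * U
          identity : ∀ a b c s z y S → -1ℤ * (a + S - b) + (S - (c + (z - s) + y)) ≡ (s + (b - a - c - y)) - z
          identity = solve-∀
        from∘to {z} z∈ (suc (suc (suc i))) = ≡⇒∣- (trans
          (cong (_+ (z (suc (suc (suc i))) - z (suc zero))) (base-to z)) (merge (z (suc zero)) (z (suc (suc (suc i))))))
          where
          merge : ∀ s x → s + (x - s) ≡ x
          merge = solve-∀

        to∘from : ∀ t i → to (from t) i ≡ t i
        to∘from t zero = identity q (t zero) (base t)
          where
          identity : ∀ q t s → t + (1ℤ + q) * s - (1ℤ + q) * s ≡ t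
          identity = solve-∀
        to∘from t (suc zero) = trans (cong (λ t₀ → base t + w * q′ * t₀) (to∘from t zero))
          (identity w q′ (t zero) (t (suc zero)))
          where
          identity : ∀ w q′ t₀ t₁ → t₁ - w * q′ * t₀ + w * q′ * t₀ ≡ t₁
          identity = solve-∀
        to∘from t (suc (suc i)) = identity (base t) (t (suc (suc i)))
          where
          identity : ∀ s y → s + y - s ≡ y
          identity = solve-∀

        to-linear : Linear to
        to-linear = record { ext = to-ext ; linear = to-lin }
          where
          to-ext : ∀ {x y} → (∀ k → x k ≡ y k) → ∀ i → to x i ≡ to y i
          to-ext h zero          = cong₂ (λ a b → a - (1ℤ + q) * b) (h zero) (h (suc zero))
          to-ext h (suc zero)    = cong₂ (λ a b → b + w * q′ * (a - (1ℤ + q) * b)) (h zero) (h (suc zero))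
          to-ext h (suc (suc i)) = cong₂ _-_ (h (suc (suc (suc i)))) (h (suc zero))
          to-lin : ∀ a b x y i → to (λ k → a * x k + b * y k) i ≡ a * to x i + b * to y i
          to-lin a b x y zero = collect q a b (x zero) (y zero) (x (suc zero)) (y (suc zero))
            where
            collect : ∀ q a b x y x₁ y₁ → a * x + b * y - (1ℤ + q) * (a * x₁ + b * y₁) ≡
                      a * (x - (1ℤ + q) * x₁) + b * (y - (1ℤ + q) * y₁)
            collect = solve-∀
          to-lin a b x y (suc zero) = collect q (w * q′) a b (x zero) (y zero) (x (suc zero)) (y (suc zero))
            where
            collect : ∀ q c a b x y x₁ y₁ →
                      a * x₁ + b * y₁ + c * (a * x + b * y - (1ℤ + q) * (a * x₁ + b * y₁)) ≡
                      a * (x₁ + c * (x - (1ℤ + q) * x₁)) + b * (y₁ + c * (y - (1ℤ + q) * y₁))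
            collect = solve-∀
          to-lin a b x y (suc (suc i)) =
            collect a b (x (suc (suc (suc i)))) (y (suc (suc (suc i)))) (x (suc zero)) (y (suc zero))
            where
            collect : ∀ a b x y x₁ y₁ → a * x + b * y - (a * x₁ + b * y₁) ≡ a * (x - x₁) + b * (y - y₁)
            collect = solve-∀

        from-linear : Linear from
        from-linear = record { ext = from-ext ; linear = from-lin }
          where
          base-ext : ∀ {x y} → (∀ k → x k ≡ y k) → base x ≡ base y
          base-ext h = cong₂ (λ a b → b - w * q′ * a) (h zero) (h (suc zero))
          total-ext : ∀ {x y} → (∀ k → x k ≡ y k) → total x ≡ total y
          total-ext {x} {y} h = cong₂ (λ a b → a + (1ℤ + q) * b) (h zero) (base-ext {x} {y} h)
          from-ext : ∀ {x y} → (∀ k → x k ≡ y k) → ∀ i → from x i ≡ from y i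
          from-ext {x} {y} h zero       = total-ext {x} {y} h
          from-ext {x} {y} h (suc zero) = base-ext {x} {y} h
          from-ext {x} {y} h (suc (suc zero)) = cong₂ _+_ (base-ext {x} {y} h)
            (cong₂ _-_ (cong₂ (λ a b → w * a - q * q * U * b - (1ℤ + q + q * q + q * q * q * U) * b)
              (total-ext {x} {y} h) (base-ext {x} {y} h)) (sum-cong λ i → h (suc (suc i))))
          from-ext {x} {y} h (suc (suc (suc i))) = cong₂ _+_ (base-ext {x} {y} h) (h (suc (suc i)))

          combine : ℤ → ℤ → Vector ℤ (2 ℕ.+ v) → Vector ℤ (2 ℕ.+ v) → Vector ℤ (2 ℕ.+ v)
          combine a b x y k = a * x k + b * y k

          base-lin : ∀ a b x y → base (combine a b x y) ≡ a * base x + b * base y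
          base-lin a b x y = collect (w * q′) a b (x zero) (y zero) (x (suc zero)) (y (suc zero))
            where
            collect : ∀ c a b x y x₁ y₁ → a * x₁ + b * y₁ - c * (a * x + b * y) ≡ a * (x₁ - c * x) + b * (y₁ - c * y)
            collect = solve-∀
          total-lin : ∀ a b x y → total (combine a b x y) ≡ a * total x + b * total y
          total-lin a b x y = trans (cong (λ s → a * x zero + b * y zero + (1ℤ + q) * s) (base-lin a b x y))
            (collect (1ℤ + q) a b (x zero) (y zero) (base x) (base y))
            where
            collect : ∀ c a b x y s t → a * x + b * y + c * (a * s + b * t) ≡ a * (x + c * s) + b * (y + c * t)
            collect = solve-∀
          redundant-lin : ∀ a b x y → redundant (combine a b x y) ≡ a * redundant x + b * redundant y
          redundant-lin a b x y = trans
            (cong₂ _-_ (cong₂ (λ z s → w * z - q * q * U * s - V * s) (total-lin a b x y) (base-lin a b x y))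
              (sum-linear a b (λ i → x (suc (suc i))) (λ i → y (suc (suc i)))))
            (collect w (q * q * U) V a b (total x) (total y) (base x) (base y)
              (sum λ i → x (suc (suc i))) (sum λ i → y (suc (suc i))))
            where
            V = 1ℤ + q + q * q + q * q * q * U
            collect : ∀ w c V a b x y s t X Y →
              w * (a * x + b * y) - c * (a * s + b * t) - V * (a * s + b * t) - (a * X + b * Y) ≡
              a * (w * x - c * s - V * s - X) + b * (w * y - c * t - V * t - Y)
            collect = solve-∀
          add-lin : ∀ a b s t x y → (a * s + b * t) + (a * x + b * y) ≡ a * (s + x) + b * (t + y)
          add-lin = solve-∀

          from-lin : ∀ a b x y i → from (combine a b x y) i ≡ a * from x i + b * from y i
          from-lin a b x y zero             = total-lin a b x y
          from-lin a b x y (suc zero)       = base-lin a b x y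
          from-lin a b x y (suc (suc zero)) = trans (cong₂ _+_ (base-lin a b x y) (redundant-lin a b x y))
            (add-lin a b (base x) (base y) (redundant x) (redundant y))
          from-lin a b x y (suc (suc (suc i))) = trans (cong (_+ (a * x (suc (suc i)) + b * y (suc (suc i)))) (base-lin a b x y))
            (add-lin a b (base x) (base y) (x (suc (suc i))) (y (suc (suc i))))

      elementaryDivisorsIso : KernelIso m (PointKernel m q U w l) (DiagonalKernel m (elementaryDivisors {1 ℕ.+ v} u k))
      elementaryDivisorsIso = record
        { to          = to
        ; from        = from
        ; to-linear   = to-linear
        ; from-linear = from-linear
        ; to-∈        = to-∈
        ; from-∈      = from-∈
        ; from∘to     = from∘to
        ; to∘from     = λ {t} _ i → ≡⇒∣- (to∘from t i)
        }

-- Multiplicities read off from kernels modulo prime powers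

multiplicity-+ : ∀ {N} (d : Vector ℕ N) ℓ i →
                 multiplicity d ℓ i ℕ.+ count (λ k → ℓ ℕ.^ suc i ℕ.∣? d k) ≡ count (λ k → ℓ ℕ.^ i ℕ.∣? d k)
multiplicity-+ {N} d ℓ i = length-filter-∖ (λ k → ℓ ℕ.^ i ℕ.∣? d k) (λ k → ℓ ℕ.^ suc i ℕ.∣? d k)
  (ℕ.∣-trans (ℕ.n∣m*n ℓ)) (allFin N)

module _ {ℓ} (ℓ-prime : Prime ℓ) where

  inverse-mod-ℓ^ : ∀ {q} → ℓ ∤ q → ∀ j → ∃ λ q′ → ℤ.+ (ℓ ℕ.^ j) ℤ∣.∣ ℤ.+ q ℤ.* q′ ℤ.- 1ℤ
  inverse-mod-ℓ^ {q} ℓ∤q zero = 0ℤ , ℤ∣.∣ᵤ⇒∣ (ℕ.1∣ _)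
  inverse-mod-ℓ^ {q} ℓ∤q (suc j) = lift (inverse-mod-ℓ^ ℓ∤q j) inverse-mod-ℓ
    where
    coprime : Coprime ℓ q
    coprime {d} (d∣ℓ , d∣q) with prime⇒irreducible ℓ-prime d∣ℓ
    ... | inj₁ d≡1  = d≡1
    ... | inj₂ refl = contradiction d∣q ℓ∤q

    cast : ∀ a b c d → 1 ℕ.+ a ℕ.* b ≡ c ℕ.* d → 1ℤ ℤ.+ ℤ.+ a ℤ.* ℤ.+ b ≡ ℤ.+ c ℤ.* ℤ.+ d
    cast a b c d e = trans (cong (ℤ._+_ 1ℤ) (sym (ℤ.pos-* a b))) (trans (cong ℤ.+_ e) (ℤ.pos-* c d))

    inverse-mod-ℓ : ∃ λ q′ → ℤ.+ ℓ ℤ∣.∣ ℤ.+ q ℤ.* q′ ℤ.- 1ℤ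
    inverse-mod-ℓ with coprime-Bézout coprime
    ... | Bézout.+- x y e = ℤ.- ℤ.+ y , ℤ∣.divides (ℤ.- ℤ.+ x)
      (trans (rearrange (ℤ.+ q) (ℤ.+ y)) (trans (cong ℤ.-_ (cast y q x ℓ e)) (ℤ.neg-distribˡ-* (ℤ.+ x) (ℤ.+ ℓ))))
      where
      rearrange : ∀ q y → q ℤ.* (ℤ.- y) ℤ.- 1ℤ ≡ ℤ.- (1ℤ ℤ.+ y ℤ.* q)
      rearrange = solve-∀
    ... | Bézout.-+ x y e = ℤ.+ y , ℤ∣.divides (ℤ.+ x)
      (trans (cong (ℤ._- 1ℤ) (trans (ℤ.*-comm (ℤ.+ q) (ℤ.+ y)) (sym (cast x ℓ y q e)))) (cancel (ℤ.+ x ℤ.* ℤ.+ ℓ)))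
      where
      cancel : ∀ a → 1ℤ ℤ.+ a ℤ.- 1ℤ ≡ a
      cancel = solve-∀

    lift : (∃ λ q′ → ℤ.+ (ℓ ℕ.^ j) ℤ∣.∣ ℤ.+ q ℤ.* q′ ℤ.- 1ℤ) → (∃ λ q′ → ℤ.+ ℓ ℤ∣.∣ ℤ.+ q ℤ.* q′ ℤ.- 1ℤ) →
           ∃ λ q′ → ℤ.+ (ℓ ℕ.^ suc j) ℤ∣.∣ ℤ.+ q ℤ.* q′ ℤ.- 1ℤ
    -- The new inverse `q′` is chosen so that `1 - q q′ = (1 - q a) (1 - q b)`; the errors,
    -- divisible by `ℓ ^ j` and by ℓ, multiply.
    lift (a , ℤ∣.divides s e) (b , ℤ∣.divides t e′) = a ℤ.+ b ℤ.- ℤ.+ q ℤ.* a ℤ.* b , ℤ∣.divides (ℤ.- (s ℤ.* t)) (begin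
      ℤ.+ q ℤ.* (a ℤ.+ b ℤ.- ℤ.+ q ℤ.* a ℤ.* b) ℤ.- 1ℤ                ≡⟨ factor (ℤ.+ q) a b ⟩
      ℤ.- ((ℤ.+ q ℤ.* a ℤ.- 1ℤ) ℤ.* (ℤ.+ q ℤ.* b ℤ.- 1ℤ))             ≡⟨ cong₂ (λ x y → ℤ.- (x ℤ.* y)) e e′ ⟩
      ℤ.- (s ℤ.* ℤ.+ (ℓ ℕ.^ j) ℤ.* (t ℤ.* ℤ.+ ℓ))                     ≡⟨ collect s t (ℤ.+ (ℓ ℕ.^ j)) (ℤ.+ ℓ) ⟩
      ℤ.- (s ℤ.* t) ℤ.* (ℤ.+ ℓ ℤ.* ℤ.+ (ℓ ℕ.^ j))                     ≡⟨ cong (ℤ._*_ (ℤ.- (s ℤ.* t))) (ℤ.pos-* ℓ (ℓ ℕ.^ j)) ⟨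
      ℤ.- (s ℤ.* t) ℤ.* ℤ.+ (ℓ ℕ.^ suc j)                             ∎)
      where
      open ≡.≡-Reasoning
      factor : ∀ q a b → q ℤ.* (a ℤ.+ b ℤ.- q ℤ.* a ℤ.* b) ℤ.- 1ℤ ≡ ℤ.- ((q ℤ.* a ℤ.- 1ℤ) ℤ.* (q ℤ.* b ℤ.- 1ℤ))
      factor = solve-∀
      collect : ∀ s t x y → ℤ.- (s ℤ.* x ℤ.* (t ℤ.* y)) ≡ ℤ.- (s ℤ.* t) ℤ.* (y ℤ.* x)
      collect = solve-∀

  module _ {L M} {A : Matrix L} {d : Vector ℕ L} {d′ : Vector ℕ M} (snf : IsSmithNormalForm A d)
           (iso : ∀ j → KernelIso (ℤ.+ (ℓ ℕ.^ suc j)) (Kernel (ℤ.+ (ℓ ℕ.^ suc j)) A)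
                                   (DiagonalKernel (ℤ.+ (ℓ ℕ.^ suc j)) d′)) where
    private
      count≡ : ∀ j → count (λ k → ℓ ℕ.^ suc j ℕ.∣? d k) ≡ count (λ k → ℓ ℕ.^ suc j ℕ.∣? d′ k)
      count≡ j = count-≡ ℓ-prime j (KernelIso-trans (smithKernelIso (ℤ.+ (ℓ ℕ.^ suc j)) snf) (iso j))

    -- A difference of two consecutive divisibility counts, both at positive exponents and hence
    -- determined by the kernels.
    multiplicity-suc : ∀ i → multiplicity d ℓ (suc i) ≡ multiplicity d′ ℓ (suc i)
    multiplicity-suc i = ℕ.+-cancelʳ-≡ _ _ _ (trans (multiplicity-+ d ℓ (suc i)) (trans (count≡ i)
      (trans (sym (multiplicity-+ d′ ℓ (suc i)))
        (cong (ℕ._+_ (multiplicity d′ ℓ (suc i))) (sym (count≡ (suc i)))))))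

    -- Every entry is divisible by `ℓ ^ 0`, so the counts at exponent 0 are the sizes `L` and `M`,
    -- and their difference goes entirely to the divisors prime to ℓ.
    multiplicity-zero : ∀ {g} → L ≡ g ℕ.+ M → multiplicity d ℓ 0 ≡ g ℕ.+ multiplicity d′ ℓ 0
    multiplicity-zero {g} refl = ℕ.+-cancelʳ-≡ _ _ _ (begin
      multiplicity d ℓ 0 ℕ.+ count (λ k → ℓ ℕ.^ 1 ℕ.∣? d k)
        ≡⟨ trans (multiplicity-+ d ℓ 0) (count-all (λ k → 1 ℕ.∣? d k) (λ k → ℕ.1∣ d k)) ⟩
      g ℕ.+ M
        ≡⟨ cong (ℕ._+_ g) (trans (multiplicity-+ d′ ℓ 0) (count-all (λ k → 1 ℕ.∣? d′ k) (λ k → ℕ.1∣ d′ k))) ⟨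
      g ℕ.+ (multiplicity d′ ℓ 0 ℕ.+ count (λ k → ℓ ℕ.^ 1 ℕ.∣? d′ k))
        ≡⟨ ℕ.+-assoc g _ _ ⟨
      g ℕ.+ multiplicity d′ ℓ 0 ℕ.+ count (λ k → ℓ ℕ.^ 1 ℕ.∣? d′ k)
        ≡⟨ cong (ℕ._+_ (g ℕ.+ multiplicity d′ ℓ 0)) (count≡ 0) ⟨
      g ℕ.+ multiplicity d′ ℓ 0 ℕ.+ count (λ k → ℓ ℕ.^ 1 ℕ.∣? d k) ∎)
      where open ≡.≡-Reasoning

    divisor-free : (∀ k → ℓ ∤ d′ k) → ∀ k → ℓ ∤ d k
    divisor-free h k ℓ∣dₖ = nonempty (trans (count≡ 0) (count-none (λ k → ℓ ℕ.^ 1 ℕ.∣? d′ k) (λ k ℓ∣ → h k (subst (_∣ d′ k) (ℕ.^-identityʳ ℓ) ℓ∣))))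
      where
      nonempty : count (λ k → ℓ ℕ.^ 1 ℕ.∣? d k) ≢ 0
      nonempty e with () ← subst Fin e (proj₁ (select-surjective (λ k → ℓ ℕ.^ 1 ℕ.∣? d k) {k} (subst (_∣ d k) (sym (ℕ.^-identityʳ ℓ)) ℓ∣dₖ)))

-- Counting with indicator functions

module _ where
  open import Data.Integer.Base using (_+_; _*_; _-_; -_)
  open ≡.≡-Reasoning

  χ-× : ∀ {a b} {P : Set a} {Q : Set b} (P? : Dec P) (Q? : Dec Q) → χ P? * χ Q? ≡ χ (P? ×-dec Q?)
  χ-× (yes _) (yes _) = refl
  χ-× (yes _) (no _)  = refl
  χ-× (no _)  _       = refl

  χ-idem : ∀ {p} {P : Set p} (P? : Dec P) → χ P? * χ P? ≡ χ P?
  χ-idem (yes _) = refl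
  χ-idem (no _)  = refl

  -- The indicator at `i` equals the number of `j` with `f j ≡ i`; exchanging the sums then counts
  -- one for each `j`.
  sum-χ : ∀ {p M N} {P : Pred (Fin N) p} (P? : Decidable P) (f : Fin M → Fin N) →
          (∀ i j → f i ≡ f j → i ≡ j) → (∀ j → P (f j)) → (∀ {i} → P i → ∃ λ j → f j ≡ i) →
          sum (λ i → χ (P? i)) ≡ ℤ.+ M
  sum-χ {M = M} {N} P? f injective satisfies surjective = begin
    sum (λ i → χ (P? i))                ≡⟨ sum-cong χ-fibre ⟩
    sum (λ i → sum (λ j → δ (f j) i))   ≡⟨ ∑-comm (λ i j → δ (f j) i) ⟩
    sum (λ j → sum (λ i → δ (f j) i))
      ≡⟨ sum-cong (λ j → trans (sum-cong λ i → sym (ℤ.*-identityʳ (δ (f j) i))) (sum-δˡ (f j) (λ _ → 1ℤ))) ⟩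
    sum {M} (λ _ → 1ℤ)                  ≡⟨ trans (sum-const M 1ℤ) (ℤ.*-identityʳ (ℤ.+ M)) ⟩
    ℤ.+ M                               ∎
    where
    χ-fibre : ∀ i → χ (P? i) ≡ sum (λ j → δ (f j) i)
    χ-fibre i with P? i
    ... | no ¬Pi = sym (sum-zero λ j → δ-≢ {i = f j} {i} λ { refl → ¬Pi (satisfies j) })
    ... | yes Pi with surjective Pi
    ...   | j₀ , refl = sym (trans (sum-cong λ j → trans (δ-f j) (sym (ℤ.*-identityʳ (δ j₀ j)))) (sum-δˡ j₀ (λ _ → 1ℤ)))
      where
      δ-f : ∀ j → δ (f j) (f j₀) ≡ δ j₀ j
      δ-f j with j₀ Fin.≟ j
      ... | yes refl = δ-refl (f j₀)
      ... | no j₀≢j  = δ-≢ {i = f j} {f j₀} (j₀≢j ∘ sym ∘ injective j j₀)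

  sum-χ-unique : ∀ {p N} {P : Pred (Fin N) p} (P? : Decidable P) {i₀} → P i₀ → (∀ {i} → P i → i₀ ≡ i) →
                 sum (λ i → χ (P? i)) ≡ 1ℤ
  sum-χ-unique P? {i₀} Pi₀ unique = sum-χ {M = 1} P? (λ _ → i₀) (λ { zero zero _ → refl })
    (λ _ → Pi₀) (λ Pi → zero , unique Pi)

-- Points and lines over a finite field

module _ {c r q} (K : FiniteField c r q) where
  open LinearAlgebra K
  private
    module K = FiniteField K
    open import Relation.Binary.Reasoning.Setoid K.setoid

    scalars : Surjection (≡.setoid (Fin q)) K.setoid
    scalars = Bijection.surjection K.elements

    vector : ∀ n → Fin (q ℕ.^ n) → V n
    vector n = Surjection.to (vectors scalars n)

    vector-injective : ∀ n a b → vector n a ≋ vector n b → a ≡ b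
    vector-injective n a b e = trans (sym (Fin.funToFin-finToFin {n} {q} a)) (trans
      (funToFin-cong (Fin.finToFun {q} {n} a) (Fin.finToFun {q} {n} b) λ i → Bijection.injective K.elements (e i))
      (Fin.funToFin-finToFin {n} {q} b))

    vector-surjective : ∀ n (x : V n) → ∃ λ a → vector n a ≋ x
    vector-surjective n x = Surjection.strictlySurjective (vectors scalars n) x

    cons : ∀ {n} → K.Carrier → V n → V (suc n)
    cons x v zero    = x
    cons x v (suc i) = v i

  pointCount : ℕ → ℕ
  pointCount zero    = 0
  pointCount (suc n) = q ℕ.^ n ℕ.+ pointCount n

  private
    pointCases : ∀ n → Fin (q ℕ.^ n) ⊎ Fin (pointCount n) → V (suc n)

  -- Points of the projective space are represented by the vectors whose first
  -- nonzero coordinate is 1.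
  point : ∀ n → Fin (pointCount n) → V n
  point (suc n) i = pointCases n (Fin.splitAt (q ℕ.^ n) i)

  pointCases n (inj₁ a) = cons K.1# (vector n a)
  pointCases n (inj₂ j) = cons K.0# (point n j)

  point-nonZero : ∀ n i → ¬ point n i ≋ 0ᵛ
  point-nonZero (suc n) i e with Fin.splitAt (q ℕ.^ n) i
  ... | inj₁ a = K.1≉0 (e zero)
  ... | inj₂ j = point-nonZero n j (e ∘ suc)

  -- At the first coordinate where either vector has its leading 1, the equation forces `x = 1`, or
  -- `1 = 0`, or `x = 0`, and the last would make a point zero.
  point-separates : ∀ n i j x → point n i ≋ x ·ᵛ point n j → i ≡ j
  point-separates (suc n) i j x e = trans (sym (Fin.join-splitAt (q ℕ.^ n) (pointCount n) i)) (trans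
    (cong (Fin.join (q ℕ.^ n) (pointCount n)) (cases (Fin.splitAt (q ℕ.^ n) i) (Fin.splitAt (q ℕ.^ n) j) e))
    (Fin.join-splitAt (q ℕ.^ n) (pointCount n) j))
    where
    cases : ∀ s t → pointCases n s ≋ x ·ᵛ pointCases n t → s ≡ t
    cases (inj₁ a) (inj₁ b) e = cong inj₁ (vector-injective n a b λ i →
      K.trans (e (suc i)) (K.trans (K.*-congʳ (K.trans (K.sym (K.*-identityʳ x)) (K.sym (e zero)))) (K.*-identityˡ _)))
    cases (inj₁ a) (inj₂ j) e = contradiction (K.trans (e zero) (K.zeroʳ x)) K.1≉0
    cases (inj₂ i) (inj₁ b) e = contradiction
      (λ k → K.trans (e (suc k)) (K.trans (K.*-congʳ (K.trans (K.sym (K.*-identityʳ x)) (K.sym (e zero)))) (K.zeroˡ _)))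
      (point-nonZero n i)
    cases (inj₂ i) (inj₂ j) e = cong inj₂ (point-separates n i j x (e ∘ suc))

  point-covers : ∀ n v → ¬ v ≋ 0ᵛ → ∃₂ λ i x → v ≋ x ·ᵛ point n i
  point-covers zero    v v≢0 = contradiction (λ ()) v≢0
  point-covers (suc n) v v≢0 with v zero ≟ᴷ K.0#
  ... | yes v₀≈0 with point-covers n (v ∘ suc) (λ e → v≢0 λ { zero → v₀≈0 ; (suc i) → e i })
  ...   | i , x , e = q ℕ.^ n Fin.↑ʳ i , x , subst (λ s → v ≋ x ·ᵛ pointCases n s)
          (sym (Fin.splitAt-↑ʳ (q ℕ.^ n) (pointCount n) i))
          λ { zero → K.trans v₀≈0 (K.sym (K.zeroʳ x)) ; (suc k) → e k }
  point-covers (suc n) v v≢0 | no v₀≉0 with K.inverse (v zero) v₀≉0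
  ... | y , yv₀≈1 with vector-surjective n (y ·ᵛ (v ∘ suc))
  ...   | a , e = a Fin.↑ˡ pointCount n , v zero , subst (λ s → v ≋ v zero ·ᵛ pointCases n s)
          (sym (Fin.splitAt-↑ˡ (q ℕ.^ n) a (pointCount n)))
          λ { zero    → K.sym (K.*-identityʳ (v zero))
            ; (suc k) → K.sym (begin
                v zero K.* vector n a k            ≈⟨ K.*-congˡ (e k) ⟩
                v zero K.* (y K.* v (suc k))       ≈⟨ K.*-assoc (v zero) y (v (suc k)) ⟨
                v zero K.* y K.* v (suc k)         ≈⟨ K.*-congʳ (K.trans (K.*-comm (v zero) y) yv₀≈1) ⟩
                K.1# K.* v (suc k)                 ≈⟨ K.*-identityˡ (v (suc k)) ⟩
                v (suc k)                          ∎) }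

  private
    -1# : K.Carrier
    -1# = K.- K.1#

    -1*x+x : ∀ x → -1# K.* x K.+ x K.≈ K.0#
    -1*x+x x = begin
      -1# K.* x K.+ x             ≈⟨ K.+-congˡ (K.*-identityˡ x) ⟨
      -1# K.* x K.+ K.1# K.* x    ≈⟨ K.distribʳ x -1# K.1# ⟨
      (-1# K.+ K.1#) K.* x        ≈⟨ K.*-congʳ (K.-‿inverseˡ K.1#) ⟩
      K.0# K.* x                  ≈⟨ K.zeroˡ x ⟩
      K.0#                        ∎

  -- Subtraction is written with the scalar -1, the form in which differences of linear combinations
  -- and determinants occur below.
  ≈-from-difference : ∀ {x y} → x K.+ K.- K.1# K.* y K.≈ K.0# → x K.≈ y
  ≈-from-difference {x} {y} e = begin
    x                               ≈⟨ K.+-identityʳ x ⟨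
    x K.+ K.0#                      ≈⟨ K.+-congˡ (-1*x+x y) ⟨
    x K.+ (-1# K.* y K.+ y)         ≈⟨ K.+-assoc x (-1# K.* y) y ⟨
    x K.+ -1# K.* y K.+ y           ≈⟨ K.+-congʳ e ⟩
    K.0# K.+ y                      ≈⟨ K.+-identityˡ y ⟩
    y                               ∎

  difference≈0 : ∀ {x y} → x K.≈ y → x K.+ K.- K.1# K.* y K.≈ K.0#
  difference≈0 {x} {y} e = K.trans (K.+-comm x (-1# K.* y)) (K.trans (K.+-congˡ e) (-1*x+x y))

  combination-· : ∀ {n k} x (y : V k) (u : Fin k → V n) → x ·ᵛ combination y u ≋ combination (x ·ᵛ y) u
  combination-· x y u = proj₂ (·-closed (span u) x {combination y u} (y , ≋-refl))

  combination-+ : ∀ {n k} (x y : V k) (u : Fin k → V n) →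
                  combination x u +ᵛ combination y u ≋ combination (x +ᵛ y) u
  combination-+ x y u = proj₂ (+-closed (span u) {combination x u} {combination y u} (x , ≋-refl) (y , ≋-refl))

  combination-injective : ∀ {n k} {u : Fin k → V n} → LinearlyIndependent u →
                          ∀ x y → combination x u ≋ combination y u → x ≋ y
  combination-injective {u = u} li x y e i = ≈-from-difference (li (x +ᵛ (-1# ·ᵛ y)) (λ j → begin
    combination (x +ᵛ (-1# ·ᵛ y)) u j                       ≈⟨ combination-+ x (-1# ·ᵛ y) u j ⟨
    combination x u j K.+ combination (-1# ·ᵛ y) u j        ≈⟨ K.+-congˡ (combination-· -1# y u j) ⟨
    combination x u j K.+ -1# K.* combination y u j         ≈⟨ difference≈0 (e j) ⟩
    K.0#                                                    ∎) i)

  combination-0 : ∀ {n k} {x : V k} (u : Fin k → V n) → x ≋ 0ᵛ → combination x u ≋ 0ᵛ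
  combination-0 u x≋0 j = K.trans (combination-cong {u = u} x≋0 (λ _ → ≋-refl) j) (K.sym (proj₂ (0-closed (span u)) j))

  ·-cancel : ∀ {n} {x} {v w : V n} → ¬ v ≋ 0ᵛ → v ≋ x ·ᵛ w → ∃ λ y → w ≋ y ·ᵛ v
  ·-cancel {x = x} {v} {w} v≢0 e with x ≟ᴷ K.0#
  ... | yes x≈0 = contradiction (λ i → K.trans (e i) (K.trans (K.*-congʳ x≈0) (K.zeroˡ (w i)))) v≢0
  ... | no x≉0 with K.inverse x x≉0
  ...   | y , yx≈1 = y , λ i → K.sym (begin
          y K.* v i              ≈⟨ K.*-congˡ (e i) ⟩
          y K.* (x K.* w i)      ≈⟨ K.*-assoc y x (w i) ⟨
          y K.* x K.* w i        ≈⟨ K.*-congʳ yx≈1 ⟩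
          K.1# K.* w i           ≈⟨ K.*-identityˡ (w i) ⟩
          w i                    ∎)

  -- In the basis `u` the points of `W` are those of the coordinate space of dimension `k`. The
  -- vector `at j` need not be normalised, so `index j` picks the point proportional to it.
  sum-points-on : ∀ {n k} (X@(W , _) : Setoid.Carrier (Grassmannian n k)) →
                  sum (λ i → χ (member? X (point n i))) ≡ ℤ.+ pointCount k
  sum-points-on {n} {k} X@(W , u , li , ⊆span , span⊆) = sum-χ (λ i → member? X (point n i)) index injective on-W surjective
    where
    at : Fin (pointCount k) → V n
    at j = combination (point k j) u
    at-nonZero : ∀ j → ¬ at j ≋ 0ᵛ
    at-nonZero j e = point-nonZero k j (li (point k j) e)
    cover : ∀ j → ∃₂ λ i x → at j ≋ x ·ᵛ point n i
    cover j = point-covers n (at j) (at-nonZero j)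
    index : Fin (pointCount k) → Fin (pointCount n)
    index = proj₁ ∘ cover
    at-index : ∀ j → ∃ λ y → point n (index j) ≋ y ·ᵛ at j
    at-index j = ·-cancel (at-nonZero j) (proj₂ (proj₂ (cover j)))
    on-W : ∀ j → member W (point n (index j))
    on-W j = let y , e = at-index j in
      resp-≋ W (≋-sym e) (·-closed W y (span⊆ (point k j , ≋-refl)))
    proportional : ∀ i j x → at i ≋ x ·ᵛ at j → i ≡ j
    proportional i j x e = point-separates k i j x (combination-injective li (point k i) (x ·ᵛ point k j)
      (≋-trans e (combination-· x (point k j) u)))
    injective : ∀ i j → index i ≡ index j → i ≡ j
    injective i j ij = let x , e  = proj₂ (cover i)
                           y , e′ = at-index j in
      proportional i j (x K.* y) λ l → begin
        at i l                        ≈⟨ e l ⟩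
        x K.* point n (index i) l     ≡⟨ cong (λ a → x K.* point n a l) ij ⟩
        x K.* point n (index j) l     ≈⟨ K.*-congˡ (e′ l) ⟩
        x K.* (y K.* at j l)          ≈⟨ K.*-assoc x y (at j l) ⟨
        x K.* y K.* at j l            ∎
    surjective : ∀ {i} → member W (point n i) → ∃ λ j → index j ≡ i
    surjective {i} Wp =
      let x , e      = ⊆span Wp
          j , y , e′ = point-covers k x λ x≋0 → point-nonZero n i (≋-trans e (combination-0 u x≋0))
          z , e″     = proj₂ (cover j)
      in j , sym (point-separates n i (index j) (y K.* z) λ l → begin
        point n i l                           ≈⟨ e l ⟩
        combination x u l                     ≈⟨ combination-cong {u = u} e′ (λ _ → ≋-refl) l ⟩
        combination (y ·ᵛ point k j) u l      ≈⟨ combination-· y (point k j) u l ⟨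
        y K.* at j l                          ≈⟨ K.*-congˡ (e″ l) ⟩
        y K.* (z K.* point n (index j) l)     ≈⟨ K.*-assoc y z (point n (index j) l) ⟨
        y K.* z K.* point n (index j) l       ∎)

-- Determinants and the line through two points

module _ {c r q} (K : FiniteField c r q) where
  open LinearAlgebra K
  private
    module K = FiniteField K
    open import Relation.Binary.Reasoning.Setoid K.setoid
    open import Algebra.Solver.Ring.NaturalCoefficients.Default K.commutativeSemiring using (solve; _:=_; _:+_; _:*_)

    -- Cramer's rule with e for -1, so that it holds in every commutative
    -- semiring; the last summand vanishes when e = -1.
    cramer : ∀ a₀ a₁ x₀ x₁ y₀ y₁ u₀ u₁ e →
      (a₀ K.* y₁ K.+ e K.* (a₁ K.* y₀)) K.* (x₀ K.* u₀ K.+ x₁ K.* u₁) K.+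
        (x₀ K.* a₁ K.+ e K.* (x₁ K.* a₀)) K.* (y₀ K.* u₀ K.+ y₁ K.* u₁) K.≈
      (x₀ K.* y₁ K.+ e K.* (x₁ K.* y₀)) K.* (a₀ K.* u₀ K.+ a₁ K.* u₁) K.+
        (K.1# K.+ e) K.* (a₁ K.* x₀ K.* y₀ K.* u₀ K.+ a₀ K.* x₁ K.* y₁ K.* u₁)
    cramer a₀ a₁ x₀ x₁ y₀ y₁ u₀ u₁ e = K.trans
      (solve 9 (λ a₀ a₁ x₀ x₁ y₀ y₁ u₀ u₁ e →
        (a₀ :* y₁ :+ e :* (a₁ :* y₀)) :* (x₀ :* u₀ :+ x₁ :* u₁) :+
          (x₀ :* a₁ :+ e :* (x₁ :* a₀)) :* (y₀ :* u₀ :+ y₁ :* u₁) :=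
        (x₀ :* y₁ :+ e :* (x₁ :* y₀)) :* (a₀ :* u₀ :+ a₁ :* u₁) :+
          (a₁ :* x₀ :* y₀ :* u₀ :+ a₀ :* x₁ :* y₁ :* u₁ :+
           e :* (a₁ :* x₀ :* y₀ :* u₀ :+ a₀ :* x₁ :* y₁ :* u₁)))
        K.refl a₀ a₁ x₀ x₁ y₀ y₁ u₀ u₁ e)
      (K.+-congˡ (K.trans (K.+-congʳ (K.sym (K.*-identityˡ _)))
        (K.sym (K.distribʳ (a₁ K.* x₀ K.* y₀ K.* u₀ K.+ a₀ K.* x₁ K.* y₁ K.* u₁) K.1# e))))

    -1# : K.Carrier
    -1# = K.- K.1#

    combination₂ : ∀ {n} x (u : Fin 2 → V n) j →
                   combination x u j K.≈ x zero K.* u zero j K.+ x (suc zero) K.* u (suc zero) j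
    combination₂ x u j = K.+-congˡ (K.+-identityʳ (x (suc zero) K.* u (suc zero) j))

    cancel-unit : ∀ {n} {x y} {v w : V n} → y K.* x K.≈ K.1# → x ·ᵛ v ≋ w → v ≋ y ·ᵛ w
    cancel-unit {x = x} {y} {v} {w} yx≈1 e j = begin
      v j                    ≈⟨ K.*-identityˡ (v j) ⟨
      K.1# K.* v j           ≈⟨ K.*-congʳ yx≈1 ⟨
      y K.* x K.* v j        ≈⟨ K.*-assoc y x (v j) ⟩
      y K.* (x K.* v j)      ≈⟨ K.*-congˡ (e j) ⟩
      y K.* w j              ∎

    point-multiple : ∀ n {i j x y} → ¬ x K.≈ K.0# → x ·ᵛ point K n i ≋ y ·ᵛ point K n j → i ≡ j
    point-multiple n {i} {j} {x} {y} x≉0 e = let z , zx≈1 = K.inverse x x≉0 in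
      point-separates K n i j (z K.* y) λ l →
        K.trans (cancel-unit {w = y ·ᵛ point K n j} zx≈1 e l) (K.sym (K.*-assoc z y (point K n j l)))

    -- A zero determinant would make the two points proportional.
    determinant-nonZero : ∀ {n i j} (u : Fin 2 → V n) (x y : V 2) → i ≢ j →
      point K n i ≋ combination x u → point K n j ≋ combination y u →
      ¬ x zero K.* y (suc zero) K.+ -1# K.* (x (suc zero) K.* y zero) K.≈ K.0#
    determinant-nonZero {n} {i} {j} u x y i≢j e e′ d≈0 with y zero ≟ᴷ K.0# | y (suc zero) ≟ᴷ K.0#
    ... | yes y₀≈0 | yes y₁≈0 = point-nonZero K n j
          (≋-trans e′ (combination-0 K {x = y} u λ { zero → y₀≈0 ; (suc zero) → y₁≈0 }))
    ... | no y₀≉0  | _ = i≢j (point-multiple n {y = x zero} y₀≉0 λ l → begin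
          y zero K.* point K n i l                                   ≈⟨ K.*-congˡ (K.trans (e l) (combination₂ x u l)) ⟩
          y zero K.* (x zero K.* u zero l K.+ x (suc zero) K.* u (suc zero) l)
            ≈⟨ solve 5 (λ y₀ x₀ x₁ u₀ u₁ → y₀ :* (x₀ :* u₀ :+ x₁ :* u₁) := x₀ :* y₀ :* u₀ :+ x₁ :* y₀ :* u₁)
                 K.refl (y zero) (x zero) (x (suc zero)) (u zero l) (u (suc zero) l) ⟩
          x zero K.* y zero K.* u zero l K.+ x (suc zero) K.* y zero K.* u (suc zero) l
            ≈⟨ K.+-congˡ (K.*-congʳ (K.sym x₀y₁≈x₁y₀)) ⟩
          x zero K.* y zero K.* u zero l K.+ x zero K.* y (suc zero) K.* u (suc zero) l
            ≈⟨ solve 5 (λ x₀ y₀ y₁ u₀ u₁ → x₀ :* y₀ :* u₀ :+ x₀ :* y₁ :* u₁ := x₀ :* (y₀ :* u₀ :+ y₁ :* u₁))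
                 K.refl (x zero) (y zero) (y (suc zero)) (u zero l) (u (suc zero) l) ⟩
          x zero K.* (y zero K.* u zero l K.+ y (suc zero) K.* u (suc zero) l)
            ≈⟨ K.*-congˡ (K.trans (e′ l) (combination₂ y u l)) ⟨
          x zero K.* point K n j l ∎)
      where
      x₀y₁≈x₁y₀ = ≈-from-difference K d≈0
    ... | yes _ | no y₁≉0 = i≢j (point-multiple n {y = x (suc zero)} y₁≉0 λ l → begin
          y (suc zero) K.* point K n i l                             ≈⟨ K.*-congˡ (K.trans (e l) (combination₂ x u l)) ⟩
          y (suc zero) K.* (x zero K.* u zero l K.+ x (suc zero) K.* u (suc zero) l)
            ≈⟨ solve 5 (λ y₁ x₀ x₁ u₀ u₁ → y₁ :* (x₀ :* u₀ :+ x₁ :* u₁) := x₀ :* y₁ :* u₀ :+ x₁ :* y₁ :* u₁)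
                 K.refl (y (suc zero)) (x zero) (x (suc zero)) (u zero l) (u (suc zero) l) ⟩
          x zero K.* y (suc zero) K.* u zero l K.+ x (suc zero) K.* y (suc zero) K.* u (suc zero) l
            ≈⟨ K.+-congʳ (K.*-congʳ x₀y₁≈x₁y₀) ⟩
          x (suc zero) K.* y zero K.* u zero l K.+ x (suc zero) K.* y (suc zero) K.* u (suc zero) l
            ≈⟨ solve 5 (λ x₁ y₀ y₁ u₀ u₁ → x₁ :* y₀ :* u₀ :+ x₁ :* y₁ :* u₁ := x₁ :* (y₀ :* u₀ :+ y₁ :* u₁))
                 K.refl (x (suc zero)) (y zero) (y (suc zero)) (u zero l) (u (suc zero) l) ⟩
          x (suc zero) K.* (y zero K.* u zero l K.+ y (suc zero) K.* u (suc zero) l)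
            ≈⟨ K.*-congˡ (K.trans (e′ l) (combination₂ y u l)) ⟨
          x (suc zero) K.* point K n j l ∎)
      where
      x₀y₁≈x₁y₀ = ≈-from-difference K d≈0

  -- Any two distinct points of a line span it: by Cramer's rule the determinant `d` times `v` is a
  -- combination of the two points, and `d` is invertible.
  line-⊆ : ∀ {n i j} ((W , _) : Line n) (W′ : Subspace n) → i ≢ j →
           member W (point K n i) → member W (point K n j) →
           member W′ (point K n i) → member W′ (point K n j) → member W ⊆ member W′
  line-⊆ {n} {i} {j} (W , u , li , ⊆span , span⊆) W′ i≢j Wi Wj W′i W′j {v} Wv =
    let x , e    = ⊆span Wi
        y , e′   = ⊆span Wj
        a , e″   = ⊆span Wv
        d        = x zero K.* y (suc zero) K.+ -1# K.* (x (suc zero) K.* y zero)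
        z , zd≈1 = K.inverse d (determinant-nonZero u x y i≢j e e′)
        α        = a zero K.* y (suc zero) K.+ -1# K.* (a (suc zero) K.* y zero)
        β        = x zero K.* a (suc zero) K.+ -1# K.* (x (suc zero) K.* a zero)
    in resp-≋ W′
      (≋-sym (cancel-unit {v = v} {w = (α ·ᵛ point K n i) +ᵛ (β ·ᵛ point K n j)} zd≈1 λ l → K.sym (begin
        α K.* point K n i l K.+ β K.* point K n j l
          ≈⟨ K.+-cong (K.*-congˡ (K.trans (e l) (combination₂ x u l))) (K.*-congˡ (K.trans (e′ l) (combination₂ y u l))) ⟩
        α K.* (x zero K.* u zero l K.+ x (suc zero) K.* u (suc zero) l) K.+
          β K.* (y zero K.* u zero l K.+ y (suc zero) K.* u (suc zero) l)
          ≈⟨ cramer (a zero) (a (suc zero)) (x zero) (x (suc zero)) (y zero) (y (suc zero)) (u zero l) (u (suc zero) l) -1# ⟩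
        d K.* (a zero K.* u zero l K.+ a (suc zero) K.* u (suc zero) l) K.+ (K.1# K.+ -1#) K.* _
          ≈⟨ K.+-congˡ (K.trans (K.*-congʳ (K.-‿inverseʳ K.1#)) (K.zeroˡ _)) ⟩
        d K.* (a zero K.* u zero l K.+ a (suc zero) K.* u (suc zero) l) K.+ K.0#
          ≈⟨ K.+-identityʳ _ ⟩
        d K.* (a zero K.* u zero l K.+ a (suc zero) K.* u (suc zero) l)
          ≈⟨ K.*-congˡ (K.trans (e″ l) (combination₂ a u l)) ⟨
        d K.* v l ∎)))
      (·-closed W′ z (+-closed W′ (·-closed W′ α W′i) (·-closed W′ β W′j)))

  lineThrough : ∀ {n i j} → i ≢ j → ∃ λ k → member (proj₁ (line n k)) (point K n i) × member (proj₁ (line n k)) (point K n j)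
  lineThrough {n} {i} {j} i≢j =
    let k , ⊆L , L⊆ = Bijection.strictlySurjective (proj₂ (grassmannian-finite n 2)) L
    in k , L⊆ (cons′ K.1# K.0# , λ l → K.sym (K.trans (combination₂ (cons′ K.1# K.0#) u l)
             (K.trans (K.+-cong (K.*-identityˡ _) (K.zeroˡ _)) (K.+-identityʳ _))))
         , L⊆ (cons′ K.0# K.1# , λ l → K.sym (K.trans (combination₂ (cons′ K.0# K.1#) u l)
             (K.trans (K.+-cong (K.zeroˡ _) (K.*-identityˡ _)) (K.+-identityˡ _))))
    where
    cons′ : K.Carrier → K.Carrier → V 2
    cons′ x y zero    = x
    cons′ x y (suc _) = y
    u : Fin 2 → V n
    u zero    = point K n i
    u (suc _) = point K n j
    -- A nonzero coefficient in a relation would make the two points proportional, hence equal.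
    independent : LinearlyIndependent u
    independent x e = λ { zero → x₀≈0 ; (suc zero) → x₁≈0 }
      where
      relation : ∀ l → x zero K.* point K n i l K.+ x (suc zero) K.* point K n j l K.≈ K.0#
      relation l = K.trans (K.sym (combination₂ x u l)) (e l)
      negate : ∀ {a b} → a K.+ b K.≈ K.0# → a K.≈ -1# K.* b
      negate {a} {b} a+b≈0 = begin
        a                              ≈⟨ K.+-identityʳ a ⟨
        a K.+ K.0#                     ≈⟨ K.+-congˡ (difference≈0 K K.refl) ⟨
        a K.+ (b K.+ -1# K.* b)        ≈⟨ K.+-assoc a b (-1# K.* b) ⟨
        a K.+ b K.+ -1# K.* b          ≈⟨ K.+-congʳ a+b≈0 ⟩
        K.0# K.+ -1# K.* b             ≈⟨ K.+-identityˡ _ ⟩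
        -1# K.* b                      ∎
      x₀≈0 : x zero K.≈ K.0#
      x₀≈0 with x zero ≟ᴷ K.0#
      ... | yes x₀≈0 = x₀≈0
      ... | no x₀≉0  = contradiction (point-multiple n {y = -1# K.* x (suc zero)} x₀≉0 λ l →
        K.trans (negate (relation l)) (K.sym (K.*-assoc -1# (x (suc zero)) (point K n j l)))) i≢j
      x₁≈0 : x (suc zero) K.≈ K.0#
      x₁≈0 with x (suc zero) ≟ᴷ K.0#
      ... | yes x₁≈0 = x₁≈0
      ... | no x₁≉0  = contradiction (sym (point-multiple n {y = -1# K.* x zero} x₁≉0 λ l →
        K.trans (negate (K.trans (K.+-comm _ _) (relation l))) (K.sym (K.*-assoc -1# (x zero) (point K n i l))))) i≢j
    L : Line n
    L = span u , u , independent , (λ h → h) , (λ h → h)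

-- The incidence matrix of points and lines

module _ {c r q} (K : FiniteField c r q) where
  open LinearAlgebra K
  open import Data.Integer.Base using (_+_; _*_; _-_; -_)
  open ≡.≡-Reasoning
  private
    module K = FiniteField K

  incident? : ∀ n i k → Dec (member (proj₁ (line n k)) (point K n i))
  incident? n i k = member? (line n k) (point K n i)

  incidence : ∀ n → Fin (pointCount K n) → Fin (gaussianBinomial n 2) → ℤ
  incidence n i k = χ (incident? n i k)

  pointCount-suc : ∀ n → pointCount K (suc n) ≡ 1 ℕ.+ q ℕ.* pointCount K n
  pointCount-suc zero    = cong suc (sym (ℕ.*-zeroʳ q))
  pointCount-suc (suc n) = begin
    q ℕ.^ suc n ℕ.+ pointCount K (suc n)           ≡⟨ cong (q ℕ.^ suc n ℕ.+_) (pointCount-suc n) ⟩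
    q ℕ.^ suc n ℕ.+ suc (q ℕ.* pointCount K n)     ≡⟨ ℕ.+-suc (q ℕ.^ suc n) (q ℕ.* pointCount K n) ⟩
    suc (q ℕ.* q ℕ.^ n ℕ.+ q ℕ.* pointCount K n)   ≡⟨ cong suc (ℕ.*-distribˡ-+ q (q ℕ.^ n) (pointCount K n)) ⟨
    suc (q ℕ.* pointCount K (suc n))               ∎

  pointCount-sucℤ : ∀ n → ℤ.+ pointCount K (suc n) ≡ 1ℤ + ℤ.+ q * ℤ.+ pointCount K n
  pointCount-sucℤ n = trans (cong ℤ.+_ (pointCount-suc n)) (cong (1ℤ +_) (ℤ.pos-* q (pointCount K n)))

  pointCount-2 : ℤ.+ pointCount K 2 ≡ 1ℤ + ℤ.+ q
  pointCount-2 = trans (pointCount-sucℤ 1) (cong (1ℤ +_) (ℤ.*-identityʳ (ℤ.+ q)))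

  lines-equal : ∀ {n i j} k l → i ≢ j →
    member (proj₁ (line n k)) (point K n i) → member (proj₁ (line n k)) (point K n j) →
    member (proj₁ (line n l)) (point K n i) → member (proj₁ (line n l)) (point K n j) → k ≡ l
  lines-equal {n} k l i≢j ki kj li lj = Bijection.injective (proj₂ (grassmannian-finite n 2))
    ( line-⊆ K (line n k) (proj₁ (line n l)) i≢j ki kj li lj
    , line-⊆ K (line n l) (proj₁ (line n k)) i≢j li lj ki kj )

  sum-incidence : ∀ n k → sum (λ i → incidence n i k) ≡ 1ℤ + ℤ.+ q
  sum-incidence n k = trans (sum-points-on K (line n k)) pointCount-2

  skew-irreflexive : ∀ {n} (L : Line n) → ¬ Skew L L
  skew-irreflexive (W , u , li , _ , span⊆) (⊆0 , _) =
    -- The vector of ones only supplies something nonzero, so that the coordinate plane has a point;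
    -- that point yields a nonzero vector of `W`.
    let i , _ = point-covers K 2 (λ _ → K.1#) (λ e → K.1≉0 (e zero))
        v∈    = span⊆ (point K 2 i , ≋-refl)
    in point-nonZero K 2 i (li (point K 2 i) (⊆0 (v∈ , v∈)))

  common-points : ∀ n k l → sum (λ i → incidence n i k * incidence n i l) ≡
                  ℤ.+ q * δ k l + 1ℤ - skewLinesMatrix n k l
  common-points n k l with k Fin.≟ l
  ... | yes refl = begin
    sum (λ i → incidence n i k * incidence n i k)   ≡⟨ sum-cong (λ i → χ-idem (incident? n i k)) ⟩
    sum (λ i → incidence n i k)                     ≡⟨ sum-incidence n k ⟩
    1ℤ + ℤ.+ q                                      ≡⟨ rearrange (ℤ.+ q) ⟩
    ℤ.+ q * 1ℤ + 1ℤ - 0ℤ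
      ≡⟨ cong (λ y → ℤ.+ q * 1ℤ + 1ℤ - y) (sym (χ-no (skew? (line n k) (line n k)) (skew-irreflexive (line n k)))) ⟩
    ℤ.+ q * 1ℤ + 1ℤ - skewLinesMatrix n k k         ∎
    where
    rearrange : ∀ q → 1ℤ + q ≡ q * 1ℤ + 1ℤ - 0ℤ
    rearrange = solve-∀
  ... | no k≢l with skew? (line n k) (line n l)
  ...   | yes (⊆0 , _) = trans
    (sum-zero λ i → trans (χ-× (incident? n i k) (incident? n i l))
      (χ-no (incident? n i k ×-dec incident? n i l) (λ both → point-nonZero K n i (⊆0 both))))
    (rearrange (ℤ.+ q))
    where
    rearrange : ∀ q → 0ℤ ≡ q * 0ℤ + 1ℤ - 1ℤ
    rearrange = solve-∀
  ...   | no ¬skew with Fin.any? (λ i → incident? n i k ×-dec incident? n i l)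
  ...     | no none = contradiction
    ( (λ {v} (v∈k , v∈l) → ⊆0 v v∈k v∈l)
    , (λ {v} v≋0 → resp-≋ (proj₁ (line n k)) (≋-sym v≋0) (0-closed (proj₁ (line n k)))
             , resp-≋ (proj₁ (line n l)) (≋-sym v≋0) (0-closed (proj₁ (line n l)))) ) ¬skew
    where
    ⊆0 : ∀ v → member (proj₁ (line n k)) v → member (proj₁ (line n l)) v → v ≋ 0ᵛ
    ⊆0 v v∈k v∈l with v ≋? 0ᵛ
    ... | yes v≋0 = v≋0
    ... | no v≢0 with point-covers K n v v≢0
    ...   | i , x , e with ·-cancel K v≢0 e
    ...     | y , e′ = contradiction
      ( i , resp-≋ (proj₁ (line n k)) (≋-sym e′) (·-closed (proj₁ (line n k)) y v∈k)
          , resp-≋ (proj₁ (line n l)) (≋-sym e′) (·-closed (proj₁ (line n l)) y v∈l)) none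
  ...     | yes (i₀ , i₀k , i₀l) = trans
    (sum-cong λ i → χ-× (incident? n i k) (incident? n i l))
    (trans (sum-χ-unique (λ i → incident? n i k ×-dec incident? n i l) {i₀} (i₀k , i₀l) unique) (rearrange (ℤ.+ q)))
    where
    rearrange : ∀ q → 1ℤ ≡ q * 0ℤ + 1ℤ - 0ℤ
    rearrange = solve-∀
    unique : ∀ {i} → member (proj₁ (line n k)) (point K n i) × member (proj₁ (line n l)) (point K n i) → i₀ ≡ i
    unique {i} (ik , il) with i₀ Fin.≟ i
    ... | yes i₀≡i = i₀≡i
    ... | no i₀≢i  = contradiction (lines-equal k l i₀≢i i₀k ik i₀l il) k≢l

  private
    lines-through : ∀ n → Fin (pointCount K n) → ℤ
    lines-through n i = sum (λ k → incidence n i k)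

  -- The number of lines through a point is still unknown here and stays on the diagonal; `degree`
  -- determines it from this identity.
  common-lines′ : ∀ n i j → sum (λ k → incidence n i k * incidence n j k) ≡ (lines-through n i - 1ℤ) * δ i j + 1ℤ
  common-lines′ n i j with i Fin.≟ j
  ... | yes refl = trans (sum-cong λ k → χ-idem (incident? n i k)) (rearrange (lines-through n i))
    where
    rearrange : ∀ w → w ≡ (w - 1ℤ) * 1ℤ + 1ℤ
    rearrange = solve-∀
  ... | no i≢j = trans (sum-cong λ k → χ-× (incident? n i k) (incident? n j k))
    (trans (sum-χ-unique (λ k → incident? n i k ×-dec incident? n j k) (k₀i , k₀j)
        (λ {k} (ki , kj) → lines-equal k₀ k i≢j k₀i k₀j ki kj))
      (rearrange (lines-through n i)))
    where
    k₀  = proj₁ (lineThrough K i≢j)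
    k₀i = proj₁ (proj₂ (lineThrough K i≢j))
    k₀j = proj₂ (proj₂ (lineThrough K i≢j))
    rearrange : ∀ w → 1ℤ ≡ (w - 1ℤ) * 0ℤ + 1ℤ
    rearrange = solve-∀

  q-nonZero : ℤ.NonZero (ℤ.+ q)
  q-nonZero = ℕ.nonTrivial⇒nonZero q {{order-nonTrivial K}}

  -- Counting the pairs of a line through the point i and a point on it:
  -- (1 + q) w = w + (v - 1).
  degree : ∀ n i → sum (λ k → incidence (suc n) i k) ≡ ℤ.+ pointCount K n
  degree n i = ℤ.*-cancelˡ-≡ (ℤ.+ q) w (ℤ.+ pointCount K n) {{q-nonZero}} (begin
    ℤ.+ q * w                                  ≡⟨ isolate (ℤ.+ q) w ⟩
    w * (1ℤ + ℤ.+ q) - w                       ≡⟨ cong (_- w) double-count ⟩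
    (w - 1ℤ) + ℤ.+ pointCount K (suc n) - w    ≡⟨ cong (λ v → (w - 1ℤ) + v - w) (pointCount-sucℤ n) ⟩
    (w - 1ℤ) + (1ℤ + ℤ.+ q * ℤ.+ pointCount K n) - w  ≡⟨ cancel w (ℤ.+ q * ℤ.+ pointCount K n) ⟩
    ℤ.+ q * ℤ.+ pointCount K n                 ∎)
    where
    N = incidence (suc n)
    w = lines-through (suc n) i
    isolate : ∀ q w → q * w ≡ w * (1ℤ + q) - w
    isolate = solve-∀
    cancel : ∀ w a → (w - 1ℤ) + (1ℤ + a) - w ≡ a
    cancel = solve-∀
    double-count : w * (1ℤ + ℤ.+ q) ≡ (w - 1ℤ) + ℤ.+ pointCount K (suc n)
    double-count = begin
      w * (1ℤ + ℤ.+ q)                             ≡⟨ *-distribʳ-sum (1ℤ + ℤ.+ q) (N i) ⟩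
      sum (λ k → N i k * (1ℤ + ℤ.+ q))
        ≡⟨ sum-cong (λ k → trans (cong (N i k *_) (sym (sum-incidence (suc n) k)))
             (*-distribˡ-sum (N i k) (λ j → N j k))) ⟩
      sum (λ k → sum (λ j → N i k * N j k))        ≡⟨ ∑-comm (λ k j → N i k * N j k) ⟩
      sum (λ j → sum (λ k → N i k * N j k))        ≡⟨ sum-cong (λ j → common-lines′ (suc n) i j) ⟩
      sum (λ j → (w - 1ℤ) * δ i j + 1ℤ)            ≡⟨ ∑-distrib-+ (λ j → (w - 1ℤ) * δ i j) (λ _ → 1ℤ) ⟩
      sum (λ j → (w - 1ℤ) * δ i j) + sum {pointCount K (suc n)} (λ _ → 1ℤ)
        ≡⟨ cong₂ _+_ (trans (sum-cong λ j → ℤ.*-comm (w - 1ℤ) (δ i j)) (sum-δˡ i (λ _ → w - 1ℤ)))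
             (trans (sum-const (pointCount K (suc n)) 1ℤ) (ℤ.*-identityʳ (ℤ.+ pointCount K (suc n)))) ⟩
      (w - 1ℤ) + ℤ.+ pointCount K (suc n)          ∎

  common-lines : ∀ n i j → sum (λ k → incidence (suc (suc n)) i k * incidence (suc (suc n)) j k) ≡
                 ℤ.+ q * ℤ.+ pointCount K n * δ i j + 1ℤ
  common-lines n i j = trans (common-lines′ (suc (suc n)) i j) (cong (λ w → w * δ i j + 1ℤ)
    (trans (cong (_- 1ℤ) (trans (degree (suc n) i) (pointCount-sucℤ n))) (cancel (ℤ.+ q * ℤ.+ pointCount K n))))
    where
    cancel : ∀ a → 1ℤ + a - 1ℤ ≡ a
    cancel = solve-∀

  -- Incident pairs counted by lines and by points. The factor `1 + q` stays on the left, so that no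
  -- quotient appears.
  lineCount : ∀ n → ℤ.+ gaussianBinomial (suc n) 2 * (1ℤ + ℤ.+ q) ≡ ℤ.+ pointCount K (suc n) * ℤ.+ pointCount K n
  lineCount n = begin
    ℤ.+ gaussianBinomial (suc n) 2 * (1ℤ + ℤ.+ q)
      ≡⟨ sum-const (gaussianBinomial (suc n) 2) (1ℤ + ℤ.+ q) ⟨
    sum {gaussianBinomial (suc n) 2} (λ _ → 1ℤ + ℤ.+ q)
      ≡⟨ sum-cong (λ k → sym (sum-incidence (suc n) k)) ⟩
    sum (λ k → sum (λ i → incidence (suc n) i k))   ≡⟨ ∑-comm (λ k i → incidence (suc n) i k) ⟩
    sum (λ i → sum (λ k → incidence (suc n) i k))   ≡⟨ sum-cong (degree n) ⟩
    sum {pointCount K (suc n)} (λ _ → ℤ.+ pointCount K n)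
      ≡⟨ sum-const (pointCount K (suc n)) (ℤ.+ pointCount K n) ⟩
    ℤ.+ pointCount K (suc n) * ℤ.+ pointCount K n   ∎

-- Elementary divisors of the skew-lines matrix

module _ where
  open import Data.Integer.Base using (_+_; _*_; _-_; -_)

  module _ {c r q} (K : FiniteField c r q) (m : ℕ) where
    open LinearAlgebra K
    private
      u = pointCount K m
      k = gaussianBinomial (1 ℕ.+ m) 2
      w = pointCount K (2 ℕ.+ m)
      v = pointCount K (3 ℕ.+ m)
      l = gaussianBinomial (3 ℕ.+ m) 2
      Q = ℤ.+ q
      U = ℤ.+ u
      k-formula : (1ℤ + Q) * ℤ.+ k ≡ U * (1ℤ + Q * U)
      k-formula = trans (ℤ.*-comm (1ℤ + Q) (ℤ.+ k)) (trans (lineCount K m)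
        (trans (ℤ.*-comm (ℤ.+ pointCount K (suc m)) U) (cong (U *_) (pointCount-sucℤ K m))))

      w-formula : ℤ.+ w ≡ 1ℤ + Q + Q * Q * U
      w-formula = trans (pointCount-sucℤ K (suc m)) (trans (cong (λ x → 1ℤ + Q * x) (pointCount-sucℤ K m)) (expand Q U))
        where
        expand : ∀ q u → 1ℤ + q * (1ℤ + q * u) ≡ 1ℤ + q + q * q * u
        expand = solve-∀

      v-formula : ℤ.+ v ≡ 1ℤ + Q + Q * Q + Q * Q * Q * U
      v-formula = trans (pointCount-sucℤ K (2 ℕ.+ m)) (trans (cong (λ x → 1ℤ + Q * x) w-formula) (expand Q U))
        where
        expand : ∀ q u → 1ℤ + q * (1ℤ + q + q * q * u) ≡ 1ℤ + q + q * q + q * q * q * u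
        expand = solve-∀

      -- The product `v w` is `(v + q² u) (1 + q)` plus `q⁴ u (1 + q u)`, and the second term is
      -- `1 + q` times `q⁴ k`. Cancelling `1 + q` in ℤ gives the formula.
      l-formula : ℤ.+ l ≡ 1ℤ + Q + Q * Q + Q * Q * Q * U + Q * Q * U + Q * Q * Q * Q * ℤ.+ k
      l-formula = ℤ.*-cancelʳ-≡ (ℤ.+ l) _ (1ℤ + Q) (begin
        ℤ.+ l * (1ℤ + Q)                                                      ≡⟨ lineCount K (2 ℕ.+ m) ⟩
        ℤ.+ v * ℤ.+ w                                                         ≡⟨ cong₂ _*_ v-formula w-formula ⟩
        (1ℤ + Q + Q * Q + Q * Q * Q * U) * (1ℤ + Q + Q * Q * U)               ≡⟨ expand Q U ⟩
        (1ℤ + Q + Q * Q + Q * Q * Q * U + Q * Q * U) * (1ℤ + Q) + Q * Q * Q * Q * (U * (1ℤ + Q * U))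
          ≡⟨ cong (λ x → (1ℤ + Q + Q * Q + Q * Q * Q * U + Q * Q * U) * (1ℤ + Q) + Q * Q * Q * Q * x) k-formula ⟨
        (1ℤ + Q + Q * Q + Q * Q * Q * U + Q * Q * U) * (1ℤ + Q) + Q * Q * Q * Q * ((1ℤ + Q) * ℤ.+ k)
          ≡⟨ collect Q U (ℤ.+ k) ⟩
        (1ℤ + Q + Q * Q + Q * Q * Q * U + Q * Q * U + Q * Q * Q * Q * ℤ.+ k) * (1ℤ + Q) ∎)
        where
        open ≡.≡-Reasoning
        expand : ∀ q u → (1ℤ + q + q * q + q * q * q * u) * (1ℤ + q + q * q * u) ≡
                 (1ℤ + q + q * q + q * q * q * u + q * q * u) * (1ℤ + q) + q * q * q * q * (u * (1ℤ + q * u))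
        expand = solve-∀
        collect : ∀ q u k → (1ℤ + q + q * q + q * q * q * u + q * q * u) * (1ℤ + q) + q * q * q * q * ((1ℤ + q) * k) ≡
                  (1ℤ + q + q * q + q * q * q * u + q * q * u + q * q * q * q * k) * (1ℤ + q)
        collect = solve-∀

    -- Makes the truncated subtraction in `g` a true difference.
    points≤lines : v ℕ.≤ l
    points≤lines = ℤ.drop‿+≤+ (subst (ℤ.+ v ℤ.≤_) (begin
      ℤ.+ v + ℤ.+ (q ℕ.* q ℕ.* u ℕ.+ q ℕ.* q ℕ.* q ℕ.* q ℕ.* k)
        ≡⟨ cong₂ _+_ v-formula (cong₂ _+_ (cast₂ u) (trans (ℤ.pos-* (q ℕ.* q ℕ.* q ℕ.* q) k)
             (cong (_* ℤ.+ k) (trans (ℤ.pos-* (q ℕ.* q ℕ.* q) q) (cong (_* Q) (cast₂ q)))))) ⟩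
      1ℤ + Q + Q * Q + Q * Q * Q * U + (Q * Q * U + Q * Q * Q * Q * ℤ.+ k)
        ≡⟨ ℤ.+-assoc (1ℤ + Q + Q * Q + Q * Q * Q * U) (Q * Q * U) (Q * Q * Q * Q * ℤ.+ k) ⟨
      1ℤ + Q + Q * Q + Q * Q * Q * U + Q * Q * U + Q * Q * Q * Q * ℤ.+ k  ≡⟨ l-formula ⟨
      ℤ.+ l ∎) (ℤ.+≤+ (ℕ.m≤m+n v _)))
      where
      open ≡.≡-Reasoning
      cast₂ : ∀ x → ℤ.+ (q ℕ.* q ℕ.* x) ≡ Q * Q * ℤ.+ x
      cast₂ x = trans (ℤ.pos-* (q ℕ.* q) x) (cong (_* ℤ.+ x) (ℤ.pos-* q q))

    k-identity : k ℕ.* suc q ≡ pointCount K (suc m) ℕ.* u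
    k-identity = ℤ.+-injective (trans (ℤ.pos-* k (suc q)) (trans (lineCount K m) (sym (ℤ.pos-* (pointCount K (suc m)) u))))

    -- Over ℤ localised at ℓ, the matrix is equivalent to diag(1^g, u^f, k).
    module _ {ℓ} (ℓ-prime : Prime ℓ) (ℓ∤q : ℓ ∤ q) where
      skewLinesIso : ∀ {v′} → v ≡ 2 ℕ.+ v′ → ∀ j → let M = ℤ.+ (ℓ ℕ.^ suc j) in
                     KernelIso M (Kernel M (skewLinesMatrix (3 ℕ.+ m))) (DiagonalKernel M (elementaryDivisors {1 ℕ.+ v′} u k))
      skewLinesIso {v′} v≡ j = KernelIso-trans
        (pointKernelIso (incidence K (3 ℕ.+ m)) (skewLinesMatrix (3 ℕ.+ m)) Q U (ℤ.+ w)
          (common-points K (3 ℕ.+ m))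
          (λ i i′ → trans (common-lines K (suc m) i i′) (cong (λ x → Q * x * δ i i′ + 1ℤ) (pointCount-sucℤ K m)))
          (degree K (2 ℕ.+ m)) M q′ q-unit)
        (transport v≡ w-formula l-formula)
        where
        M = ℤ.+ (ℓ ℕ.^ suc j)
        q′ = proj₁ (inverse-mod-ℓ^ ℓ-prime ℓ∤q (suc j))
        q-unit = proj₂ (inverse-mod-ℓ^ ℓ-prime ℓ∤q (suc j))
        transport : ∀ {v″ w″ l″} → v″ ≡ 2 ℕ.+ v′ → w″ ≡ 1ℤ + Q + Q * Q * U →
                    l″ ≡ 1ℤ + Q + Q * Q + Q * Q * Q * U + Q * Q * U + Q * Q * Q * Q * ℤ.+ k →
                    KernelIso M (PointKernel M Q U w″ l″ {v″}) (DiagonalKernel M (elementaryDivisors {1 ℕ.+ v′} u k))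
        transport refl refl refl = elementaryDivisorsIso Q u k M q′ q-unit
          (trans (cong ℤ.+_ (sym v≡)) v-formula) k-formula

      module _ {d} (snf : IsSmithNormalForm (skewLinesMatrix (3 ℕ.+ m)) d) where
        private
          two-points : ∃ λ v′ → v ≡ 2 ℕ.+ v′
          -- `v = 1 + q w` with `q` and `w` positive, so `v′` is `q w - 1`.
          two-points with pointCount K (2 ℕ.+ m) | pointCount-suc K (2 ℕ.+ m) | pointCount-suc K (1 ℕ.+ m)
          ... | suc w′ | v≡ | _ = w′ ℕ.+ (q ℕ.∸ 1) ℕ.* suc w′ , trans v≡ (cong suc (begin
            q ℕ.* suc w′                             ≡⟨ cong (ℕ._* suc w′) (ℕ.suc-pred q {{q-nonZero K}}) ⟨
            suc (q ℕ.∸ 1) ℕ.* suc w′                  ≡⟨⟩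
            suc (w′ ℕ.+ (q ℕ.∸ 1) ℕ.* suc w′)         ∎))
            where open ≡.≡-Reasoning

          v′ = proj₁ two-points
          v≡ = proj₂ two-points
          model = elementaryDivisors {1 ℕ.+ v′} u k

          multiplicity-model : ∀ i → multiplicity model ℓ i ≡
                               𝟙 (hasValuation? ℓ k i) ℕ.+ (v ℕ.∸ 1) ℕ.* 𝟙 (hasValuation? ℓ u i)
          multiplicity-model i = trans (count-suc (λ j → hasValuation? ℓ (model j) i))
            (cong (𝟙 (hasValuation? ℓ k i) ℕ.+_) (trans (count-const (hasValuation? ℓ u i))
              (cong (λ f → f ℕ.* 𝟙 (hasValuation? ℓ u i)) (cong (ℕ._∸ 1) (sym v≡)))))

        skewLines-multiplicity : ∀ i → multiplicity d ℓ i ≡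
          𝟙 (i ℕ.≟ 0) ℕ.* (l ℕ.∸ v) ℕ.+ (𝟙 (hasValuation? ℓ k i) ℕ.+ (v ℕ.∸ 1) ℕ.* 𝟙 (hasValuation? ℓ u i))
        skewLines-multiplicity zero    = trans
          (multiplicity-zero ℓ-prime {d′ = model} snf (skewLinesIso v≡) {l ℕ.∸ v}
            (trans (sym (ℕ.m∸n+n≡m points≤lines)) (cong (l ℕ.∸ v ℕ.+_) v≡)))
          (cong₂ ℕ._+_ (sym (ℕ.*-identityˡ (l ℕ.∸ v))) (multiplicity-model 0))
        skewLines-multiplicity (suc i) = trans (multiplicity-suc ℓ-prime {d′ = model} snf (skewLinesIso v≡) i) (multiplicity-model (suc i))

        skewLines-trivial : ℓ ∤ u → ℓ ∤ k → ∃ λ (S : Finite (cokernel (skewLinesMatrix (3 ℕ.+ m)))) → ℓ ∤ card S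
        skewLines-trivial ℓ∤u ℓ∤k =
          -- Zero is divisible by ℓ, so divisors prime to ℓ are nonzero and finiteness of the
          -- cokernel comes for free.
          let S , card≡ = cokernel-finite snf (λ i d≡0 → ℓ∤d i (subst (ℓ ∣_) (sym d≡0) (ℓ ℕ.∣0)))
          in S , subst (ℓ ∤_) (sym card≡) (∤-∏ ℓ-prime d ℓ∤d)
          where
          ℓ∤d = divisor-free ℓ-prime {d′ = model} snf (skewLinesIso v≡) λ { zero → ℓ∤k ; (suc _) → ℓ∤u }

-- q-numbers

module _ where
  open import Data.Nat.Base using (_+_; _*_; _∸_; _/_; _%_; _^_; NonTrivial; NonZero; 2+)
  open ≡.≡-Reasoning

  -- The geometric sum in Horner form. It avoids the quotient in `qNumber` and satisfies the
  -- recursion of `pointCount`.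
  repunit : ℕ → ℕ → ℕ
  repunit Q zero    = 0
  repunit Q (suc m) = 1 + Q * repunit Q m

  repunit-^ : ∀ k m → suc k ^ m ≡ 1 + repunit (suc k) m * k
  repunit-^ k zero    = refl
  repunit-^ k (suc m) = trans (cong (suc k *_) (repunit-^ k m)) (expand k (repunit (suc k) m))
    where
    expand : ∀ k r → suc k * (1 + r * k) ≡ 1 + (1 + suc k * r) * k
    expand = ℕ-solve-∀

  qNumber≡repunit : ∀ Q .{{_ : NonTrivial Q}} m → qNumber Q m ≡ repunit Q m
  qNumber≡repunit Q@(2+ k) m = trans (cong (λ x → (x ∸ 1) / suc k) (repunit-^ (suc k) m))
    (ℕ.m*n/n≡m (repunit Q m) (suc k))

  ^2-nonTrivial : ∀ Q → .{{NonTrivial Q}} → NonTrivial (Q ^ 2)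
  ^2-nonTrivial (2+ _) = _

  pointCount≡repunit : ∀ {c r q} (K : FiniteField c r q) m → pointCount K m ≡ repunit q m
  pointCount≡repunit         K zero    = refl
  pointCount≡repunit {q = q} K (suc m) = trans (pointCount-suc K m) (cong (λ x → 1 + q * x) (pointCount≡repunit K m))

  repunit-double : ∀ q h → repunit q (h * 2) ≡ suc q * repunit (q ^ 2) h
  repunit-double q zero    = sym (ℕ.*-zeroʳ q)
  repunit-double q (suc h) = trans (cong (λ x → 1 + q * (1 + q * x)) (repunit-double q h)) (expand q (repunit (q ^ 2) h))
    where
    expand : ∀ q r → 1 + q * (1 + q * (suc q * r)) ≡ suc q * (1 + q * (q * 1) * r)
    expand = ℕ-solve-∀

  ∤-suc-multiple : ∀ {ℓ a} b → Prime ℓ → ℓ ∣ a → ℓ ∤ 1 + b * a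
  ∤-suc-multiple {ℓ} {a} b ℓ-prime ℓ∣a ℓ∣1+ba = ¬prime[1] (subst Prime
    (ℕ.∣1⇒≡1 (ℕ.∣m+n∣m⇒∣n (subst (ℓ ∣_) (ℕ.+-comm 1 (b * a)) ℓ∣1+ba) (ℕ.∣n⇒∣m*n b ℓ∣a))) ℓ-prime)

  -- For odd `m` the q-number is `1 + q [m-1]`, where `m - 1` is even and ℓ divides `1 + q`, hence
  -- `[m-1]`; so ℓ could not divide it. This is the parity remark in the theorem.
  repunit-even : ∀ {ℓ q} → Prime ℓ → ℓ ∣ suc q → ∀ m → ℓ ∣ repunit q m → repunit q m ≡ suc q * repunit (q ^ 2) (m / 2)
  repunit-even {ℓ} {q} ℓ-prime ℓ∣1+q m ℓ∣ with m % 2 | ℕ.m%n<n m 2 | ℕ.m≡m%n+[m/n]*n m 2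
  ... | 0 | _ | m≡ = trans (cong (repunit q) m≡) (repunit-double q (m / 2))
  ... | 1 | _ | m≡ = contradiction (subst (ℓ ∣_) (cong (repunit q) m≡) ℓ∣)
    (∤-suc-multiple q ℓ-prime (subst (ℓ ∣_) (sym (repunit-double q (m / 2))) (ℕ.∣m⇒∣m*n _ ℓ∣1+q)))
  ... | 2+ _ | ℕ.s≤s (ℕ.s≤s ()) | _

-- Valuations

  ∣⇒valuation≢0 : ∀ {ℓ x} a → ℓ ∣ x → HasValuation ℓ x a → a ≢ 0
  ∣⇒valuation≢0 {ℓ} {x} _ ℓ∣x (_ , ∤) refl = ∤ (subst (_∣ x) (sym (ℕ.^-identityʳ ℓ)) ℓ∣x)

  ∤⇒valuation-0 : ∀ {ℓ x} → ℓ ∤ x → HasValuation ℓ x 0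
  ∤⇒valuation-0 {ℓ} {x} ℓ∤x = ℕ.1∣ x , λ ∣ → ℓ∤x (subst (_∣ x) (ℕ.^-identityʳ ℓ) ∣)

  ^-mono-∣ : ∀ ℓ {a b} → a ℕ.≤ b → ℓ ^ a ∣ ℓ ^ b
  ^-mono-∣ ℓ {a} {b} a≤b = subst (λ c → ℓ ^ a ∣ ℓ ^ c) (ℕ.m+[n∸m]≡n a≤b)
    (subst (ℓ ^ a ∣_) (sym (ℕ.^-distribˡ-+-* ℓ a (b ∸ a))) (ℕ.m∣m*n (ℓ ^ (b ∸ a))))

  valuation-unique : ∀ {ℓ x} a b → HasValuation ℓ x a → HasValuation ℓ x b → a ≡ b
  valuation-unique {ℓ} {x} a b (ℓᵃ∣ , ∤a) (ℓᵇ∣ , ∤b) with ℕ.<-cmp a b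
  ... | tri≈ _ a≡b _ = a≡b
  ... | tri< a<b _ _ = contradiction (ℕ.∣-trans (^-mono-∣ ℓ a<b) ℓᵇ∣) ∤a
  ... | tri> _ _ b<a = contradiction (ℕ.∣-trans (^-mono-∣ ℓ b<a) ℓᵃ∣) ∤b

  module _ {ℓ} (ℓ-prime : Prime ℓ) where
    private
      instance
        ℓ-nonZero : NonZero ℓ
        ℓ-nonZero = prime⇒nonZero ℓ-prime

    valuation-cancelʳ : ∀ {x y} a → ℓ ∤ y → HasValuation ℓ (x * y) a → HasValuation ℓ x a
    valuation-cancelʳ {x} {y} a ℓ∤y (ℓᵃ∣ , ∤) = ^∣-cancelʳ ℓ-prime a x y ℓ∤y ℓᵃ∣ , λ ∣x → ∤ (ℕ.∣m⇒∣m*n y ∣x)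

    valuation-* : ∀ {x y} a b → HasValuation ℓ x a → HasValuation ℓ y b → HasValuation ℓ (x * y) (a + b)
    valuation-* a b (ℕ.divides s refl , ∤x) (ℕ.divides t refl , ∤y) =
      ℕ.divides (s * t) product , λ ∣xy →
        [ (λ ℓ∣s → ∤x (ℕ.*-monoˡ-∣ (ℓ ^ a) ℓ∣s)) , (λ ℓ∣t → ∤y (ℕ.*-monoˡ-∣ (ℓ ^ b) ℓ∣t)) ]′
        (euclidsLemma s t ℓ-prime (ℕ.*-cancelʳ-∣ (ℓ ^ (a + b)) {{ℕ.m^n≢0 ℓ (a + b)}}
          (subst (ℓ * ℓ ^ (a + b) ∣_) product ∣xy)))
      where
      product : s * ℓ ^ a * (t * ℓ ^ b) ≡ s * t * ℓ ^ (a + b)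
      product = trans (regroup s t (ℓ ^ a) (ℓ ^ b)) (cong (s * t *_) (sym (ℕ.^-distribˡ-+-* ℓ a b)))
        where
        regroup : ∀ s t x y → s * x * (t * y) ≡ s * t * (x * y)
        regroup = ℕ-solve-∀

  𝟙-yes : ∀ {p} {P : Set p} (P? : Dec P) → P → 𝟙 P? ≡ 1
  𝟙-yes (yes _) _ = refl
  𝟙-yes (no ¬p) p = contradiction p ¬p

  𝟙-no : ∀ {p} {P : Set p} (P? : Dec P) → ¬ P → 𝟙 P? ≡ 0
  𝟙-no (yes p) ¬p = contradiction p ¬p
  𝟙-no (no _)  _  = refl

  prime-∤-^ : ∀ {ℓ p} → Prime ℓ → Prime p → ℓ ≢ p → ∀ t → ℓ ∤ p ^ t
  prime-∤-^ ℓ-prime p-prime ℓ≢p zero    ℓ∣1 = ¬prime[1] (subst Prime (ℕ.∣1⇒≡1 ℓ∣1) ℓ-prime)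
  prime-∤-^ {p = p} ℓ-prime p-prime ℓ≢p (suc t) ℓ∣ with euclidsLemma p (p ^ t) ℓ-prime ℓ∣
  ... | inj₂ ℓ∣p^t = prime-∤-^ ℓ-prime p-prime ℓ≢p t ℓ∣p^t
  ... | inj₁ ℓ∣p with prime⇒irreducible p-prime ℓ∣p
  ...   | inj₁ refl = ¬prime[1] ℓ-prime
  ...   | inj₂ ℓ≡p  = ℓ≢p ℓ≡p

  -- From here on only arithmetic remains. `x` and `u` stand for `[n-2]` and `[n-3]`, `k` for the
  -- number of lines in dimension `n - 2`, and `y`, `y′` for the q²-numbers at the halves of `n - 2`
  -- and `n - 3`. The factorisations by `1 + q` are conditional because they fail for the other
  -- parity.
  module ElementaryDivisorCases {ℓ} (ℓ-prime : Prime ℓ) (f g q u k x y y′ : ℕ) (e : ℕ → ℕ)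
    (e-formula : ∀ i → e i ≡ 𝟙 (i ℕ.≟ 0) * g + (𝟙 (hasValuation? ℓ k i) + f * 𝟙 (hasValuation? ℓ u i)))
    (x-formula : x ≡ 1 + q * u) (k-formula : k * suc q ≡ x * u)
    (x-even : ℓ ∣ suc q → ℓ ∣ x → x ≡ suc q * y) (u-even : ℓ ∣ suc q → ℓ ∣ u → u ≡ suc q * y′) where

    -- Uniqueness of valuations replaces each valuation test at `i` by comparing `i` with the known
    -- valuation; `a`, `b`, `c` receive the outcomes of the comparisons.
    e-with-valuations : ∀ α β → HasValuation ℓ u α → HasValuation ℓ k β →
      ∀ i {a b c} → 𝟙 (i ℕ.≟ 0) ≡ a → 𝟙 (i ℕ.≟ β) ≡ b → 𝟙 (i ℕ.≟ α) ≡ c → e i ≡ a * g + (b + f * c)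
    e-with-valuations α β uα kβ i refl refl refl = trans (e-formula i)
      (cong₂ (λ b c → 𝟙 (i ℕ.≟ 0) * g + (b + f * c)) (indicator β kβ) (indicator α uα))
      where
      indicator : ∀ {z} γ → HasValuation ℓ z γ → 𝟙 (hasValuation? ℓ z i) ≡ 𝟙 (i ℕ.≟ γ)
      indicator {z} γ zγ with i ℕ.≟ γ
      ... | yes i≡γ = trans (𝟙-yes (hasValuation? ℓ z i) (subst (HasValuation ℓ z) (sym i≡γ) zγ)) (sym (𝟙-yes (i ℕ.≟ γ) i≡γ))
      ... | no i≢γ  = trans (𝟙-no (hasValuation? ℓ z i) (λ zi → i≢γ (valuation-unique i γ zi zγ))) (sym (𝟙-no (i ℕ.≟ γ) i≢γ))

    private
      ≟-refl : ∀ i → 𝟙 (i ℕ.≟ i) ≡ 1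
      ≟-refl i = 𝟙-yes (i ℕ.≟ i) refl

      ≟-no : ∀ {i j} → i ≢ j → 𝟙 (i ℕ.≟ j) ≡ 0
      ≟-no {i} {j} = 𝟙-no (i ℕ.≟ j)

      f*0 : f * 0 ≡ 0
      f*0 = ℕ.*-zeroʳ f

      f*1 : f * 1 ≡ f
      f*1 = ℕ.*-identityʳ f

      none : 0 + (0 + f * 0) ≡ 0
      none = f*0

    both-zero : ℓ ∤ u → ℓ ∤ k → ∀ i → i ≢ 0 → e i ≡ 0
    both-zero ℓ∤u ℓ∤k i i≢0 = trans
      (e-with-valuations 0 0 (∤⇒valuation-0 ℓ∤u) (∤⇒valuation-0 ℓ∤k) i (≟-no i≢0) (≟-no i≢0) (≟-no i≢0)) none

    u-zero : ∀ a → HasValuation ℓ u 0 → HasValuation ℓ k a → a ≢ 0 →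
             e a ≡ 1 × e 0 ≡ f + g × (∀ i → i ≢ a → i ≢ 0 → e i ≡ 0)
    u-zero a u0 ka a≢0 =
        trans (e-with-valuations 0 a u0 ka a (≟-no a≢0) (≟-refl a) (≟-no a≢0)) (cong suc f*0)
      , trans (e-with-valuations 0 a u0 ka 0 refl (≟-no (a≢0 ∘ sym)) refl)
          (trans (cong₂ _+_ (ℕ.*-identityˡ g) f*1) (ℕ.+-comm g f))
      , λ i i≢a i≢0 → trans (e-with-valuations 0 a u0 ka i (≟-no i≢0) (≟-no i≢a) (≟-no i≢0)) none

    both-equal : ∀ a → HasValuation ℓ u a → HasValuation ℓ k a → a ≢ 0 →
                 e a ≡ f + 1 × e 0 ≡ g × (∀ i → i ≢ a → i ≢ 0 → e i ≡ 0)
    both-equal a ua ka a≢0 =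
        trans (e-with-valuations a a ua ka a (≟-no a≢0) (≟-refl a) (≟-refl a)) (trans (cong suc f*1) (ℕ.+-comm 1 f))
      , trans (e-with-valuations a a ua ka 0 refl (≟-no (a≢0 ∘ sym)) (≟-no (a≢0 ∘ sym)))
          (trans (cong₂ _+_ (ℕ.*-identityˡ g) f*0) (ℕ.+-identityʳ g))
      , λ i i≢a i≢0 → trans (e-with-valuations a a ua ka i (≟-no i≢0) (≟-no i≢a) (≟-no i≢a)) none

    k-zero : ∀ a → HasValuation ℓ u a → HasValuation ℓ k 0 → a ≢ 0 →
             e a ≡ f × e 0 ≡ g + 1 × (∀ i → i ≢ a → i ≢ 0 → e i ≡ 0)
    k-zero a ua k0 a≢0 =
        trans (e-with-valuations a 0 ua k0 a (≟-no a≢0) (≟-no a≢0) (≟-refl a)) f*1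
      , trans (e-with-valuations a 0 ua k0 0 refl refl (≟-no (a≢0 ∘ sym)))
          (cong₂ _+_ (ℕ.*-identityˡ g) (cong suc f*0))
      , λ i i≢a i≢0 → trans (e-with-valuations a 0 ua k0 i (≟-no i≢0) (≟-no i≢0) (≟-no i≢a)) none

    distinct : ∀ a b → HasValuation ℓ u (a + b) → HasValuation ℓ k b → a ≢ 0 → b ≢ 0 →
               e (a + b) ≡ f × e b ≡ 1 × e 0 ≡ g × (∀ i → i ≢ a + b → i ≢ b → i ≢ 0 → e i ≡ 0)
    distinct a b ua kb a≢0 b≢0 =
        trans (e-with-valuations (a + b) b ua kb (a + b) (≟-no a+b≢0) (≟-no a+b≢b) (≟-refl (a + b))) f*1
      , trans (e-with-valuations (a + b) b ua kb b (≟-no b≢0) (≟-refl b) (≟-no (a+b≢b ∘ sym))) (cong suc f*0)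
      , trans (e-with-valuations (a + b) b ua kb 0 refl (≟-no (b≢0 ∘ sym)) (≟-no (a+b≢0 ∘ sym)))
          (trans (cong₂ _+_ (ℕ.*-identityˡ g) f*0) (ℕ.+-identityʳ g))
      , λ i i≢a+b i≢b i≢0 → trans (e-with-valuations (a + b) b ua kb i (≟-no i≢0) (≟-no i≢b) (≟-no i≢a+b)) none
      where
      a+b≢0 : a + b ≢ 0
      a+b≢0 h = a≢0 (ℕ.m+n≡0⇒m≡0 a h)
      a+b≢b : a + b ≢ b
      a+b≢b h = a≢0 (ℕ.+-cancelʳ-≡ b a 0 h)

    -- `x = 1 + q u` makes `x` and `u` coprime.
    ℓ∣u⇒ℓ∤x : ℓ ∣ u → ℓ ∤ x
    ℓ∣u⇒ℓ∤x ℓ∣u ℓ∣x = ∤-suc-multiple q ℓ-prime ℓ∣u (subst (ℓ ∣_) x-formula ℓ∣x)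

    private
      ∤-* : ∀ {a b} → ℓ ∤ a → ℓ ∤ b → ℓ ∤ a * b
      ∤-* {a} {b} ℓ∤a ℓ∤b ℓ∣ab = [ ℓ∤a , ℓ∤b ]′ (euclidsLemma a b ℓ-prime ℓ∣ab)

      -- Here ℓ divides `1 + q`, so this factor cannot be ignored at ℓ. It is cancelled in ℕ against
      -- the same factor of `x`, leaving a product whose valuation can be read off.
      k≡y*u : ℓ ∣ suc q → ℓ ∣ x → k ≡ y * u
      k≡y*u ℓ∣1+q ℓ∣x = ℕ.*-cancelʳ-≡ k (y * u) (suc q) (trans k-formula
        (trans (cong (_* u) (x-even ℓ∣1+q ℓ∣x)) (regroup (suc q) y u)))
        where
        regroup : ∀ a b c → a * b * c ≡ b * c * a
        regroup = ℕ-solve-∀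

      k≡x*y′ : ℓ ∣ suc q → ℓ ∣ u → k ≡ x * y′
      k≡x*y′ ℓ∣1+q ℓ∣u = ℕ.*-cancelʳ-≡ k (x * y′) (suc q) (trans k-formula
        (trans (cong (x *_) (u-even ℓ∣1+q ℓ∣u)) (regroup x (suc q) y′)))
        where
        regroup : ∀ a b c → a * (b * c) ≡ a * c * b
        regroup = ℕ-solve-∀

    -- `T` stands for the statement that the cokernel is finite of order prime to ℓ, which is
    -- supplied from outside since the matrix is absent here.
    classification : ∀ {t} {T : Set t} → (ℓ ∤ u → ℓ ∤ k → T) →
      let ℓ-trivial = T × (∀ i → i ≢ 0 → e i ≡ 0) in
      (ℓ ∤ suc q →
        (ℓ ∤ x → ℓ ∤ u → ℓ-trivial) ×
        (ℓ ∣ x → ℓ ∤ u → ∀ a → HasValuation ℓ k a →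
          e a ≡ 1 × e 0 ≡ f + g × (∀ i → i ≢ a → i ≢ 0 → e i ≡ 0)) ×
        (ℓ ∤ x → ℓ ∣ u → ∀ a → HasValuation ℓ u a →
          e a ≡ f + 1 × e 0 ≡ g × (∀ i → i ≢ a → i ≢ 0 → e i ≡ 0))) ×
      (ℓ ∣ suc q →
        (ℓ ∣ x → ℓ ∤ y → ℓ-trivial) ×
        (ℓ ∣ x → ℓ ∣ y → ∀ a → HasValuation ℓ k a →
          e a ≡ 1 × e 0 ≡ f + g × (∀ i → i ≢ a → i ≢ 0 → e i ≡ 0)) ×
        (ℓ ∣ u → ℓ ∤ y′ → ∀ a → HasValuation ℓ u a →
          e a ≡ f × e 0 ≡ g + 1 × (∀ i → i ≢ a → i ≢ 0 → e i ≡ 0)) ×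
        (ℓ ∣ u → ℓ ∣ y′ → ∀ a b → HasValuation ℓ (suc q) a → HasValuation ℓ (u / suc q) b →
          e (a + b) ≡ f × e b ≡ 1 × e 0 ≡ g × (∀ i → i ≢ a + b → i ≢ b → i ≢ 0 → e i ≡ 0)))
    classification trivial = (λ ℓ∤1+q →
        (λ ℓ∤x ℓ∤u →
          let ℓ∤k = λ ℓ∣k → ∤-* ℓ∤x ℓ∤u (subst (ℓ ∣_) k-formula (ℕ.∣m⇒∣m*n (suc q) ℓ∣k))
          in trivial ℓ∤u ℓ∤k , both-zero ℓ∤u ℓ∤k)
      , (λ ℓ∣x ℓ∤u a ka →
          let ℓ∣k = [ (λ h → h) , (λ h → contradiction h ℓ∤1+q) ]′
                      (euclidsLemma k (suc q) ℓ-prime (subst (ℓ ∣_) (sym k-formula) (ℕ.∣m⇒∣m*n u ℓ∣x)))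
          in u-zero a (∤⇒valuation-0 ℓ∤u) ka (∣⇒valuation≢0 a ℓ∣k ka))
      -- `x` and `1 + q` are units at ℓ, so `k (1 + q) = x u` gives `k` the valuation of `u`.
      , (λ ℓ∤x ℓ∣u a ua →
          both-equal a ua (valuation-cancelʳ ℓ-prime a ℓ∤1+q (subst (λ z → HasValuation ℓ z a) (sym k-formula)
            (valuation-* ℓ-prime 0 a (∤⇒valuation-0 ℓ∤x) ua))) (∣⇒valuation≢0 a ℓ∣u ua)))
      , (λ ℓ∣1+q →
        (λ ℓ∣x ℓ∤y →
          let ℓ∤u = λ ℓ∣u → ℓ∣u⇒ℓ∤x ℓ∣u ℓ∣x
              ℓ∤k = subst (ℓ ∤_) (sym (k≡y*u ℓ∣1+q ℓ∣x)) (∤-* ℓ∤y ℓ∤u)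
          in trivial ℓ∤u ℓ∤k , both-zero ℓ∤u ℓ∤k)
      , (λ ℓ∣x ℓ∣y a ka →
          u-zero a (∤⇒valuation-0 (λ ℓ∣u → ℓ∣u⇒ℓ∤x ℓ∣u ℓ∣x)) ka
            (∣⇒valuation≢0 a (subst (ℓ ∣_) (sym (k≡y*u ℓ∣1+q ℓ∣x)) (ℕ.∣m⇒∣m*n u ℓ∣y)) ka))
      , (λ ℓ∣u ℓ∤y′ a ua →
          k-zero a ua (∤⇒valuation-0 (subst (ℓ ∤_) (sym (k≡x*y′ ℓ∣1+q ℓ∣u)) (∤-* (ℓ∣u⇒ℓ∤x ℓ∣u) ℓ∤y′)))
            (∣⇒valuation≢0 a ℓ∣u ua))
      -- The quotient is exactly `y′`, so `u = (1 + q) y′` has valuation `a + b`, while `k = x y′`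
      -- with `x` a unit at ℓ has valuation `b`.
      , (λ ℓ∣u ℓ∣y′ a b 1+qa y′b₀ →
          let u/[1+q]≡y′ = trans (cong (_/ suc q) (trans (u-even ℓ∣1+q ℓ∣u) (ℕ.*-comm (suc q) y′))) (ℕ.m*n/n≡m y′ (suc q))
              y′b        = subst (λ z → HasValuation ℓ z b) u/[1+q]≡y′ y′b₀
          in distinct a b (subst (λ z → HasValuation ℓ z (a + b)) (sym (u-even ℓ∣1+q ℓ∣u)) (valuation-* ℓ-prime a b 1+qa y′b))
               (subst (λ z → HasValuation ℓ z b) (sym (k≡x*y′ ℓ∣1+q ℓ∣u))
                 (valuation-* ℓ-prime 0 b (∤⇒valuation-0 (ℓ∣u⇒ℓ∤x ℓ∣u)) y′b))
               (∣⇒valuation≢0 a ℓ∣1+q 1+qa) (∣⇒valuation≢0 b ℓ∣y′ y′b)))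

open import Data.Nat.Base using (_+_; _^_; _∸_; _/_; _≥_; s≤s)

mainTheorem8 :
  ∀ {c r} (p t n : ℕ) → Prime p → t ≥ 1 → n ≥ 4 →
  (K : FiniteField c r (p ^ t)) →
  (ℓ : ℕ) → Prime ℓ → ℓ ≢ p →
  let open LinearAlgebra K
      q = p ^ t
      A = skewLinesMatrix n
      f = [ n ] ∸ 1
      g = gaussianBinomial n 2 ∸ [ n ]
  in
  ∃ (IsSmithNormalForm A) ×
  (∀ d → IsSmithNormalForm A d →
    let e = multiplicity d ℓ
        ℓ-trivial = (∃ λ (S : Finite (cokernel A)) → ℓ ∤ card S) × (∀ i → i ≢ 0 → e i ≡ 0)
    in
    (ℓ ∤ suc q →
      (ℓ ∤ [ n ∸ 2 ] → ℓ ∤ [ n ∸ 3 ] → ℓ-trivial) ×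
      (ℓ ∣ [ n ∸ 2 ] → ℓ ∤ [ n ∸ 3 ] →
        ∀ a → HasValuation ℓ (gaussianBinomial (n ∸ 2) 2) a →
        e a ≡ 1 × e 0 ≡ f + g × (∀ i → i ≢ a → i ≢ 0 → e i ≡ 0)) ×
      (ℓ ∤ [ n ∸ 2 ] → ℓ ∣ [ n ∸ 3 ] →
        ∀ a → HasValuation ℓ [ n ∸ 3 ] a →
        e a ≡ f + 1 × e 0 ≡ g × (∀ i → i ≢ a → i ≢ 0 → e i ≡ 0))) ×
    (ℓ ∣ suc q →
      (ℓ ∣ [ n ∸ 2 ] → ℓ ∤ [ (n ∸ 2) / 2 ]q² → ℓ-trivial) ×
      (ℓ ∣ [ n ∸ 2 ] → ℓ ∣ [ (n ∸ 2) / 2 ]q² →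
        ∀ a → HasValuation ℓ (gaussianBinomial (n ∸ 2) 2) a →
        e a ≡ 1 × e 0 ≡ f + g × (∀ i → i ≢ a → i ≢ 0 → e i ≡ 0)) ×
      (ℓ ∣ [ n ∸ 3 ] → ℓ ∤ [ (n ∸ 3) / 2 ]q² →
        ∀ a → HasValuation ℓ [ n ∸ 3 ] a →
        e a ≡ f × e 0 ≡ g + 1 × (∀ i → i ≢ a → i ≢ 0 → e i ≡ 0)) ×
      (ℓ ∣ [ n ∸ 3 ] → ℓ ∣ [ (n ∸ 3) / 2 ]q² →
        ∀ a b → HasValuation ℓ (suc q) a → HasValuation ℓ ([ n ∸ 3 ] / suc q) b →
        e (a + b) ≡ f × e b ≡ 1 × e 0 ≡ g ×
        (∀ i → i ≢ a + b → i ≢ b → i ≢ 0 → e i ≡ 0))))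
mainTheorem8 p t (suc (suc (suc m))) p-prime _ (s≤s (s≤s (s≤s _))) K ℓ ℓ-prime ℓ≢p =
  smithNormalForm (skewLinesMatrix (3 + m)) , λ d snf →
    let open ElementaryDivisorCases ℓ-prime ([ 3 + m ] ∸ 1) (gaussianBinomial (3 + m) 2 ∸ [ 3 + m ]) q
               [ m ] (gaussianBinomial (1 + m) 2) [ 1 + m ] ([ (1 + m) / 2 ]q²) ([ m / 2 ]q²) (multiplicity d ℓ)
               (λ i → ≡.subst₂ (λ v u → multiplicity d ℓ i ≡
                   𝟙 (i ℕ.≟ 0) ℕ.* (gaussianBinomial (3 + m) 2 ∸ v) +
                   (𝟙 (hasValuation? ℓ (gaussianBinomial (1 + m) 2) i) + (v ∸ 1) ℕ.* 𝟙 (hasValuation? ℓ u i)))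
                 (sym (points (3 + m))) (sym (points m)) (skewLines-multiplicity K m ℓ-prime ℓ∤q snf i))
               (trans (points (1 + m)) (trans (pointCount-suc K m) (cong (λ u → 1 + q ℕ.* u) (sym (points m)))))
               (trans (k-identity K m) (sym (cong₂ ℕ._*_ (points (1 + m)) (points m))))
               (even (1 + m)) (even m)
    in classification λ ℓ∤u ℓ∤k → skewLines-trivial K m ℓ-prime ℓ∤q snf (subst (ℓ ∤_) (points m) ℓ∤u) ℓ∤k
  where
  open LinearAlgebra K
  q = p ^ t
  ℓ∤q : ℓ ∤ q
  ℓ∤q = prime-∤-^ ℓ-prime p-prime ℓ≢p t
  points : ∀ i → [ i ] ≡ pointCount K i
  points i = trans (qNumber≡repunit q {{order-nonTrivial K}} i) (sym (pointCount≡repunit K i))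
  even : ∀ i → ℓ ∣ suc q → ℓ ∣ [ i ] → [ i ] ≡ suc q ℕ.* [ i / 2 ]q²
  even i ℓ∣1+q ℓ∣[i] = trans [i]≡ (trans
    (repunit-even ℓ-prime ℓ∣1+q i (subst (ℓ ∣_) [i]≡ ℓ∣[i]))
    (cong (suc q ℕ.*_) (sym (qNumber≡repunit (q ^ 2) {{^2-nonTrivial q {{order-nonTrivial K}}}} (i / 2)))))
    where [i]≡ = qNumber≡repunit q {{order-nonTrivial K}} i
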